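{- Every class of antipodal metric spaces from Cherlin's list has EPPA. That is, for every integer $\delta$ and every $K$ with $1\leq K\leq \frac{\delta}{2}$ or $K=\delta$, the class $\mathcal A^\delta_K$ has EPPA.
   Context: A class $\mathcal C$ of finite structures has the extension property for partial automorphisms (EPPA) if for every $A\in\mathcal C$ there is $B\in\mathcal C$ such that $A$ is an (induced) substructure of $B$ and every isomorphism between substructures of $A$ extends to an automorphism of $B$. Metric spaces with distances in $\{0,1,\ldots,\delta\}$ are viewed as relational structures with binary symmetric irreflexive relations $R^1,\ldots,R^\delta$ (one per nonzero distance, every pair of distinct points in exactly one relation). Cherlin's list describes the classes of finite metric spaces embeddable into the path-metric space of a countable metrically homogeneous graph (a connected graph in which every distance-preserving map between finite vertex sets extends to an automorphism). Its antipodal classes are $\mathcal A^\delta_K$, where $1\leq K\leq \frac{\delta}{2}$ or $K=\delta$: $\mathcal A^\delta_K$ is the class of all finite metric spaces with distances in $\{0,1,\ldots,\delta\}$ containing no triangle with distances $a,b,c$ such that (1) $a+b+c>2\delta$, or (2) $a+b+c$ is odd and $a+b+c<2K$, or (3) $a+b+c$ is odd and $a+b+c>2(\delta-K)+2\min(a,b,c)$. The case $K=\delta$ gives the bipartite antipodal classes; the others are the non-bipartite ones. -}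

module Defs where

open import Data.Nat using (ℕ; zero; suc; _+_; _*_; _≤_; _<_; _>_)
open import Data.Nat.Properties using ()
open import Data.Fin using (Fin)
open import Data.Maybe using (Maybe; just; nothing)
open import Data.Product using (Σ; _×_; _,_; ∃; ∃-syntax)
open import Data.Sum using (_⊎_)
open import Data.Empty using (⊥)
open import Relation.Nullary using (¬_)
open import Relation.Binary.PropositionalEquality using (_≡_)
open import Function.Definitions using (Injective)

Odd : ℕ → Set
Odd n = ∃[ k ] n ≡ suc (2 * k)

min3 : ℕ → ℕ → ℕ → ℕ
min3 a b c = a Data.Nat.⊓ b Data.Nat.⊓ c

-- A finite metric space with distances in {0,1,...,δ}, on carrier Fin n.
-- (Equivalently a relational structure with symmetric irreflexive relations
-- R^1..R^δ partitioning the pairs of distinct points.)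
record MetricSpace (δ : ℕ) : Set where
  field
    n     : ℕ
    d     : Fin n → Fin n → ℕ
    d≤δ   : ∀ x y → d x y ≤ δ
    d0⇒≡  : ∀ x y → d x y ≡ 0 → x ≡ y
    d-refl : ∀ x → d x x ≡ 0
    d-sym : ∀ x y → d x y ≡ d y x
    d-tri : ∀ x y z → d x z ≤ d x y + d y z
open MetricSpace public

Forbidden : (δ K a b c : ℕ) → Set
Forbidden δ K a b c =
    (a + b + c > 2 * δ)
  ⊎ (Odd (a + b + c) × a + b + c < 2 * K)
  ⊎ (Odd (a + b + c) × a + b + c > 2 * (δ Data.Nat.∸ K) + 2 * min3 a b c)

InA : (δ K : ℕ) → MetricSpace δ → Set
InA δ K A = ∀ x y z → ¬ Forbidden δ K (d A x y) (d A y z) (d A x z)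

Class : ℕ → Set₁
Class δ = MetricSpace δ → Set

record Embedding {δ : ℕ} (A B : MetricSpace δ) : Set where
  field
    f      : Fin (n A) → Fin (n B)
    f-inj  : Injective _≡_ _≡_ f
    f-pres : ∀ x y → d B (f x) (f y) ≡ d A x y
open Embedding public

-- A partial automorphism of A: an isomorphism between two substructures of A,
-- represented as a partial map (nothing = outside the domain) that preserves
-- distances (hence is injective, distance 0 only occurring on equal points).
PartialIso : {δ : ℕ} (A : MetricSpace δ) → (Fin (n A) → Maybe (Fin (n A))) → Set
PartialIso A p = ∀ x y x' y' → p x ≡ just x' → p y ≡ just y' → d A x' y' ≡ d A x y

record Automorphism {δ : ℕ} (B : MetricSpace δ) : Set where
  field
    g       : Fin (n B) → Fin (n B)
    g⁻¹     : Fin (n B) → Fin (n B)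
    inv-l   : ∀ x → g⁻¹ (g x) ≡ x
    inv-r   : ∀ x → g (g⁻¹ x) ≡ x
    g-pres  : ∀ x y → d B (g x) (g y) ≡ d B x y
open Automorphism public

EPPA : {δ : ℕ} → Class δ → Set
EPPA {δ} 𝒞 =
  (A : MetricSpace δ) → 𝒞 A →
  Σ (MetricSpace δ) λ B → 𝒞 B × Σ (Embedding A B) λ e →
    (p : Fin (n A) → Maybe (Fin (n A))) → PartialIso A p →
    Σ (Automorphism B) λ α →
      ∀ x x' → p x ≡ just x' → g α (f e x) ≡ f e x'

{-# OPTIONS --safe #-}
module Submission where

-- Antipodal pairs ("poles") are kept together by an involution τ with d (τ x , y) = δ − d (x , y).
-- Only distances at most δ/2 are kept as edges.
--
-- First, A embeds in a finite graph whose labels need not be a metric: a point holds a word for every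
-- pole, the label of two points is read off the sum of the words they hold for each other, and partial
-- isometries of A extend to automorphisms by permuting poles and adding suitable words.
--
-- Next, bad cycles (closed walks shorter than δ between antipodal points, violated triangle
-- inequalities, and odd closed walks shorter than 2K) are removed one length at a time. A shortest bad
-- cycle has no chords, while any two poles of A are joined by an edge, so A meets the cycle in at most
-- two consecutive poles; hence A and the automorphisms lift to a double cover along the cycle, in which
-- the cycle does not close up.
--
-- Once there are no bad cycles, the distance of x and z is the length of a shortest walk from x to z, or
-- δ minus that of a shortest walk from x to τ z, whenever that walk is short enough, and otherwise a
-- value next to δ/2. The bipartite classes differ in that distances are fixed modulo g = 2, and near δ/2
-- the label in the original graph decides between the two candidates.

-- The conditions on triangles reduce to two. Replacing a vertex by its antipode turns the two sides
-- at it into their complements to δ; this exchanges triangle inequalities with the bound 2δ on the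
-- perimeter, and the lower bound on odd perimeters with the upper ones. So it suffices to keep
-- distances compatible with τ and to control triangle inequalities and short odd perimeters.
--
-- The obstacle is the value for pairs without a short connection. Its values at (x , z) and (x , τ
-- z) must add up to δ, and when δ is odd or the parity is prescribed no choice is symmetric. Hence
-- labels exist for all pairs, and covers change adjacency only: the label breaks the tie in a way
-- that automorphisms respect.
--
-- A partial isometry may switch the points of some poles and not of others, so labels v must be
-- able to turn into δ - v pair by pair. On words this is an affine map, reversal followed by
-- complement, so it is compatible with sums, and the constant term can be put on either point of a
-- pair.
--
-- The removal of cycles stops because edges have positive length: with enough edges no closed walk
-- is short.

open import Data.Bool.Base using (Bool; true; false; not; _xor_; _∧_; if_then_else_)
open import Data.Bool.Properties using (xor-same; xor-comm; xor-assoc; xor-identityʳ; not-involutive)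
import Data.Bool.Properties as Bool
open import Data.Fin.Base as Fin using (Fin; zero; suc; toℕ; punchOut; combine; remQuot)
import Data.Fin.Properties as Fin
open import Data.Fin.Permutation.Components using (transpose; transpose-inverse)
open import Data.Nat
open import Data.Nat.Properties
open import Data.Nat.Divisibility
open import Data.Nat.DivMod
open import Data.List.Base using ([]; _∷_)
open import Data.Nat.Tactic.RingSolver using (solve)
open import Data.Product using (Σ; _×_; _,_; ∃; ∃₂; proj₁; proj₂; uncurry)
open import Data.Sum.Base using (_⊎_; inj₁; inj₂)
open import Data.Empty using (⊥; ⊥-elim)
open import Data.Maybe.Base using (Maybe; just; nothing)
open import Data.Maybe.Properties using () renaming (≡-dec to Maybe-≡-dec)
open import Data.Vec.Base as Vec using (Vec; lookup; tabulate)
open import Data.Vec.Properties using (lookup∘tabulate; tabulate∘lookup; tabulate-cong; map-∘; map-cong; map-id)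
open import Function.Base using (_∘_)
open import Function.Definitions using (Injective)
open import Function.Bundles using (mk⇔)
open import Relation.Nullary using (¬_; Dec; yes; no; does; contradiction)
open import Relation.Nullary.Decidable using (map′; _×-dec_; _⊎-dec_; _→-dec_; dec-true; dec-false; does-⇔; ¬?; from-yes)
open import Relation.Binary.PropositionalEquality
open import Relation.Binary.Definitions using (DecidableEquality; tri<; tri≈; tri>)
open import Defs using (Odd)

-- Farkas certificates: a summed hypothesis P ≤ Q, a multiplier, and a slack s, up to rounding.
lin : ∀ k s {x y P Q} → P ≤ Q → suc k * x + Q + s ≡ suc k * y + k + P → x ≤ y
lin k s {x} {y} {P} {Q} h eq = ≮⇒≥ λ y<x → <-irrefl (sym eq) (begin-strict
  suc k * y + k + P     ≡⟨ cong (_+ P) (+-comm (suc k * y) k) ⟩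
  k + suc k * y + P     <⟨ +-mono-<-≤ {y = suc (k + suc k * y)} (n<1+n _) h ⟩
  suc k + suc k * y + Q ≡⟨ cong (_+ Q) (sym (*-suc (suc k) y)) ⟩
  suc k * suc y + Q     ≤⟨ +-monoˡ-≤ Q (*-monoʳ-≤ (suc k) y<x) ⟩
  suc k * x + Q         ≤⟨ m≤m+n _ s ⟩
  suc k * x + Q + s     ∎)
  where open ≤-Reasoning

lin₀ : ∀ {x y P Q} → P ≤ Q → x + Q ≡ y + P → x ≤ y
lin₀ {x} {y} {P} {Q} h eq = +-cancelʳ-≤ Q x y (≤-trans (≤-reflexive eq) (+-monoʳ-≤ y h))

lin⊥ : ∀ s {P Q} → P ≤ Q → suc (Q + s) ≡ P → ⊥
lin⊥ s {P} {Q} h eq = <-irrefl refl (≤-trans (s≤s (m≤m+n Q s)) (≤-trans (≤-reflexive eq) h))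

infixr 4 _⊕_
_⊕_ : ∀ {a b c d} → a ≤ b → c ≤ d → a + c ≤ b + d
_⊕_ = +-mono-≤

eq≤ : ∀ {a b : ℕ} → a ≡ b → a ≤ b
eq≤ = ≤-reflexive

eq≥ : ∀ {a b : ℕ} → a ≡ b → b ≤ a
eq≥ = ≤-reflexive ∘ sym

-- Sums of bits

xor-cancelˡ : ∀ b c → b xor (b xor c) ≡ c
xor-cancelˡ b c = trans (sym (xor-assoc b b c)) (cong (_xor c) (xor-same b))

xor-cancelʳ : ∀ b c → (b xor c) xor c ≡ b
xor-cancelʳ b c = trans (xor-comm (b xor c) c) (trans (cong (c xor_) (xor-comm b c)) (xor-cancelˡ c b))

xor-injectiveʳ : ∀ c {b b′} → b xor c ≡ b′ xor c → b ≡ b′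
xor-injectiveʳ c {b} {b′} eq = trans (sym (xor-cancelʳ b c)) (trans (cong (_xor c) eq) (xor-cancelʳ b′ c))

xor-interchange : ∀ a b c d → (a xor b) xor (c xor d) ≡ (a xor c) xor (b xor d)
xor-interchange a b c d = begin
  (a xor b) xor (c xor d) ≡⟨ xor-assoc a b (c xor d) ⟩
  a xor (b xor (c xor d)) ≡⟨ cong (a xor_) (xor-assoc b c d) ⟨
  a xor ((b xor c) xor d) ≡⟨ cong (λ e → a xor (e xor d)) (xor-comm b c) ⟩
  a xor ((c xor b) xor d) ≡⟨ cong (a xor_) (xor-assoc c b d) ⟩
  a xor (c xor (b xor d)) ≡⟨ xor-assoc a c (b xor d) ⟨
  (a xor c) xor (b xor d) ∎
  where open ≡-Reasoning

xor-chain : ∀ a b c → (a xor b) xor (b xor c) ≡ a xor c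
xor-chain a b c = trans (xor-assoc a b (b xor c)) (cong (a xor_) (xor-cancelˡ b c))

xor-shift : ∀ b c x → (b xor x) xor (c xor x) ≡ b xor c
xor-shift b c x = trans (cong ((b xor x) xor_) (xor-comm c x)) (xor-chain b x c)

xor-transpose : ∀ a a′ b b′ → a xor b ≡ a′ xor b′ → a xor a′ ≡ b xor b′
xor-transpose a a′ b b′ eq = begin
  a xor a′                  ≡⟨ xor-chain a b a′ ⟨
  (a xor b) xor (b xor a′)  ≡⟨ cong₂ _xor_ eq (xor-comm b a′) ⟩
  (a′ xor b′) xor (a′ xor b) ≡⟨ cong (_xor (a′ xor b)) (xor-comm a′ b′) ⟩
  (b′ xor a′) xor (a′ xor b) ≡⟨ xor-chain b′ a′ b ⟩
  b′ xor b                  ≡⟨ xor-comm b′ b ⟩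
  b xor b′                  ∎
  where open ≡-Reasoning

not-xor-not : ∀ b c → not b xor not c ≡ b xor c
not-xor-not false c = not-involutive c
not-xor-not true  c = refl

complement-short : ∀ {δ v} → v ≤ δ → ¬ (2 * v ≤ δ) → 2 * (δ ∸ v) ≤ δ
complement-short {δ} {v} v≤δ ¬h = lin 0 1 {2 * (δ ∸ v)} {δ} {2 * (δ ∸ v + v) + suc δ} {2 * δ + 2 * v}
  (*-monoʳ-≤ 2 (eq≤ (m∸n+n≡m v≤δ)) ⊕ ≰⇒> ¬h) (identity (δ ∸ v) v δ)
  where
  identity : ∀ w v δ → 1 * (2 * w) + (2 * δ + 2 * v) + 1 ≡ 1 * δ + 0 + (2 * (w + v) + suc δ)
  identity w v δ = solve (w ∷ v ∷ δ ∷ [])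

-- Modulo a divisor of 2 every number is its own negative, so congruence of `x` and `y` is written
-- `g ∣ x + y`, without subtraction.
module Divisor2 {g : ℕ} (g∣2 : g ∣ 2) where

  g∣2* : ∀ n → g ∣ 2 * n
  g∣2* n = ∣-trans g∣2 (m∣m*n n)

  drop-2* : ∀ {m n p} → g ∣ p → p ≡ m + 2 * n → g ∣ m
  drop-2* {m} {n} h refl = ∣m+n∣m⇒∣n (subst (g ∣_) (+-comm m (2 * n)) h) (g∣2* n)

  -- Dropping `2 * x` from `x + y` leaves the difference, a positive multiple of `g`. Failed
  -- triangle inequalities are widened in this way until they become absurd.
  congruent-gap : ∀ {x y} → g ∣ x + y → x < y → x + g ≤ y
  congruent-gap {x} {y} h x<y with m≤n⇒∃[o]m+o≡n (<⇒≤ x<y)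
  ... | zero , refl = ⊥-elim (<-irrefl (sym (+-identityʳ x)) x<y)
  ... | suc k , refl = +-monoʳ-≤ x (∣⇒≤ (drop-2* {n = x} h lemma))
    where lemma : x + (x + suc k) ≡ suc k + 2 * x
          lemma = solve (x ∷ k ∷ [])

-- Finite types, tables and permutations

record Finite (V : Set) : Set where
  field
    size    : ℕ
    to      : V → Fin size
    from    : Fin size → V
    from-to : ∀ v → from (to v) ≡ v
    to-from : ∀ i → to (from i) ≡ i

  to-injective : Injective _≡_ _≡_ to
  to-injective {x} {y} h = trans (sym (from-to x)) (trans (cong from h) (from-to y))

  from-injective : Injective _≡_ _≡_ from
  from-injective {x} {y} h = trans (sym (to-from x)) (trans (cong to h) (to-from y))

  infix 4 _≟ᶠ_
  _≟ᶠ_ : DecidableEquality V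
  x ≟ᶠ y = map′ to-injective (cong to) (to x Fin.≟ to y)

  any-finite? : {P : V → Set} → (∀ v → Dec (P v)) → Dec (∃ P)
  any-finite? {P} P? = map′ (λ (i , p) → from i , p)
    (λ (v , p) → to v , subst P (sym (from-to v)) p) (Fin.any? (P? ∘ from))

  all-finite? : {P : V → Set} → (∀ v → Dec (P v)) → Dec (∀ v → P v)
  all-finite? {P} P? = map′ (λ h v → subst P (from-to v) (h (to v))) (λ h → h ∘ from)
    (Fin.all? (P? ∘ from))

Fin-finite : ∀ n → Finite (Fin n)
Fin-finite n = record
  { size = n ; to = λ i → i ; from = λ i → i ; from-to = λ _ → refl ; to-from = λ _ → refl }

Bool-finite : Finite Bool
Bool-finite = record { size = 2 ; to = t ; from = f ; from-to = ft ; to-from = tf }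
  where
  t : Bool → Fin 2
  t false = zero
  t true = suc zero
  f : Fin 2 → Bool
  f zero = false
  f (suc zero) = true
  ft : ∀ b → f (t b) ≡ b
  ft false = refl
  ft true = refl
  tf : ∀ i → t (f i) ≡ i
  tf zero = refl
  tf (suc zero) = refl

infixr 2 _×-finite_
_×-finite_ : {A B : Set} → Finite A → Finite B → Finite (A × B)
FA ×-finite FB = record
  { size = A.size * B.size
  ; to = λ (a , b) → combine (A.to a) (B.to b)
  ; from = λ i → A.from (proj₁ (remQuot B.size i)) , B.from (proj₂ (remQuot {A.size} B.size i))
  ; from-to = λ (a , b) → cong₂ _,_
      (trans (cong (A.from ∘ proj₁) (Fin.remQuot-combine (A.to a) (B.to b))) (A.from-to a))
      (trans (cong (B.from ∘ proj₂) (Fin.remQuot-combine (A.to a) (B.to b))) (B.from-to b))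
  ; to-from = λ i → trans (cong₂ combine (A.to-from _) (B.to-from _)) (Fin.combine-remQuot {A.size} B.size i)
  }
  where
  module A = Finite FA
  module B = Finite FB

Vec-finite : {A : Set} → Finite A → ∀ k → Finite (Vec A k)
Vec-finite FA zero = record
  { size = 1 ; to = λ _ → zero ; from = λ _ → Vec.[]
  ; from-to = λ { Vec.[] → refl } ; to-from = λ { zero → refl } }
Vec-finite FA (suc k) = record
  { size = size
  ; to = λ { (x Vec.∷ xs) → to (x , xs) }
  ; from = uncurry Vec._∷_ ∘ from
  ; from-to = λ { (x Vec.∷ xs) → cong (uncurry Vec._∷_) (from-to (x , xs)) }
  ; to-from = to-from
  }
  where open Finite (FA ×-finite Vec-finite FA k)

-- Functions out of a finite type, as data, so that pointwise equal functions are equal.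
module Table {I : Set} (F : Finite I) (A : Set) where
  open Finite F

  Table : Set
  Table = Vec A size

  look : Table → I → A
  look t i = lookup t (to i)

  table : (I → A) → Table
  table f = tabulate (f ∘ from)

  look-table : ∀ f i → look (table f) i ≡ f i
  look-table f i = trans (lookup∘tabulate _ (to i)) (cong f (from-to i))

  table-ext : ∀ {s t} → (∀ i → look s i ≡ look t i) → s ≡ t
  table-ext {s} {t} h = begin
    s                    ≡⟨ tabulate∘lookup s ⟨
    tabulate (lookup s)  ≡⟨ tabulate-cong pointwise ⟩
    tabulate (lookup t)  ≡⟨ tabulate∘lookup t ⟩
    t                    ∎
    where
    open ≡-Reasoning
    pointwise : ∀ i → lookup s i ≡ lookup t i
    pointwise i = subst (λ j → lookup s j ≡ lookup t j) (to-from i) (h (from i))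

-- A missed value could be punched out, which would give an injection into a smaller set.
injective⇒surjective : ∀ {n} {f : Fin n → Fin n} → Injective _≡_ _≡_ f → ∀ y → ∃ λ x → f x ≡ y
injective⇒surjective {suc n} {f} f-inj y with Fin.any? (λ x → f x Fin.≟ y)
... | yes found = found
... | no ∄ = contradiction (Fin.injective⇒≤ {f = avoid} avoid-inj) 1+n≰n
  where
  y≢f : ∀ x → y ≢ f x
  y≢f x y≡fx = ∄ (x , sym y≡fx)
  avoid : Fin (suc n) → Fin n
  avoid x = punchOut (y≢f x)
  avoid-inj : Injective _≡_ _≡_ avoid
  avoid-inj eq = f-inj (Fin.punchOut-injective (y≢f _) (y≢f _) eq)

record Inverse {V : Set} (f : V → V) : Set where
  field
    f⁻¹  : V → V
    f⁻¹f : ∀ x → f⁻¹ (f x) ≡ x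
    ff⁻¹ : ∀ x → f (f⁻¹ x) ≡ x

injective⇒inverse : {V : Set} → Finite V → {f : V → V} → Injective _≡_ _≡_ f → Inverse f
injective⇒inverse F {f} f-inj = record
  { f⁻¹ = f⁻¹ ; f⁻¹f = λ x → f-inj (ff⁻¹ (f x)) ; ff⁻¹ = ff⁻¹ }
  where
  open Finite F
  preimage : ∀ i → ∃ λ j → to (f (from j)) ≡ i
  preimage = injective⇒surjective (from-injective ∘ f-inj ∘ to-injective)
  f⁻¹ = λ x → from (proj₁ (preimage (to x)))
  ff⁻¹ : ∀ x → f (f⁻¹ x) ≡ x
  ff⁻¹ x = to-injective (proj₂ (preimage (to x)))

transpose-injective : ∀ {n} (i j : Fin n) → Injective _≡_ _≡_ (transpose i j)
transpose-injective i j {x} {y} eq =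
  trans (sym (transpose-inverse j i)) (trans (cong (transpose j i) eq) (transpose-inverse j i))

transpose-source : ∀ {n} (i j : Fin n) → transpose i j i ≡ j
transpose-source i j rewrite dec-true (i Fin.≟ i) refl = refl

transpose-other : ∀ {n} (i j k : Fin n) → k ≢ i → k ≢ j → transpose i j k ≡ k
transpose-other i j k k≢i k≢j rewrite dec-false (k Fin.≟ i) k≢i | dec-false (k Fin.≟ j) k≢j = refl

transpose-diagonal : ∀ {n} (i k : Fin n) → transpose i i k ≡ k
transpose-diagonal i k with k Fin.≟ i
... | yes refl = refl
... | no  k≢i rewrite dec-false (k Fin.≟ i) k≢i = refl

-- Composing with a transposition corrects the value at the new point `s zero`. It could disturb an
-- earlier value only if that is one of the two swapped points, and the hypotheses confine this to
-- `s (suc a) ≡ s zero`, where the two swapped points coincide.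
extend-to-permutation : ∀ {m n} (s t : Fin m → Fin n) {Active : Fin m → Set} → (∀ a → Dec (Active a)) →
  (∀ a b → Active a → Active b → s a ≡ s b → t a ≡ t b) →
  (∀ a b → Active a → Active b → t a ≡ t b → s a ≡ s b) →
  ∃ λ φ → Injective _≡_ _≡_ φ × (∀ a → Active a → φ (s a) ≡ t a)
extend-to-permutation {zero} s t act? s⇒t t⇒s = (λ i → i) , (λ eq → eq) , λ ()
extend-to-permutation {suc m} s t {Active} act? s⇒t t⇒s
  with extend-to-permutation (s ∘ suc) (t ∘ suc) (act? ∘ suc) (λ a b → s⇒t (suc a) (suc b))
         (λ a b → t⇒s (suc a) (suc b)) | act? zero
... | φ , φ-inj , φ-ext | no ¬act = φ , φ-inj , λ { zero h → contradiction h ¬act ; (suc a) → φ-ext a }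
... | φ , φ-inj , φ-ext | yes act = transpose i j ∘ φ , φ-inj ∘ transpose-injective i j , ext
  where
  i = φ (s zero)
  j = t zero
  ext : ∀ a → Active a → transpose i j (φ (s a)) ≡ t a
  ext zero _ = transpose-source i j
  ext (suc a) h with s (suc a) Fin.≟ s zero
  ... | yes eq = begin
    transpose i j (φ (s (suc a))) ≡⟨ cong (λ k → transpose k j (φ (s (suc a)))) i≡j ⟩
    transpose j j (φ (s (suc a))) ≡⟨ transpose-diagonal j _ ⟩
    φ (s (suc a))                 ≡⟨ φ-ext a h ⟩
    t (suc a)                     ∎
    where
    open ≡-Reasoning
    i≡j : i ≡ j
    i≡j = trans (cong φ (sym eq)) (trans (φ-ext a h) (s⇒t (suc a) zero h act eq))
  ... | no s≢ = trans (transpose-other i j _ (s≢ ∘ φ-inj)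
                        (λ eq → s≢ (t⇒s (suc a) zero h act (trans (sym (φ-ext a h)) eq)))) (φ-ext a h)

least : {P : ℕ → Set} → (∀ k → Dec (P k)) → ∀ m →
  (∃ λ k → k < m × P k × (∀ l → P l → k ≤ l)) ⊎ (∀ l → P l → m ≤ l)
least P? zero = inj₂ λ _ _ → z≤n
least P? (suc m) with least P? m
... | inj₁ (k , k<m , pk , min) = inj₁ (k , m<n⇒m<1+n k<m , pk , min)
... | inj₂ none with P? m
...   | yes pm = inj₁ (m , n<1+n m , pm , none)
...   | no ¬pm = inj₂ λ l pl → ≤∧≢⇒< (none l pl) λ { refl → ¬pm pl }

-- Parity

Even⊎Odd : ∀ n → (∃ λ k → n ≡ 2 * k) ⊎ Odd n
Even⊎Odd zero = inj₁ (0 , refl)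
Even⊎Odd (suc n) with Even⊎Odd n
... | inj₁ (k , refl) = inj₂ (k , refl)
... | inj₂ (k , refl) = inj₁ (suc k , solve (k ∷ []))

even-odd : ∀ {a b : ℕ} → suc (2 * a) ≢ 2 * b
even-odd {a} {b} eq with <-cmp a b
... | tri< a<b _ _ = lin⊥ 0 {2 * suc a + 2 * b} {2 * b + suc (2 * a)} (*-monoʳ-≤ 2 a<b ⊕ eq≥ eq) (solve (a ∷ b ∷ []))
... | tri≈ _ refl _ = 1+n≢n eq
... | tri> _ _ b<a = lin⊥ 2 {2 * suc b + suc (2 * a)} {2 * a + 2 * b} (*-monoʳ-≤ 2 b<a ⊕ eq≤ eq) (solve (a ∷ b ∷ []))

odd? : ∀ n → Dec (Odd n)
odd? n with Even⊎Odd n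
... | inj₁ (k , refl) = no λ (l , eq) → even-odd {l} {k} (sym eq)
... | inj₂ o = yes o

Odd-drop-2* : ∀ {m} n p → Odd m → m ≡ p + 2 * n → Odd p
Odd-drop-2* n p (k , refl) eq with Even⊎Odd p
... | inj₂ o = o
... | inj₁ (l , refl) = ⊥-elim (even-odd {k} {l + n} (trans eq (solve (l ∷ n ∷ []))))

Odd-add-2* : ∀ {m} n p → Odd m → p ≡ m + 2 * n → Odd p
Odd-add-2* n p (k , refl) eq = k + n , trans eq (solve (k ∷ n ∷ []))

-- Walks and bad cycles

twistBy : {V : Set} → (V → V) → Bool → V → V
twistBy τ false x = x
twistBy τ true  x = τ x

-- `r` covers all pairs and need not satisfy the triangle inequality; `adj` selects the pairs whose
-- label serves as a length. The other labels matter too: they pick the distances near δ/2.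
record Graph (δ g : ℕ) : Set₁ where
  field
    V         : Set
    V-finite  : Finite V
    τ         : V → V
    τ-invol   : ∀ x → τ (τ x) ≡ x
    τ-free    : ∀ x → x ≢ τ x
    r         : V → V → ℕ
    r-sym     : ∀ x y → r x y ≡ r y x
    r-τ       : ∀ x y → r (τ x) y + r x y ≡ δ
    r-par     : ∀ x y z → g ∣ r x y + r y z + r x z

    adj       : V → V → Set
    adj?      : ∀ x y → Dec (adj x y)
    adj-sym   : ∀ {x y} → adj x y → adj y x
    adj-τ     : ∀ {x y} → adj x y → adj (τ x) (τ y)
    adj-pos   : ∀ {x y} → adj x y → 0 < r x y
    adj-short : ∀ {x y} → adj x y → 2 * r x y ≤ δ
    adj-≉     : ∀ {x y} → adj x y → ∀ s → x ≢ twistBy τ s y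

  tw : Bool → V → V
  tw = twistBy τ

  infix 4 _≟V_
  _≟V_ : DecidableEquality V
  _≟V_ = Finite._≟ᶠ_ V-finite

  tw-tw : ∀ s t x → tw s (tw t x) ≡ tw (s xor t) x
  tw-tw false t     x = refl
  tw-tw true  false x = refl
  tw-tw true  true  x = τ-invol x

  tw-invol : ∀ s x → tw s (tw s x) ≡ x
  tw-invol s x = trans (tw-tw s s x) (cong (λ b → tw b x) (xor-same s))

  tw-swap : ∀ {s x y} → x ≡ tw s y → y ≡ tw s x
  tw-swap {s} refl = sym (tw-invol s _)

  r-ττ : ∀ x y → r (τ x) (τ y) ≡ r x y
  r-ττ x y = +-cancelʳ-≡ (r x (τ y)) _ _ (begin
    r (τ x) (τ y) + r x (τ y) ≡⟨ r-τ x (τ y) ⟩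
    δ                         ≡⟨ r-τ y x ⟨
    r (τ y) x + r y x         ≡⟨ +-comm (r (τ y) x) (r y x) ⟩
    r y x + r (τ y) x         ≡⟨ cong₂ _+_ (r-sym y x) (r-sym (τ y) x) ⟩
    r x y + r x (τ y)         ∎)
    where open ≡-Reasoning

  r-tw : ∀ s x y → r (tw s x) (tw s y) ≡ r x y
  r-tw false x y = refl
  r-tw true  x y = r-ττ x y

  adj-tw : ∀ s {x y} → adj x y → adj (tw s x) (tw s y)
  adj-tw false a = a
  adj-tw true  a = adj-τ a

module Walks {δ g : ℕ} (G : Graph δ g) where
  open Graph G

  data Walk : ℕ → ℕ → V → V → Set where
    stay  : ∀ {x} → Walk 0 0 x x
    _▸_ : ∀ {k L x y z} → adj x y → Walk k L y z → Walk (suc k) (r x y + L) x z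

  cast : ∀ {k k′ L L′ x y} → k ≡ k′ → L ≡ L′ → Walk k L x y → Walk k′ L′ x y
  cast refl refl w = w

  infixr 5 _▸_

  infixr 5 _++_
  _++_ : ∀ {k l L M x y z} → Walk k L x y → Walk l M y z → Walk (k + l) (L + M) x z
  stay      ++ v = v
  (_▸_ {L = L} {x = x} {y = y} a w) ++ v = cast refl (sym (+-assoc (r x y) L _)) (a ▸ (w ++ v))

  reverse : ∀ {k L x y} → Walk k L x y → Walk k L y x
  reverse stay = stay
  reverse (_▸_ {k} {L} {x} {y} a w) =
    cast (+-comm k 1) (trans (cong (L +_) (trans (+-identityʳ _) (r-sym y x))) (+-comm L (r x y)))
      (reverse w ++ (adj-sym a ▸ stay))

  twist : ∀ s {k L x y} → Walk k L x y → Walk k L (tw s x) (tw s y)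
  twist s stay = stay
  twist s (_▸_ {L = L} {x} {y} a w) = cast refl (cong (_+ L) (r-tw s x y)) (adj-tw s a ▸ twist s w)

  steps≤length : ∀ {k L x y} → Walk k L x y → k ≤ L
  steps≤length stay = z≤n
  steps≤length (a ▸ w) = +-mono-≤ (adj-pos a) (steps≤length w)

  single-short : ∀ {k L x y} → Walk k L x y → k ≤ 1 → 2 * L ≤ δ
  single-short stay _ = z≤n
  single-short (_▸_ {x = x} {y} a stay) _ = ≤-trans (eq≤ (cong (2 *_) (+-identityʳ (r x y)))) (adj-short a)
  single-short (_ ▸ _ ▸ _) (s≤s ())

  -- The ways a closed walk, made of an edge of length q and a walk of length L that returns up to
  -- τ^σ, rules out an antipodal space: too short for its endpoints to be antipodal, a violated
  -- triangle inequality, or a short odd perimeter.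
  BadCond : ℕ → Bool → ℕ → ℕ → Set
  BadCond K true  q L = q + L < δ
  BadCond K false q L = L < q ⊎ (Odd (q + L) × q + L < 2 * K)

  badCond? : ∀ K σ q L → Dec (BadCond K σ q L)
  badCond? K true  q L = q + L <? δ
  badCond? K false q L = (L <? q) ⊎-dec (odd? (q + L) ×-dec (q + L <? 2 * K))

  Good : ℕ → ℕ → Set
  Good K s = ∀ {k L x y} σ → adj x y → Walk k L y (tw σ x) → suc k ≤ s → ¬ BadCond K σ (r x y) L

  module GoodWalks {K s} (good : Good K s) where

    antipodal : ∀ {k L x z} → Walk k L x z → z ≡ τ x → k ≤ s → δ ≤ L
    antipodal stay x≡τx _ = ⊥-elim (τ-free _ x≡τx)
    antipodal (a ▸ w) refl k≤s = ≮⇒≥ (good true a w k≤s)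

    geodesic : ∀ {k L x y} → adj x y → Walk k L y x → suc k ≤ s → r x y ≤ L
    geodesic a w k≤s = ≮⇒≥ (good false a w k≤s ∘ inj₁)

    odd-closed : ∀ {k L x} → Walk k L x x → k ≤ s → Odd L → 2 * K ≤ L
    odd-closed stay _ (_ , ())
    odd-closed (a ▸ w) k≤s o = ≮⇒≥ (λ L<2K → good false a w k≤s (inj₂ (o , L<2K)))

    shortcut-same : ∀ {k kc L c u v} → Walk k L u v → Walk kc c u v → kc ≤ 1 → suc k ≤ s → c ≤ L
    shortcut-same w stay _ _ = z≤n
    shortcut-same {L = L} w (_▸_ {x = x} {y} a stay) _ k<s =
      ≤-trans (eq≤ (+-identityʳ (r x y))) (geodesic a (reverse w) k<s)
    shortcut-same w (_ ▸ _ ▸ _) (s≤s ()) _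

    -- The walk `w`, followed by the chord twisted by `τ` and reversed, runs from `u` to `τ u`.
    shortcut-opposite : ∀ {k kc L c u v} → Walk k L u v → Walk kc c u (τ v) → k + kc ≤ s → δ ≤ L + c
    shortcut-opposite {k} {kc} {L} {c} {u} {v} w chord =
      antipodal (w ++ reverse (subst (Walk kc c (τ u)) (τ-invol v) (twist true chord))) refl

  module _ {K s} (good : Good K s) (2K≤δ : 2 * K ≤ δ) where
    open GoodWalks good

    -- A chord splits a minimal bad cycle into two good ones, whose inequalities add up to
    -- goodness of the whole.
    no-chord : ∀ {σ ε q x₀ x y z k₁ k₂ k₃ kc L₁ L₂ L₃ c} →
      Walk k₁ L₁ x₀ x → Walk k₂ L₂ x y → Walk k₃ L₃ y z → adj z (tw σ x₀) → r z (tw σ x₀) ≡ q →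
      BadCond K σ q (L₁ + L₂ + L₃) → Walk kc c x (tw ε y) → kc ≤ 1 →
      2 ≤ k₂ → 1 ≤ k₁ + k₃ → k₁ + k₂ + k₃ ≤ s → ⊥
    no-chord {σ} {ε} {q} {x₀} {x} {y} {z} {k₁} {k₂} {k₃} {kc} {L₁} {L₂} {L₃} {c}
      w₁ w₂ w₃ a q≡ bad chord kc≤1 2≤k₂ 1≤k₁₃ k≤s = conclude σ ε bad refl refl
      where
      outer : Walk (k₃ + suc k₁) (L₃ + (q + L₁)) y (tw σ x)
      outer = w₃ ++ cast refl (cong (_+ L₁) q≡) (a ▸ twist σ w₁)
      chord⁻ : Walk kc c y (tw ε x)
      chord⁻ = subst (λ v → Walk kc c v (tw ε x)) (tw-invol ε y) (twist ε (reverse chord))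
      -- `2 ≤ k₂` and `1 ≤ k₁ + k₃` make every cycle through the chord fit into `s` edges, even when
      -- the chord is an edge rather than a repeated vertex.
      inner<s : suc k₂ ≤ s
      inner<s = lin₀ (1≤k₁₃ ⊕ k≤s) (solve (k₁ ∷ k₂ ∷ k₃ ∷ s ∷ []))
      inner+chord : k₂ + kc ≤ s
      inner+chord = lin₀ (1≤k₁₃ ⊕ k≤s ⊕ kc≤1) (solve (k₁ ∷ k₂ ∷ k₃ ∷ kc ∷ s ∷ []))
      outer<s : suc (k₃ + suc k₁) ≤ s
      outer<s = lin₀ (2≤k₂ ⊕ k≤s) (solve (k₁ ∷ k₂ ∷ k₃ ∷ s ∷ []))
      outer+chord : k₃ + suc k₁ + kc ≤ s
      outer+chord = lin₀ (2≤k₂ ⊕ k≤s ⊕ kc≤1) (solve (k₁ ∷ k₂ ∷ k₃ ∷ kc ∷ s ∷ []))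
      chord+outer : kc + (k₃ + suc k₁) ≤ s
      chord+outer = ≤-trans (eq≤ (+-comm kc _)) outer+chord
      bypass<s : suc (k₁ + (kc + k₃)) ≤ s
      bypass<s = lin₀ (2≤k₂ ⊕ k≤s ⊕ kc≤1) (solve (k₁ ∷ k₂ ∷ k₃ ∷ kc ∷ s ∷ []))
      2c≤δ = single-short chord kc≤1

      edge-too-long : L₁ + L₂ + L₃ < q → 2 * q ≤ δ → δ ≤ L₂ + c → ⊥
      edge-too-long L<q 2q≤δ δ≤ = lin⊥ (1 + 2 * L₁ + 2 * L₃)
        {2 * suc (L₁ + L₂ + L₃) + (2 * q + (2 * δ + 2 * c))}
        {2 * q + (δ + (2 * (L₂ + c) + δ))}
        (*-monoʳ-≤ 2 L<q ⊕ 2q≤δ ⊕ *-monoʳ-≤ 2 δ≤ ⊕ 2c≤δ) (solve (L₁ ∷ L₂ ∷ L₃ ∷ q ∷ δ ∷ c ∷ []))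

      conclude : ∀ σ′ ε′ → BadCond K σ′ q (L₁ + L₂ + L₃) → σ ≡ σ′ → ε ≡ ε′ → ⊥
      conclude true false bad refl refl = lin⊥ 0 {suc (q + (L₁ + L₂ + L₃)) + (c + δ)} {δ + (L₂ + (c + (L₃ + (q + L₁))))}
        (bad ⊕ shortcut-same w₂ chord kc≤1 inner<s ⊕ shortcut-opposite chord⁻ outer chord+outer)
        (solve (L₁ ∷ L₂ ∷ L₃ ∷ q ∷ δ ∷ c ∷ []))
      conclude true true bad refl refl = lin⊥ 0 {suc (q + (L₁ + L₂ + L₃)) + (δ + c)} {δ + (L₂ + c + (L₃ + (q + L₁)))}
        (bad ⊕ shortcut-opposite w₂ chord inner+chord ⊕ shortcut-same outer chord⁻ kc≤1 outer<s)
        (solve (L₁ ∷ L₂ ∷ L₃ ∷ q ∷ δ ∷ c ∷ []))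
      -- The chord and the edge are at most δ/2 each, so `w₂`, which closes up with the chord to an
      -- antipodal walk, is alone as long as the edge.
      conclude false true (inj₁ L<q) refl refl =
        edge-too-long L<q (subst (λ p → 2 * p ≤ δ) q≡ (adj-short a)) (shortcut-opposite w₂ chord inner+chord)
      -- Both parts are antipodal, so with two copies of the chord they reach 2δ. The two copies
      -- take at most δ, and the cycle keeps at least `δ ≥ 2 * K`.
      conclude false true (inj₂ (_ , L<2K)) refl refl =
        lin⊥ 0 {suc (q + (L₁ + L₂ + L₃)) + (δ + (δ + (2 * K + 2 * c)))}
          {2 * K + (L₂ + c + (L₃ + (q + L₁) + c + (δ + δ)))}
          (L<2K ⊕ shortcut-opposite w₂ chord inner+chord ⊕ shortcut-opposite outer chord⁻ outer+chord
            ⊕ 2K≤δ ⊕ 2c≤δ)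
          (solve (L₁ ∷ L₂ ∷ L₃ ∷ q ∷ δ ∷ c ∷ K ∷ []))
      -- With the chord in place of `w₂` the walk still returns along the edge, and it has not
      -- become longer.
      conclude false false (inj₁ L<q) refl refl =
        lin⊥ 0 {suc (L₁ + L₂ + L₃) + (q + c)} {q + (L₁ + (c + L₃) + L₂)}
          (L<q ⊕ subst (_≤ _) q≡ (geodesic a (w₁ ++ (chord ++ w₃)) bypass<s) ⊕ shortcut-same w₂ chord kc≤1 inner<s)
          (solve (L₁ ∷ L₂ ∷ L₃ ∷ q ∷ c ∷ []))
      -- The chord cuts the odd cycle into an odd and an even one. The odd one has length at least
      -- `2 * K`; in the other one the chord is no longer than the rest.
      conclude false false (inj₂ (o , L<2K)) refl refl with Even⊎Odd (L₂ + c)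
      ... | inj₂ o₂ =
        lin⊥ 0 {suc (q + (L₁ + L₂ + L₃)) + (2 * K + c)} {2 * K + (L₂ + c + (L₃ + (q + L₁)))}
          (L<2K ⊕ odd-closed (w₂ ++ reverse chord) inner+chord o₂
            ⊕ shortcut-same outer chord⁻ kc≤1 outer<s)
          (solve (L₁ ∷ L₂ ∷ L₃ ∷ q ∷ c ∷ K ∷ []))
      ... | inj₁ (h , even₂) =
        lin⊥ 0 {suc (q + (L₁ + L₂ + L₃)) + (2 * K + c)} {2 * K + (L₃ + (q + L₁) + c + L₂)}
          (L<2K ⊕ odd-closed (outer ++ reverse chord⁻) outer+chord odd-outer
            ⊕ shortcut-same w₂ chord kc≤1 inner<s)
          (solve (L₁ ∷ L₂ ∷ L₃ ∷ q ∷ c ∷ K ∷ []))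
        where
        regroup : q + (L₁ + L₂ + L₃) + 2 * c ≡ (L₃ + (q + L₁) + c) + (L₂ + c)
        regroup = solve (L₁ ∷ L₂ ∷ L₃ ∷ q ∷ c ∷ [])
        odd-outer : Odd (L₃ + (q + L₁) + c)
        odd-outer = Odd-drop-2* h _ (Odd-add-2* c _ o refl)
          (trans regroup (cong ((L₃ + (q + L₁) + c) +_) even₂))

-- Positions past the end repeat the last entry, so plain numbers serve as positions and no bounds
-- have to be carried along.
at : ∀ {A : Set} {k} → Vec A (suc k) → ℕ → A
at               (x Vec.∷ xs) zero    = x
at {k = zero}    (x Vec.∷ xs) (suc t) = x
at {k = suc _}   (x Vec.∷ xs) (suc t) = at xs t

at-map : ∀ {A B : Set} (f : A → B) {k} (M : Vec A (suc k)) t → at (Vec.map f M) t ≡ f (at M t)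
at-map f             (x Vec.∷ xs) zero    = refl
at-map f {k = zero}  (x Vec.∷ xs) (suc t) = refl
at-map f {k = suc _} (x Vec.∷ xs) (suc t) = at-map f xs t

module Cycles {δ g : ℕ} (G : Graph δ g) (K k : ℕ) where
  open Graph G
  open Walks G public

  Seq : Set
  Seq = Vec V (suc k)

  IsPath : (ℕ → V) → ℕ → Set
  IsPath m l = ∀ {t} → t < l → adj (m t) (m (suc t))

  pathLength : (ℕ → V) → ℕ → ℕ → ℕ
  pathLength m i zero    = 0
  pathLength m i (suc l) = r (m i) (m (suc i)) + pathLength m (suc i) l

  pathLength-+ : ∀ m i a b → pathLength m i (a + b) ≡ pathLength m i a + pathLength m (i + a) b
  pathLength-+ m i zero b = cong (λ j → pathLength m j b) (sym (+-identityʳ i))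
  pathLength-+ m i (suc a) b = begin
    r (m i) (m (suc i)) + pathLength m (suc i) (a + b)
      ≡⟨ cong (r (m i) (m (suc i)) +_) (pathLength-+ m (suc i) a b) ⟩
    r (m i) (m (suc i)) + (pathLength m (suc i) a + pathLength m (suc i + a) b)
      ≡⟨ +-assoc (r (m i) (m (suc i))) (pathLength m (suc i) a) (pathLength m (suc i + a) b) ⟨
    pathLength m i (suc a) + pathLength m (suc i + a) b
      ≡⟨ cong (λ j → pathLength m i (suc a) + pathLength m j b) (+-suc i a) ⟨
    pathLength m i (suc a) + pathLength m (i + suc a) b ∎
    where open ≡-Reasoning

  pathLength-suc : ∀ m i l → pathLength m (suc i) l ≡ pathLength (m ∘ suc) i l
  pathLength-suc m i zero    = refl
  pathLength-suc m i (suc l) = cong (r (m (suc i)) (m (suc (suc i))) +_) (pathLength-suc m (suc i) l)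

  pathLength-cong : ∀ {m m′} → (∀ t → r (m t) (m (suc t)) ≡ r (m′ t) (m′ (suc t))) →
    ∀ i l → pathLength m i l ≡ pathLength m′ i l
  pathLength-cong h i zero    = refl
  pathLength-cong h i (suc l) = cong₂ _+_ (h i) (pathLength-cong h (suc i) l)

  segment : ∀ {m n} → IsPath m n → ∀ i l {j} → i + l ≡ j → j ≤ n → Walk l (pathLength m i l) (m i) (m j)
  segment path i zero refl j≤n rewrite +-identityʳ i = stay
  segment path i (suc l) refl j≤n rewrite +-suc i l =
    path (≤-trans (s≤s (m≤m+n i l)) j≤n) ▸ segment path (suc i) l refl j≤n

  -- Modulo `τ` this is a cycle with `k + 1` edges, and `σ` records whether it returns to its start
  -- or to the antipode. The closing edge is the one that `BadCond` compares with the remaining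
  -- path.
  record Bad (M : Seq) : Set where
    constructor badCycle
    field
      path    : IsPath (at M) k
      σ       : Bool
      closing : adj (at M k) (tw σ (at M 0))
      cond    : BadCond K σ (r (at M k) (tw σ (at M 0))) (pathLength (at M) 0 k)

  bad? : ∀ M → Dec (Bad M)
  bad? M with allUpTo? (λ t → adj? (at M t) (at M (suc t))) k
    | Finite.any-finite? Bool-finite (λ σ → adj? (at M k) (tw σ (at M 0)) ×-dec
        badCond? K σ (r (at M k) (tw σ (at M 0))) (pathLength (at M) 0 k))
  ... | yes p | yes (s , a , c) = yes (badCycle p s a c)
  ... | no ¬p | _ = no λ b → ¬p (Bad.path b)
  ... | yes _ | no ¬c = no λ b → ¬c (Bad.σ b , Bad.closing b , Bad.cond b)

  -- Length 0 is allowed, so that a repeated vertex counts as a chord.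
  Chord : V → V → Set
  Chord x y = ∃ λ ε → ∃₂ λ kc c → Walk kc c x (tw ε y) × kc ≤ 1

  Chord-tw : ∀ s t {x y} → Chord x y → Chord (tw s x) (tw t y)
  Chord-tw s t {x} {y} (ε , kc , c , w , kc≤1) =
    (s xor ε) xor t , kc , c , subst (Walk kc c (tw s x)) eq (twist s w) , kc≤1
    where
    open ≡-Reasoning
    eq : tw s (tw ε y) ≡ tw ((s xor ε) xor t) (tw t y)
    eq = begin
      tw s (tw ε y)                   ≡⟨ tw-tw s ε y ⟩
      tw (s xor ε) y                  ≡⟨ cong (tw (s xor ε)) (tw-invol t y) ⟨
      tw (s xor ε) (tw t (tw t y))    ≡⟨ tw-tw (s xor ε) t (tw t y) ⟩
      tw ((s xor ε) xor t) (tw t y)   ∎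

  Chord-≈ : ∀ {x y s} → x ≡ tw s y → Chord x y
  Chord-≈ {s = s} refl = s , 0 , 0 , stay , z≤n

  Chord-adj : ∀ {x y} ε → adj x (tw ε y) → Chord x y
  Chord-adj ε a = ε , 1 , _ , a ▸ stay , s≤s z≤n

  module Minimal (good : Good K k) (2K≤δ : 2 * K ≤ δ) (2≤k : 2 ≤ k) {M : Seq} (M-bad : Bad M) where

    private
      m = at M
      open Bad M-bad renaming (σ to σ₀)

    -- `no-chord` applies unless the chord spans a single edge of the path or leaves nothing of the
    -- path outside.
    chords-are-edges : ∀ {i j} → i < j → j ≤ k → Chord (m i) (m j) → suc i ≡ j ⊎ (i ≡ 0 × j ≡ k)
    chords-are-edges {i} {j} i<j j≤k (ε , kc , c , w , kc≤1)
      with l , refl ← m≤n⇒∃[o]m+o≡n i<j | l′ , refl ← m≤n⇒∃[o]m+o≡n j≤k = decide l l′ refl refl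
      where
      short : ∀ l₀ l′₀ → l ≡ l₀ → l′ ≡ l′₀ → 1 ≤ l₀ → 1 ≤ i + l′₀ → ⊥
      short l₀ l′₀ refl refl 1≤l 1≤ = no-chord good 2K≤δ {σ₀} {ε}
        (segment path 0 i refl (≤-trans (m≤m+n i _) (≤-trans (eq≤ (+-suc i l)) j≤k)))
        (segment path i (suc l) (+-suc i l) j≤k)
        (segment path (suc i + l) l′ refl ≤-refl)
        closing refl
        (subst (BadCond K σ₀ _) total cond)
        w kc≤1 (s≤s 1≤l) 1≤ (eq≤ steps)
        where
        steps : i + suc l + l′ ≡ suc i + l + l′
        steps = cong (_+ l′) (+-suc i l)
        total : pathLength m 0 (suc i + l + l′)
          ≡ pathLength m 0 i + pathLength m i (suc l) + pathLength m (suc i + l) l′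
        total = trans (pathLength-+ m 0 (suc i + l) l′) (cong (_+ pathLength m (suc i + l) l′)
          (trans (cong (pathLength m 0) (sym (+-suc i l))) (pathLength-+ m 0 i (suc l))))
      decide : ∀ l₀ l′₀ → l ≡ l₀ → l′ ≡ l′₀ → suc i ≡ suc i + l ⊎ (i ≡ 0 × suc i + l ≡ suc i + l + l′)
      decide zero l′₀ refl _ = inj₁ (sym (+-identityʳ (suc i)))
      decide (suc l₀) zero eq refl with i ≟ 0
      ... | yes i≡0 = inj₂ (i≡0 , sym (+-identityʳ _))
      ... | no  i≢0 = ⊥-elim (short (suc l₀) zero eq refl (s≤s z≤n) (≤-trans (n≢0⇒n>0 i≢0) (m≤m+n i 0)))
      decide (suc l₀) (suc l′₀) eq eq′ =
        ⊥-elim (short (suc l₀) (suc l′₀) eq eq′ (s≤s z≤n) (≤-trans (s≤s z≤n) (m≤n+m (suc l′₀) i)))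

    -- A repetition would be a chord of length 0. Its ends would be the ends of an edge of the
    -- cycle, but no edge joins a pole to itself.
    start-not-repeated : ∀ {j} → 0 < j → j ≤ k → ∀ s → m 0 ≢ tw s (m j)
    start-not-repeated 0<j j≤k s eq with chords-are-edges 0<j j≤k (Chord-≈ {s = s} eq)
    ... | inj₁ refl = adj-≉ (path j≤k) s eq
    ... | inj₂ (_ , refl) = adj-≉ closing (σ₀ xor s) (begin
      m k                      ≡⟨ tw-swap {s} eq ⟩
      tw s (m 0)               ≡⟨ cong (λ b → tw b (m 0)) cancel ⟩
      tw ((σ₀ xor s) xor σ₀) (m 0) ≡⟨ tw-tw (σ₀ xor s) σ₀ (m 0) ⟨
      tw (σ₀ xor s) (tw σ₀ (m 0)) ∎)
      where
      open ≡-Reasoning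
      cancel : s ≡ (σ₀ xor s) xor σ₀
      cancel = sym (trans (xor-comm (σ₀ xor s) σ₀) (xor-cancelˡ σ₀ s))

  vertices : ∀ {l L x y} → Walk l L x y → Vec V (suc l)
  vertices {x = x} stay    = x Vec.∷ Vec.[]
  vertices {x = x} (a ▸ w) = x Vec.∷ vertices w

  vertices-start : ∀ {l L x y} (w : Walk l L x y) → at (vertices w) 0 ≡ x
  vertices-start stay    = refl
  vertices-start (a ▸ w) = refl

  vertices-end : ∀ {l L x y} (w : Walk l L x y) → at (vertices w) l ≡ y
  vertices-end stay    = refl
  vertices-end (a ▸ w) = vertices-end w

  vertices-path : ∀ {l L x y} (w : Walk l L x y) → IsPath (at (vertices w)) l
  vertices-path (a ▸ w) {zero}  _         = subst (adj _) (sym (vertices-start w)) a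
  vertices-path (a ▸ w) {suc t} (s≤s t<l) = vertices-path w t<l

  vertices-length : ∀ {l L x y} (w : Walk l L x y) → pathLength (at (vertices w)) 0 l ≡ L
  vertices-length stay = refl
  vertices-length (_▸_ {k = l} {x = x} a w) = cong₂ _+_ (cong (r x) (vertices-start w))
    (trans (pathLength-suc (at (x Vec.∷ vertices w)) 0 l) (vertices-length w))

-- Graphs with extensions of partial isometries

-- The non-bipartite classes have g = 1; the bipartite one has g = 2 and K = 0, since all perimeters
-- are even.
record AntipodalSpace (δ g K : ℕ) {X : Set} (d : X → X → ℕ) : Set where
  field
    d≤δ       : ∀ x y → d x y ≤ δ
    d0⇒≡      : ∀ x y → d x y ≡ 0 → x ≡ y
    d-refl    : ∀ x → d x x ≡ 0
    d-sym     : ∀ x y → d x y ≡ d y x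
    triangle  : ∀ x y z → d x z ≤ d x y + d y z
    perimeter : ∀ x y z → d x y + d y z + d x z ≤ 2 * δ
    odd-lower : ∀ x y z → Odd (d x y + d y z + d x z) → 2 * K ≤ d x y + d y z + d x z
    odd-upper : ∀ x y z → Odd (d x y + d y z + d x z) → 2 * K + (d x y + d y z + d x z) ≤ 2 * δ + 2 * d x y
    congruent : ∀ x y z → g ∣ d x y + d y z + d x z

record Automorphismᴳ {δ g : ℕ} (G : Graph δ g) : Set where
  open Graph G
  field
    φ      : V → V
    φ-inverse : Inverse φ
    φ-τ    : ∀ x → φ (τ x) ≡ τ (φ x)
    φ-r    : ∀ x y → r (φ x) (φ y) ≡ r x y
    φ-adj  : ∀ {x y} → adj x y → adj (φ x) (φ y)
    φ-adj⁻ : ∀ {x y} → adj (φ x) (φ y) → adj x y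

  open Inverse φ-inverse renaming (f⁻¹ to φ⁻¹; f⁻¹f to φ⁻¹φ; ff⁻¹ to φφ⁻¹) public

  φ-injective : Injective _≡_ _≡_ φ
  φ-injective {x} {y} eq = trans (sym (φ⁻¹φ x)) (trans (cong φ⁻¹ eq) (φ⁻¹φ y))

  φ-tw : ∀ s x → φ (tw s x) ≡ tw s (φ x)
  φ-tw false x = refl
  φ-tw true  x = φ-τ x

  inverse : Automorphismᴳ G
  inverse = record
    { φ = φ⁻¹
    ; φ-inverse = record { f⁻¹ = φ ; f⁻¹f = φφ⁻¹ ; ff⁻¹ = φ⁻¹φ }
    ; φ-τ = λ x → φ-injective (trans (φφ⁻¹ (τ x)) (sym (trans (φ-τ (φ⁻¹ x)) (cong τ (φφ⁻¹ x)))))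
    ; φ-r = λ x y → trans (sym (φ-r (φ⁻¹ x) (φ⁻¹ y))) (cong₂ r (φφ⁻¹ x) (φφ⁻¹ y))
    ; φ-adj = λ {x} {y} a → φ-adj⁻ (subst₂ adj (sym (φφ⁻¹ x)) (sym (φφ⁻¹ y)) a)
    ; φ-adj⁻ = λ {x} {y} a → subst₂ adj (φφ⁻¹ x) (φφ⁻¹ y) (φ-adj a)
    }

module Extension (δ g K : ℕ) {n : ℕ} (d : Fin n → Fin n → ℕ) where

  IsPartialIso : (Fin n → Maybe (Fin n)) → Set
  IsPartialIso p = ∀ x y x′ y′ → p x ≡ just x′ → p y ≡ just y′ → d x′ y′ ≡ d x y

  -- The invariant of the induction on the number of edges of a bad cycle. `e-adj` confines the copy
  -- of the space to an edge of a minimal bad cycle, so every cover has to provide it anew.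
  record Level (s : ℕ) : Set₁ where
    field
      graph : Graph δ g
    open Graph graph public
    open Walks graph using (Good)
    field
      e          : Fin n → V
      e-inj      : ∀ {a b} → e a ≡ e b → a ≡ b
      e-antipode : ∀ {a b} → d a b ≡ δ → e a ≡ τ (e b)
      e-τ        : ∀ {a b} → e a ≡ τ (e b) → d a b ≡ δ
      e-r        : ∀ {a b} → (∀ s → e a ≢ tw s (e b)) → r (e a) (e b) ≡ d a b
      e-adj      : ∀ a b → (∃ λ s → e a ≡ tw s (e b)) ⊎ (∃ λ s → adj (e a) (tw s (e b)))
      good       : Good K s
      extend     : ∀ p → IsPartialIso p → Σ (Automorphismᴳ graph) λ α →
                     ∀ {a a′} → p a ≡ just a′ → Automorphismᴳ.φ α (e a) ≡ e a′

-- Triangles under passage to antipodes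

module TriangleFlips {δ K : ℕ} where

  flip : Bool → ℕ → ℕ
  flip false v = v
  flip true  v = δ ∸ v

  flip-flip : ∀ s t {v} → v ≤ δ → flip s (flip t v) ≡ flip (s xor t) v
  flip-flip false t     h = refl
  flip-flip true  false h = refl
  flip-flip true  true  h = m∸[m∸n]≡n h

  record Triangle (a b c : ℕ) : Set where
    field
      a≤   : a ≤ b + c
      b≤   : b ≤ a + c
      c≤   : c ≤ a + b
      sum≤ : a + b + c ≤ 2 * δ
      odd₀ : Odd (a + b + c) → 2 * K ≤ a + b + c
      oddᵃ : Odd (a + b + c) → 2 * K + (a + b + c) ≤ 2 * δ + 2 * a
      oddᵇ : Odd (a + b + c) → 2 * K + (a + b + c) ≤ 2 * δ + 2 * b
      oddᶜ : Odd (a + b + c) → 2 * K + (a + b + c) ≤ 2 * δ + 2 * c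

  record Admissible (a b c : ℕ) : Set where
    field
      c≤   : c ≤ a + b
      odd₀ : Odd (a + b + c) → 2 * K ≤ a + b + c

  private
    flip₁₃ : ∀ {a b c a′ c′} → a′ + a ≡ δ → c′ + c ≡ δ → a ≤ b + c →
      (Odd (a + b + c) → 2 * K + (a + b + c) ≤ 2 * δ + 2 * b) → Admissible a′ b c′
    flip₁₃ {a} {b} {c} {a′} {c′} refl ec a≤ oddᵇ = record
      { c≤ = lin₀ {c′} {a′ + b} {a + (c′ + c)} {b + c + (a′ + a)} (a≤ ⊕ eq≤ ec)
               (solve (a ∷ b ∷ c ∷ a′ ∷ c′ ∷ []))
      ; odd₀ = λ o → lin₀ {2 * K} {a′ + b + c′} {2 * K + (a + b + c) + ((a′ + a) + (a′ + a))}
               {2 * (a′ + a) + 2 * b + (c′ + c + (a′ + a))}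
               (oddᵇ (sum-odd o) ⊕ eq≥ ec ⊕ ≤-refl) (solve (a ∷ b ∷ c ∷ a′ ∷ c′ ∷ K ∷ [])) }
      where
      sum-odd : Odd (a′ + b + c′) → Odd (a + b + c)
      sum-odd o = Odd-drop-2* (a′ + a) _ (Odd-add-2* (a + c) _ o refl) (begin
        a′ + b + c′ + 2 * (a + c)             ≡⟨ solve (a ∷ b ∷ c ∷ a′ ∷ c′ ∷ []) ⟩
        (a + b + c) + ((a′ + a) + (c′ + c))   ≡⟨ cong (λ v → (a + b + c) + ((a′ + a) + v)) ec ⟩
        (a + b + c) + ((a′ + a) + (a′ + a))   ≡⟨ solve (a ∷ b ∷ c ∷ a′ ∷ []) ⟩
        (a + b + c) + 2 * (a′ + a)            ∎)
        where open ≡-Reasoning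

    swap₁₂ : ∀ {a b c} → Admissible a b c → Admissible b a c
    swap₁₂ {a} {b} {c} A = record
      { c≤ = ≤-trans (Admissible.c≤ A) (eq≤ (+-comm a b))
      ; odd₀ = λ o → subst (2 * K ≤_) ab (Admissible.odd₀ A (subst Odd (sym ab) o)) }
      where ab = cong (_+ c) (+-comm a b)

  -- Choosing antipodes for the vertices flips an even number of sides. Each of the four patterns
  -- turns the two conditions of `Admissible` into one triangle or perimeter inequality of
  -- `Triangle` and one of its four odd bounds.
  flip-admissible : ∀ s t {a b c} → a ≤ δ → b ≤ δ → c ≤ δ → Triangle a b c →
    Admissible (flip s a) (flip t b) (flip (s xor t) c)
  flip-admissible false false _ _ _ T = record { c≤ = Triangle.c≤ T ; odd₀ = Triangle.odd₀ T }
  flip-admissible true false a≤δ _ c≤δ T =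
    flip₁₃ (m∸n+n≡m a≤δ) (m∸n+n≡m c≤δ) (Triangle.a≤ T) (Triangle.oddᵇ T)
  flip-admissible false true {a} {b} {c} _ b≤δ c≤δ T = swap₁₂ (flip₁₃ (m∸n+n≡m b≤δ) (m∸n+n≡m c≤δ)
    (Triangle.b≤ T) (λ o → subst (λ v → 2 * K + v ≤ 2 * δ + 2 * a) ab (Triangle.oddᵃ T (subst Odd (sym ab) o))))
    where ab = cong (_+ c) (+-comm a b)
  flip-admissible true true {a} {b} {c} a≤δ b≤δ _ T = record
    { c≤ = lin₀ {c} {a′ + b′} {(δ + δ) + (a + b + c)} {(a′ + a) + (b′ + b) + 2 * δ}
        ((eq≥ ea ⊕ eq≥ eb) ⊕ Triangle.sum≤ T) (identity₁ a b c a′ b′ δ)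
    ; odd₀ = λ o → lin₀ {2 * K} {a′ + b′ + c} {(2 * K + (a + b + c)) + (δ + δ)}
        {(2 * δ + 2 * c) + ((a′ + a) + (b′ + b))}
        (Triangle.oddᶜ T (sum-odd o) ⊕ eq≥ ea ⊕ eq≥ eb) (identity₂ a b c a′ b′ δ K) }
    where
    a′ = δ ∸ a
    b′ = δ ∸ b
    ea : a′ + a ≡ δ
    ea = m∸n+n≡m a≤δ
    eb : b′ + b ≡ δ
    eb = m∸n+n≡m b≤δ
    identity₁ : ∀ a b c a′ b′ δ → c + ((a′ + a) + (b′ + b) + 2 * δ) ≡ (a′ + b′) + ((δ + δ) + (a + b + c))
    identity₁ a b c a′ b′ δ = solve (a ∷ b ∷ c ∷ a′ ∷ b′ ∷ δ ∷ [])
    identity₂ : ∀ a b c a′ b′ δ K → (2 * K) + ((2 * δ + 2 * c) + ((a′ + a) + (b′ + b)))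
      ≡ (a′ + b′ + c) + ((2 * K + (a + b + c)) + (δ + δ))
    identity₂ a b c a′ b′ δ K = solve (a ∷ b ∷ c ∷ a′ ∷ b′ ∷ δ ∷ K ∷ [])
    regroup : ∀ a b c a′ b′ → a′ + b′ + c + 2 * (a + b) ≡ (a + b + c) + ((a′ + a) + (b′ + b))
    regroup a b c a′ b′ = solve (a ∷ b ∷ c ∷ a′ ∷ b′ ∷ [])
    twice : ∀ a b c δ → (a + b + c) + (δ + δ) ≡ (a + b + c) + 2 * δ
    twice a b c δ = solve (a ∷ b ∷ c ∷ δ ∷ [])
    sum-odd : Odd (a′ + b′ + c) → Odd (a + b + c)
    sum-odd o = Odd-drop-2* δ _ (Odd-add-2* (a + b) _ o refl)
      (trans (regroup a b c a′ b′) (trans (cong₂ (λ u v → (a + b + c) + (u + v)) ea eb) (twice a b c δ)))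

-- Removing the bad cycles of one length

module Flips {δ g : ℕ} (G : Graph δ g) {K : ℕ} where
  open Graph G
  open TriangleFlips {δ} {K}

  r≤δ : ∀ x y → r x y ≤ δ
  r≤δ x y = ≤-trans (m≤n+m (r x y) (r (τ x) y)) (eq≤ (r-τ x y))

  r-flip : ∀ s x y → r (tw s x) y ≡ flip s (r x y)
  r-flip false x y = refl
  r-flip true  x y = trans (sym (m+n∸n≡m _ (r x y))) (cong (_∸ r x y) (r-τ x y))

  r-flips : ∀ s t x y → r (tw s x) (tw t y) ≡ flip (s xor t) (r x y)
  r-flips s t x y = begin
    r (tw s x) (tw t y)   ≡⟨ r-flip s x (tw t y) ⟩
    flip s (r x (tw t y)) ≡⟨ cong (flip s) (trans (r-sym x (tw t y)) (r-flip t y x)) ⟩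
    flip s (flip t (r y x)) ≡⟨ flip-flip s t (r≤δ y x) ⟩
    flip (s xor t) (r y x) ≡⟨ cong (flip (s xor t)) (r-sym y x) ⟩
    flip (s xor t) (r x y) ∎
    where open ≡-Reasoning

module SpaceTriangles {δ g K : ℕ} {X : Set} {d : X → X → ℕ} (A : AntipodalSpace δ g K d) where
  open AntipodalSpace A
  open TriangleFlips {δ} {K}

  space-triangle : ∀ a b c → Triangle (d a b) (d b c) (d a c)
  space-triangle a b c = record
    { a≤ = ≤-trans (triangle a c b) (eq≤ (trans (cong (d a c +_) (d-sym c b)) (+-comm (d a c) (d b c))))
    ; b≤ = ≤-trans (triangle b a c) (eq≤ (cong (_+ d a c) (d-sym b a)))
    ; c≤ = triangle a b c
    ; sum≤ = perimeter a b c
    ; odd₀ = odd-lower a b c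
    ; oddᵃ = odd-upper a b c
    ; oddᵇ = upper (d b c) total₁ (odd-upper b c a)
    ; oddᶜ = upper (d a c) total₂ (odd-upper a c b)
    }
    where
    rotate : ∀ u v w → u + v + w ≡ v + w + u
    rotate u v w = solve (u ∷ v ∷ w ∷ [])
    swap : ∀ u v w → u + v + w ≡ w + v + u
    swap u v w = solve (u ∷ v ∷ w ∷ [])
    total : ℕ
    total = d a b + d b c + d a c
    total₁ : total ≡ d b c + d c a + d b a
    total₁ = trans (rotate (d a b) (d b c) (d a c)) (cong₂ (λ u v → d b c + u + v) (d-sym a c) (d-sym a b))
    total₂ : total ≡ d a c + d c b + d a b
    total₂ = trans (swap (d a b) (d b c) (d a c)) (cong (λ u → d a c + u + d a b) (d-sym b c))
    upper : ∀ {v} w → total ≡ v → (Odd v → 2 * K + v ≤ 2 * δ + 2 * w) → Odd total → 2 * K + total ≤ 2 * δ + 2 * w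
    upper w refl h = h

module Step {δ g K n : ℕ} {d : Fin n → Fin n → ℕ} (A : AntipodalSpace δ g K d) (2K≤δ : 2 * K ≤ δ)
  {k : ℕ} (2≤k : 2 ≤ k) (L : Extension.Level δ g K d k) where

  open Extension δ g K d
  open Level L
  open Cycles graph K k
  open Flips graph {K}
  open TriangleFlips {δ} {K}

  Seq-finite : Finite Seq
  Seq-finite = Vec-finite V-finite (suc k)

  open Table Seq-finite Bool

  infix 4 _≈_ _≈?_
  _≈_ : V → V → Set
  x ≈ y = ∃ λ s → x ≡ tw s y

  _≈?_ : ∀ x y → Dec (x ≈ y)
  x ≈? y = Finite.any-finite? Bool-finite λ s → x ≟V tw s y

  ≈-tw : ∀ t {x y} → x ≈ y → tw t x ≈ y
  ≈-tw t (s , refl) = t xor s , tw-tw t s _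

  ≈-untw : ∀ t {x y} → tw t x ≈ y → x ≈ y
  ≈-untw t {x} {y} h = subst (_≈ y) (tw-invol t x) (≈-tw t h)

  ≈-sym : ∀ {x y} → x ≈ y → y ≈ x
  ≈-sym (s , eq) = s , tw-swap {s} eq

  ≈-trans : ∀ {x y z} → x ≈ y → y ≈ z → x ≈ z
  ≈-trans (s , refl) h = ≈-tw s h

  e≉⇒r : ∀ {a b} → ¬ (e a ≈ e b) → r (e a) (e b) ≡ d a b
  e≉⇒r h = e-r λ s eq → h (s , eq)

  image-triple : ∀ {a b c x y z} → x ≈ e a → y ≈ e b → z ≈ e c → ¬ (x ≈ y) → ¬ (y ≈ z) → ¬ (x ≈ z) →
    Admissible (r x y) (r y z) (r x z)
  image-triple {a} {b} {c} (s , refl) (t , refl) (u , refl) x≉y y≉z x≉z =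
    subst₂ (λ v w → Admissible v w (r (tw s (e a)) (tw u (e c)))) (sym eq₁) (sym eq₂)
      (subst (Admissible (flip (s xor t) (d a b)) (flip (t xor u) (d b c))) (sym eq₃)
        (flip-admissible (s xor t) (t xor u) (d≤δ a b) (d≤δ b c) (d≤δ a c)
          (SpaceTriangles.space-triangle A a b c)))
    where
    open AntipodalSpace A
    eq₁ = trans (r-flips s t (e a) (e b)) (cong (flip (s xor t)) (e≉⇒r (x≉y ∘ ≈-sym ∘ ≈-tw t ∘ ≈-sym ∘ ≈-tw s)))
    eq₂ = trans (r-flips t u (e b) (e c)) (cong (flip (t xor u)) (e≉⇒r (y≉z ∘ ≈-sym ∘ ≈-tw u ∘ ≈-sym ∘ ≈-tw t)))
    eq₃ = trans (r-flips s u (e a) (e c))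
      (cong₂ flip (sym (xor-chain s t u)) (e≉⇒r (x≉z ∘ ≈-sym ∘ ≈-tw u ∘ ≈-sym ∘ ≈-tw s)))

  -- The bit of a at M is set where M closes up, provided that the closing edge lies in A.
  Marked : Fin n → Seq → Set
  Marked a M = Bad M × e a ≈ at M 0 × ∃ λ b → e b ≈ at M k

  abstract
    marked? : ∀ a M → Dec (Marked a M)
    marked? a M = bad? M ×-dec (e a ≈? at M 0) ×-dec Fin.any? λ b → e b ≈? at M k

  mark : Fin n → Seq → Bool
  mark a M = does (marked? a M)

  mark-≈ : ∀ {a b} → e a ≈ e b → ∀ M → mark a M ≡ mark b M
  mark-≈ {a} {b} a≈b M = does-⇔ (mk⇔ (λ (bad , h , i) → bad , ≈-trans (≈-sym a≈b) h , i)
    (λ (bad , h , i) → bad , ≈-trans a≈b h , i)) (marked? a M) (marked? b M)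

  -- By `e-adj` two points of the space coincide up to antipodes or are joined by an edge, so the
  -- positions of a cycle that lie in the space are pairwise joined by chords.
  chord-between : ∀ {a b x y} → e a ≈ x → e b ≈ y → Chord x y
  chord-between {a} {b} {x} {y} (s , eq) (t , eq′) =
    subst₂ Chord (sym (tw-swap {s} eq)) (sym (tw-swap {t} eq′)) (Chord-tw s t direct)
    where
    direct : Chord (e a) (e b)
    direct with e-adj a b
    ... | inj₁ (ε , eq) = Chord-≈ {s = ε} eq
    ... | inj₂ (ε , adjacent) = Chord-adj ε adjacent

  module OnBad {M : Seq} (M-bad : Bad M) where

    open Minimal good 2K≤δ 2≤k M-bad public

    private
      m = at M

    -- The labels of a triangle inside the space are distances up to flips, and the conditions on
    -- the space exclude bad triangles in all flips.
    no-triangle : k ≡ 2 → ∀ {a b c} → e a ≈ m 0 → e b ≈ m 1 → e c ≈ m 2 → ⊥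
    no-triangle refl ha hb hc = refute σ cond
      where
      open Bad M-bad
      x≉y : ¬ (m 0 ≈ m 1)
      x≉y (s , eq) = adj-≉ (path (s≤s z≤n)) s eq
      y≉z : ¬ (m 1 ≈ m 2)
      y≉z (s , eq) = adj-≉ (path (s≤s (s≤s z≤n))) s eq
      z≉x : ¬ (m 2 ≈ m 0)
      z≉x h with ≈-trans h (σ , sym (tw-invol σ (m 0)))
      ... | s , eq = adj-≉ closing s eq
      x≉z : ¬ (m 0 ≈ m 2)
      x≉z = z≉x ∘ ≈-sym
      u = r (m 0) (m 1)
      v = r (m 1) (m 2)
      w = r (m 0) (m 2)
      admissible : Admissible u v w
      admissible = image-triple (≈-sym ha) (≈-sym hb) (≈-sym hc) x≉y y≉z x≉z
      closing-length : ∀ σ → r (m 2) (tw σ (m 0)) ≡ flip σ w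
      closing-length σ = trans (r-sym _ _) (r-flip σ (m 0) (m 2))
      refute : ∀ σ → BadCond K σ (r (m 2) (tw σ (m 0))) (u + (v + 0)) → ⊥
      refute true cond = lin⊥ 0 {suc (w′ + (u + (v + 0))) + (w + δ)} {δ + ((u + v) + (w′ + w))}
        (subst (λ q → q + (u + (v + 0)) < δ) (closing-length true) cond ⊕ Admissible.c≤ admissible
          ⊕ eq≥ (m∸n+n≡m (r≤δ (m 0) (m 2))))
        (identity w′ u v w δ)
        where
        w′ = δ ∸ w
        identity : ∀ w′ u v w δ → suc (δ + ((u + v) + (w′ + w)) + 0) ≡ suc (w′ + (u + (v + 0))) + (w + δ)
        identity w′ u v w δ = solve (w′ ∷ u ∷ v ∷ w ∷ δ ∷ [])
      refute false (inj₁ L<q) = <⇒≱ L<q (subst₂ _≤_ (sym (closing-length false))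
        (cong (u +_) (sym (+-identityʳ v))) (Admissible.c≤ admissible))
      refute false (inj₂ (o , L<2K)) = <⇒≱ L<2K (subst (2 * K ≤_) (sym sum)
        (Admissible.odd₀ admissible (subst Odd sum o)))
        where
        identity : ∀ u v w → w + (u + (v + 0)) ≡ u + v + w
        identity u v w = solve (u ∷ v ∷ w ∷ [])
        sum : r (m 2) (m 0) + (u + (v + 0)) ≡ u + v + w
        sum = trans (cong (_+ (u + (v + 0))) (closing-length false)) (identity u v w)

    unmarked-off-start : ∀ {a i} → 0 < i → i ≤ k → e a ≈ m i → ¬ Marked a M
    unmarked-off-start 0<i i≤k h (_ , h₀ , _) with ≈-trans (≈-sym h₀) h
    ... | s , eq = start-not-repeated 0<i i≤k s eq

    -- If the far end of the closing edge were in the space too, its chord to `m 1` would have to be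
    -- an edge of the cycle, and the cycle would be a triangle inside the space.
    unmarked-first-edge : ∀ {a b} → e a ≈ m 0 → e b ≈ m 1 → ¬ Marked a M
    unmarked-first-edge h₀ h₁ (_ , _ , c , hc) with chords-are-edges 2≤k ≤-refl (chord-between h₁ hc)
    ... | inj₁ refl = no-triangle refl h₀ h₁ hc

    path-edge-unmarked : ∀ {a b t} → t < k → e a ≈ m t → e b ≈ m (suc t) →
      mark a M ≡ false × mark b M ≡ false
    path-edge-unmarked {a} {b} {t} t<k ha hb =
      dec-false (marked? a M) (source t t<k ha hb) ,
      dec-false (marked? b M) (unmarked-off-start (s≤s z≤n) t<k hb)
      where
      source : ∀ t → t < k → e a ≈ m t → e b ≈ m (suc t) → ¬ Marked a M
      source zero    _   = unmarked-first-edge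
      source (suc t) t<k ha _ = unmarked-off-start (s≤s z≤n) (<⇒≤ t<k) ha

    closing-edge-marks : ∀ {a b} → e a ≈ m 0 → e b ≈ m k → mark a M ≡ true × mark b M ≡ false
    closing-edge-marks {a} {b} ha hb = dec-true (marked? a M) (M-bad , ha , b , hb) ,
      dec-false (marked? b M) (unmarked-off-start (<-trans z<s 2≤k) ≤-refl hb)

    pair-marks : ∀ {a b i j} → i < j → j ≤ k → e a ≈ m i → e b ≈ m j →
      (suc i ≡ j × mark a M ≡ false × mark b M ≡ false) ⊎
      ((i ≡ 0 × j ≡ k) × mark a M ≡ true × mark b M ≡ false)
    pair-marks i<j j≤k ha hb with chords-are-edges i<j j≤k (chord-between ha hb)
    ... | inj₁ refl = inj₁ (refl , path-edge-unmarked j≤k ha hb)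
    ... | inj₂ (refl , refl) = inj₂ ((refl , refl) , closing-edge-marks ha hb)

  infix 4 _on_
  record _on_ (x : V) (M : Seq) : Set where
    constructor on-at
    field
      index   : ℕ
      index≤k : index ≤ k
      located : x ≈ at M index

  _on?_ : ∀ x M → Dec (x on M)
  x on? M = map′ (λ (t , t<1+k , h) → on-at t (s≤s⁻¹ t<1+k) h) (λ (on-at t t≤k h) → t , s≤s t≤k , h)
    (anyUpTo? (λ t → x ≈? at M t) (suc k))

  data PathEdge (M : Seq) (x y : V) : Set where
    forward  : ∀ t → t < k → x ≈ at M t → y ≈ at M (suc t) → PathEdge M x y
    backward : ∀ t → t < k → y ≈ at M t → x ≈ at M (suc t) → PathEdge M x y

  data ClosingEdge (M : Seq) (x y : V) : Set where
    forward  : x ≈ at M k → y ≈ at M 0 → ClosingEdge M x y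
    backward : y ≈ at M k → x ≈ at M 0 → ClosingEdge M x y

  pathEdge? : ∀ M x y → Dec (PathEdge M x y)
  pathEdge? M x y = map′
    (λ { (t , t<k , inj₁ (h , h′)) → forward t t<k h h′ ; (t , t<k , inj₂ (h , h′)) → backward t t<k h h′ })
    (λ { (forward t t<k h h′) → t , t<k , inj₁ (h , h′) ; (backward t t<k h h′) → t , t<k , inj₂ (h , h′) })
    (anyUpTo? (λ t → ((x ≈? at M t) ×-dec (y ≈? at M (suc t)))
      ⊎-dec ((y ≈? at M t) ×-dec (x ≈? at M (suc t)))) k)

  closingEdge? : ∀ M x y → Dec (ClosingEdge M x y)
  closingEdge? M x y = map′
    (λ { (inj₁ (h , h′)) → forward h h′ ; (inj₂ (h , h′)) → backward h h′ })
    (λ { (forward h h′) → inj₁ (h , h′) ; (backward h h′) → inj₂ (h , h′) })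
    (((x ≈? at M k) ×-dec (y ≈? at M 0)) ⊎-dec ((y ≈? at M k) ×-dec (x ≈? at M 0)))

  pathEdge-sym : ∀ {M x y} → PathEdge M x y → PathEdge M y x
  pathEdge-sym (forward t t<k h h′)  = backward t t<k h h′
  pathEdge-sym (backward t t<k h h′) = forward t t<k h h′

  closingEdge-sym : ∀ {M x y} → ClosingEdge M x y → ClosingEdge M y x
  closingEdge-sym (forward h h′)  = backward h h′
  closingEdge-sym (backward h h′) = forward h h′

  pathEdge-untw : ∀ s t {M x y} → PathEdge M (tw s x) (tw t y) → PathEdge M x y
  pathEdge-untw s t (forward i i<k h h′)  = forward i i<k (≈-untw s h) (≈-untw t h′)
  pathEdge-untw s t (backward i i<k h h′) = backward i i<k (≈-untw t h) (≈-untw s h′)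

  closingEdge-untw : ∀ s t {M x y} → ClosingEdge M (tw s x) (tw t y) → ClosingEdge M x y
  closingEdge-untw s t (forward h h′)  = forward (≈-untw s h) (≈-untw t h′)
  closingEdge-untw s t (backward h h′) = backward (≈-untw t h) (≈-untw s h′)

  pathEdge⇒on : ∀ {M x y} → PathEdge M x y → x on M
  pathEdge⇒on (forward t t<k h _)  = on-at t (<⇒≤ t<k) h
  pathEdge⇒on (backward t t<k _ h) = on-at (suc t) t<k h

  closingEdge⇒on : ∀ {M x y} → ClosingEdge M x y → x on M
  closingEdge⇒on (forward h _)  = on-at k ≤-refl h
  closingEdge⇒on (backward _ h) = on-at 0 z≤n h

  -- One bit for every sequence, so that a single cover opens all bad cycles of this length;
  -- automorphisms permute the sequences and with them the bits.
  V′ : Set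
  V′ = V × Table

  τ′ : V′ → V′
  τ′ (x , χ) = τ x , χ

  tw′ : Bool → V′ → V′
  tw′ = twistBy τ′

  tw′-≡ : ∀ s x → tw′ s x ≡ (tw s (proj₁ x) , proj₂ x)
  tw′-≡ false x = refl
  tw′-≡ true  x = refl

  -- Around a lift of a bad cycle the bit at that cycle changes exactly once, so no lift closes up.
  record Consistent (x : V) (χ : Table) (y : V) (ψ : Table) (M : Seq) : Set where
    constructor consistent
    field
      on-path    : Bad M → PathEdge M x y → look χ M ≡ look ψ M
      on-closing : Bad M → ClosingEdge M x y → look χ M ≡ not (look ψ M)

  open Consistent

  consistent? : ∀ x χ y ψ M → Dec (Consistent x χ y ψ M)
  consistent? x χ y ψ M = map′ (λ (p , c) → consistent p c) (λ (consistent p c) → p , c)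
    ((bad? M →-dec pathEdge? M x y →-dec (look χ M Bool.≟ look ψ M))
      ×-dec (bad? M →-dec closingEdge? M x y →-dec (look χ M Bool.≟ not (look ψ M))))

  adj′ : V′ → V′ → Set
  adj′ (x , χ) (y , ψ) = adj x y × (∀ M → Consistent x χ y ψ M)

  consistent-sym : ∀ {x χ y ψ M} → Consistent x χ y ψ M → Consistent y ψ x χ M
  consistent-sym {ψ = ψ} {M} c = consistent
    (λ b h → sym (on-path c b (pathEdge-sym h)))
    (λ b h → trans (sym (not-involutive (look ψ M))) (cong not (sym (on-closing c b (closingEdge-sym h)))))

  consistent-tw : ∀ s t {x χ y ψ M} → Consistent x χ y ψ M → Consistent (tw s x) χ (tw t y) ψ M
  consistent-tw s t c = consistent (λ b → on-path c b ∘ pathEdge-untw s t)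
                                   (λ b → on-closing c b ∘ closingEdge-untw s t)

  cover : Graph δ g
  cover = record
    { V = V′
    ; V-finite = V-finite ×-finite Vec-finite Bool-finite (Finite.size Seq-finite)
    ; τ = τ′
    ; τ-invol = λ (x , χ) → cong (_, χ) (τ-invol x)
    ; τ-free = λ (x , χ) eq → τ-free x (cong proj₁ eq)
    -- Labels ignore the bits, even between different lifts of one point; only adjacency sees them.
    ; r = λ x y → r (proj₁ x) (proj₁ y)
    ; r-sym = λ x y → r-sym (proj₁ x) (proj₁ y)
    ; r-τ = λ x y → r-τ (proj₁ x) (proj₁ y)
    ; r-par = λ x y z → r-par (proj₁ x) (proj₁ y) (proj₁ z)
    ; adj = adj′
    ; adj? = λ (x , χ) (y , ψ) → adj? x y ×-dec Finite.all-finite? Seq-finite (consistent? x χ y ψ)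
    ; adj-sym = λ (a , c) → adj-sym a , λ M → consistent-sym (c M)
    ; adj-τ = λ (a , c) → adj-τ a , λ M → consistent-tw true true (c M)
    ; adj-pos = adj-pos ∘ proj₁
    ; adj-short = adj-short ∘ proj₁
    ; adj-≉ = λ {x} {y} (a , _) s eq → adj-≉ a s (trans (cong proj₁ eq) (cong proj₁ (tw′-≡ s y)))
    }

  module C′ = Cycles cover K k

  project : ∀ {l L x y} → C′.Walk l L x y → Walk l L (proj₁ x) (proj₁ y)
  project C′.stay = stay
  project (a C′.▸ w) = proj₁ a ▸ project w

  -- Cycles with at most `k` edges project to good ones. A bad one with `k + 1` edges projects to a
  -- bad sequence `M`, and its bit at this very `M` would be constant along the path and yet change
  -- along the closing edge.
  cover-good : C′.Good K (suc k)
  cover-good {l} {L} {x} {y} σ a w l<1+k bad-cond with suc l ≤? k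
  ... | yes l<k = good σ (proj₁ a)
    (subst (Walk l L (proj₁ y)) (cong proj₁ (tw′-≡ σ x)) (project w)) l<k bad-cond
  ... | no l≮k with refl ← ≤-antisym (s≤s⁻¹ l<1+k) (s≤s⁻¹ (≰⇒> l≮k)) = contradict (trans twisted (cong not constant))
    where
    M′ = C′.vertices w
    M = Vec.map proj₁ M′
    m′ = at M′
    at-M : ∀ t → at M t ≡ proj₁ (m′ t)
    at-M = at-map proj₁ M′
    start : at M 0 ≡ proj₁ y
    start = trans (at-M 0) (cong proj₁ (C′.vertices-start w))
    end : at M k ≡ tw σ (proj₁ x)
    end = trans (at-M k) (trans (cong proj₁ (C′.vertices-end w)) (cong proj₁ (tw′-≡ σ x)))
    M-path : IsPath (at M) k
    M-path {t} t<k = subst₂ adj (sym (at-M t)) (sym (at-M (suc t))) (proj₁ (C′.vertices-path w t<k))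
    same-length : ∀ i l → pathLength (at M) i l ≡ C′.pathLength m′ i l
    same-length i zero    = refl
    same-length i (suc l) = cong₂ _+_ (cong₂ r (at-M i) (at-M (suc i))) (same-length (suc i) l)
    closing-≡ : r (proj₁ x) (proj₁ y) ≡ r (at M k) (tw σ (at M 0))
    closing-≡ = trans (sym (r-tw σ _ _)) (sym (cong₂ (λ u v → r u (tw σ v)) end start))
    M-bad : Bad M
    M-bad = badCycle M-path σ
      (subst₂ (λ u v → adj u (tw σ v)) (sym end) (sym start) (adj-tw σ (proj₁ a)))
      (subst₂ (BadCond K σ) closing-≡ (sym (trans (same-length 0 k) (C′.vertices-length w))) bad-cond)
    bit : ℕ → Bool
    bit t = look (proj₂ (m′ t)) M
    ≈-at : ∀ t → proj₁ (m′ t) ≈ at M t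
    ≈-at t = false , sym (at-M t)
    bit-constant : ∀ t → t ≤ k → bit 0 ≡ bit t
    bit-constant zero    _   = refl
    bit-constant (suc t) t<k = trans (bit-constant t (<⇒≤ t<k))
      (on-path (proj₂ (C′.vertices-path w t<k) M) M-bad (forward t t<k (≈-at t) (≈-at (suc t))))
    constant : look (proj₂ y) M ≡ look (proj₂ x) M
    constant = begin
      look (proj₂ y) M          ≡⟨ cong (λ v → look (proj₂ v) M) (C′.vertices-start w) ⟨
      bit 0                     ≡⟨ bit-constant k ≤-refl ⟩
      bit k                     ≡⟨ cong (λ v → look (proj₂ v) M) (C′.vertices-end w) ⟩
      look (proj₂ (tw′ σ x)) M  ≡⟨ cong (λ v → look (proj₂ v) M) (tw′-≡ σ x) ⟩
      look (proj₂ x) M          ∎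
      where open ≡-Reasoning
    twisted : look (proj₂ x) M ≡ not (look (proj₂ y) M)
    twisted = on-closing (proj₂ a M) M-bad
      (forward (σ , sym (trans (cong (tw σ) end) (tw-invol σ _))) (false , sym start))
    contradict : ∀ {b} → b ≢ not b
    contradict {false} ()
    contradict {true} ()

  e′ : Fin n → V′
  e′ a = e a , table (mark a)

  e′-≈ : ∀ {a b} s → e a ≡ tw s (e b) → e′ a ≡ tw′ s (e′ b)
  e′-≈ {a} {b} s eq = trans (cong₂ _,_ eq (table-ext λ M → trans (look-table (mark a) M)
    (trans (mark-≈ (s , eq) M) (sym (look-table (mark b) M))))) (sym (tw′-≡ s (e′ b)))

  ≈-e′ : ∀ {a b} s → e′ a ≡ tw′ s (e′ b) → e a ≡ tw s (e b)
  ≈-e′ {a} {b} s eq = trans (cong proj₁ eq) (cong proj₁ (tw′-≡ s (e′ b)))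

  -- This lifts the edges between points of the space, so that `e-adj` survives in the cover.
  marks-consistent : ∀ a b M → Consistent (e a) (table (mark a)) (e b) (table (mark b)) M
  marks-consistent a b M = consistent
    (λ M-bad h → trans (look-table (mark a) M) (trans (path-marks M-bad h) (sym (look-table (mark b) M))))
    (λ M-bad h → trans (look-table (mark a) M)
      (trans (closing-marks M-bad h) (cong not (sym (look-table (mark b) M)))))
    where
    open OnBad
    path-marks : Bad M → PathEdge M (e a) (e b) → mark a M ≡ mark b M
    path-marks M-bad (forward t t<k ha hb) with path-edge-unmarked M-bad t<k ha hb
    ... | u , v = trans u (sym v)
    path-marks M-bad (backward t t<k hb ha) with path-edge-unmarked M-bad t<k hb ha
    ... | u , v = trans v (sym u)
    closing-marks : Bad M → ClosingEdge M (e a) (e b) → mark a M ≡ not (mark b M)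
    closing-marks M-bad (forward ha hb) with closing-edge-marks M-bad hb ha
    ... | u , v = trans v (cong not (sym u))
    closing-marks M-bad (backward hb ha) with closing-edge-marks M-bad ha hb
    ... | u , v = trans u (cong not (sym v))

  module Action (α : Automorphismᴳ graph) where

    open Automorphismᴳ α

    φ* : Seq → Seq
    φ* = Vec.map φ

    φ*⁻¹ : Seq → Seq
    φ*⁻¹ = Vec.map φ⁻¹

    φ*φ*⁻¹ : ∀ M → φ* (φ*⁻¹ M) ≡ M
    φ*φ*⁻¹ M = trans (sym (map-∘ φ φ⁻¹ M)) (trans (map-cong φφ⁻¹ M) (map-id M))

    φ*⁻¹φ* : ∀ M → φ*⁻¹ (φ* M) ≡ M
    φ*⁻¹φ* M = trans (sym (map-∘ φ⁻¹ φ M)) (trans (map-cong φ⁻¹φ M) (map-id M))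

    ≈-φ : ∀ {x y} → x ≈ y → φ x ≈ φ y
    ≈-φ (s , refl) = s , φ-tw s _

    ≈-φ⁻ : ∀ {x y} → φ x ≈ φ y → x ≈ y
    ≈-φ⁻ (s , eq) = s , φ-injective (trans eq (sym (φ-tw s _)))

    ≈-φ* : ∀ {x} M t → x ≈ at M t → φ x ≈ at (φ* M) t
    ≈-φ* M t h = subst (_ ≈_) (sym (at-map φ M t)) (≈-φ h)

    ≈-φ*⁻ : ∀ {x} M t → φ x ≈ at (φ* M) t → x ≈ at M t
    ≈-φ*⁻ M t h = ≈-φ⁻ (subst (_ ≈_) (at-map φ M t) h)

    bad-φ : ∀ {M} → Bad M → Bad (φ* M)
    bad-φ {M} (badCycle path σ closing cond) = badCycle
      (λ {t} t<k → subst₂ adj (sym (at-φ t)) (sym (at-φ (suc t))) (φ-adj (path t<k)))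
      σ (subst₂ adj (sym (at-φ k)) (sym tw-at-φ) (φ-adj closing))
      (subst₂ (BadCond K σ)
        (sym (trans (cong₂ r (at-φ k) tw-at-φ) (φ-r (at M k) (tw σ (at M 0)))))
        (pathLength-cong (λ t → sym (trans (cong₂ r (at-φ t) (at-φ (suc t))) (φ-r (at M t) (at M (suc t))))) 0 k) cond)
      where
      at-φ : ∀ t → at (φ* M) t ≡ φ (at M t)
      at-φ = at-map φ M
      tw-at-φ : tw σ (at (φ* M) 0) ≡ φ (tw σ (at M 0))
      tw-at-φ = trans (cong (tw σ) (at-φ 0)) (sym (φ-tw σ (at M 0)))

    pathEdge-φ : ∀ {M x y} → PathEdge M x y → PathEdge (φ* M) (φ x) (φ y)
    pathEdge-φ {M} (forward t t<k h h′)  = forward t t<k (≈-φ* M t h) (≈-φ* M (suc t) h′)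
    pathEdge-φ {M} (backward t t<k h h′) = backward t t<k (≈-φ* M t h) (≈-φ* M (suc t) h′)

    pathEdge-φ⁻ : ∀ {M x y} → PathEdge (φ* M) (φ x) (φ y) → PathEdge M x y
    pathEdge-φ⁻ {M} (forward t t<k h h′)  = forward t t<k (≈-φ*⁻ M t h) (≈-φ*⁻ M (suc t) h′)
    pathEdge-φ⁻ {M} (backward t t<k h h′) = backward t t<k (≈-φ*⁻ M t h) (≈-φ*⁻ M (suc t) h′)

    closingEdge-φ : ∀ {M x y} → ClosingEdge M x y → ClosingEdge (φ* M) (φ x) (φ y)
    closingEdge-φ {M} (forward h h′)  = forward (≈-φ* M k h) (≈-φ* M 0 h′)
    closingEdge-φ {M} (backward h h′) = backward (≈-φ* M k h) (≈-φ* M 0 h′)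

    closingEdge-φ⁻ : ∀ {M x y} → ClosingEdge (φ* M) (φ x) (φ y) → ClosingEdge M x y
    closingEdge-φ⁻ {M} (forward h h′)  = forward (≈-φ*⁻ M k h) (≈-φ*⁻ M 0 h′)
    closingEdge-φ⁻ {M} (backward h h′) = backward (≈-φ*⁻ M k h) (≈-φ*⁻ M 0 h′)

  module Lift (p : Fin n → Maybe (Fin n)) (α : Automorphismᴳ graph)
    (α-extends : ∀ {a a′} → p a ≡ just a′ → Automorphismᴳ.φ α (e a) ≡ e a′) where

    open Automorphismᴳ α
    open Action α

    bad-φ⁻ : ∀ {M} → Bad (φ* M) → Bad M
    bad-φ⁻ {M} b = subst Bad (φ*⁻¹φ* M) (Action.bad-φ inverse b)

    Moved : Seq → Fin n → Fin n → Set
    Moved M a a′ = p a ≡ just a′ × e a on M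

    -- The change of the bits at `M` on their way to `φ* M`, read off any point of the domain of `p`
    -- on `M`; by `mark-shift` the choice is immaterial. Without such a point nothing is prescribed
    -- and the bits stay.
    shift-by : ∀ {M} → Dec (∃₂ (Moved M)) → Bool
    shift-by {M} (yes (a , a′ , _)) = mark a M xor mark a′ (φ* M)
    shift-by     (no _)             = false

    abstract
      moved? : ∀ M → Dec (∃₂ (Moved M))
      moved? M = Fin.any? λ a → Fin.any? λ a′ → Maybe-≡-dec Fin._≟_ (p a) (just a′) ×-dec (e a on? M)

    shift : Seq → Bool
    shift M = shift-by (moved? M)

    mark-image : ∀ {a a′ b b′} → p a ≡ just a′ → p b ≡ just b′ → e a ≈ e b → e a′ ≈ e b′
    mark-image pa pb h = subst₂ _≈_ (α-extends pa) (α-extends pb) (≈-φ h)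

    -- `φ*` keeps positions, so the pair and its image both lie on a path edge or both on the
    -- closing edge. In the first case all four marks vanish; in the second both marks at the start
    -- are set and both at the end are not.
    mark-shift-ordered : ∀ {M} → Bad M → ∀ {a a′ b b′ i j} → p a ≡ just a′ → p b ≡ just b′ →
      i < j → j ≤ k → e a ≈ at M i → e b ≈ at M j →
      mark a M xor mark a′ (φ* M) ≡ mark b M xor mark b′ (φ* M)
    mark-shift-ordered {M} M-bad {a} {a′} {b} {b′} {i} {j} pa pb i<j j≤k ha hb =
      combine-marks (OnBad.pair-marks M-bad i<j j≤k ha hb)
        (OnBad.pair-marks (bad-φ M-bad) i<j j≤k
          (subst (_≈ _) (α-extends pa) (≈-φ* M i ha)) (subst (_≈ _) (α-extends pb) (≈-φ* M j hb)))
      where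
      not-both : suc i ≡ j → i ≡ 0 × j ≡ k → ⊥
      not-both refl (refl , refl) = <-irrefl refl 2≤k
      Marks : Fin n → Fin n → Seq → Set
      Marks a b M = (suc i ≡ j × mark a M ≡ false × mark b M ≡ false) ⊎
        ((i ≡ 0 × j ≡ k) × mark a M ≡ true × mark b M ≡ false)
      combine-marks : Marks a b M → Marks a′ b′ (φ* M) →
        mark a M xor mark a′ (φ* M) ≡ mark b M xor mark b′ (φ* M)
      combine-marks (inj₁ (_ , u , v)) (inj₁ (_ , u′ , v′)) =
        trans (cong₂ _xor_ u u′) (sym (cong₂ _xor_ v v′))
      combine-marks (inj₂ (_ , u , v)) (inj₂ (_ , u′ , v′)) =
        trans (cong₂ _xor_ u u′) (sym (cong₂ _xor_ v v′))
      combine-marks (inj₁ (c , _)) (inj₂ (c′ , _)) = ⊥-elim (not-both c c′)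
      combine-marks (inj₂ (c′ , _)) (inj₁ (c , _)) = ⊥-elim (not-both c c′)

    mark-shift : ∀ {M a a′ b b′} → Moved M a a′ → Moved M b b′ →
      mark a M xor mark a′ (φ* M) ≡ mark b M xor mark b′ (φ* M)
    mark-shift {M} {a} {a′} {b} {b′} (pa , on-at i i≤k ha) (pb , on-at j j≤k hb) = by-badness (bad? M)
      where
      by-order : Bad M → mark a M xor mark a′ (φ* M) ≡ mark b M xor mark b′ (φ* M)
      by-order M-bad with <-cmp i j
      ... | tri< i<j _ _ = mark-shift-ordered M-bad pa pb i<j j≤k ha hb
      ... | tri≈ _ refl _ = cong₂ _xor_ (mark-≈ a≈b M) (mark-≈ (mark-image pa pb a≈b) (φ* M))
        where a≈b = ≈-trans ha (≈-sym hb)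
      ... | tri> _ _ j<i = sym (mark-shift-ordered M-bad pb pa j<i i≤k hb ha)
      by-badness : Dec (Bad M) → mark a M xor mark a′ (φ* M) ≡ mark b M xor mark b′ (φ* M)
      by-badness (yes M-bad) = by-order M-bad
      by-badness (no ¬bad) = trans (cong₂ _xor_ (unmarked a) (unmarked′ a′))
                                   (sym (cong₂ _xor_ (unmarked b) (unmarked′ b′)))
        where
        unmarked : ∀ a → mark a M ≡ false
        unmarked a = dec-false (marked? a M) (¬bad ∘ proj₁)
        unmarked′ : ∀ a → mark a (φ* M) ≡ false
        unmarked′ a = dec-false (marked? a (φ* M)) (¬bad ∘ bad-φ⁻ ∘ proj₁)

    shift-moved : ∀ {M a a′} → Moved M a a′ → shift M ≡ mark a M xor mark a′ (φ* M)
    shift-moved {M} moved with moved? M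
    ... | yes (_ , _ , moved′) = mark-shift moved′ moved
    ... | no ¬moved = ⊥-elim (¬moved (_ , _ , moved))

    -- All points on `M` are shifted alike, which preserves the conditions on its edges. Points off
    -- `M` keep their bits, as they must: those in the space have no mark at `M`, and their images
    -- under `p` have none at `φ* M`.
    twist-at : V → Seq → Bool
    twist-at x M = does (x on? M) ∧ shift M

    moveBit : V → Table → Seq → Bool
    moveBit x χ M′ = look χ (φ*⁻¹ M′) xor twist-at x (φ*⁻¹ M′)

    moveTable : V → Table → Table
    moveTable x χ = table (moveBit x χ)

    look-moveTable : ∀ x χ M → look (moveTable x χ) (φ* M) ≡ look χ M xor twist-at x M
    look-moveTable x χ M = trans (look-table (moveBit x χ) (φ* M))
      (cong (λ M → look χ M xor twist-at x M) (φ*⁻¹φ* M))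

    φ′ : V′ → V′
    φ′ (x , χ) = φ x , moveTable x χ

    twist-on : ∀ {x M} → x on M → twist-at x M ≡ shift M
    twist-on {x} {M} h = cong (_∧ shift M) (dec-true (x on? M) h)

    twist-τ : ∀ x M → twist-at (τ x) M ≡ twist-at x M
    twist-τ x M = cong (_∧ shift M) (does-⇔ (mk⇔ (λ (on-at t t≤k h) → on-at t t≤k (≈-untw true h))
      (λ (on-at t t≤k h) → on-at t t≤k (≈-tw true h))) (τ x on? M) (x on? M))

    xor-cancel-notʳ : ∀ {b b′} c → b xor c ≡ not (b′ xor c) → b ≡ not b′
    xor-cancel-notʳ {b} {b′} c eq = xor-injectiveʳ c (trans eq (Bool.not-distribˡ-xor b′ c))

    φ′-injective : Injective _≡_ _≡_ φ′
    φ′-injective {x , χ} {y , ψ} eq with refl ← φ-injective (cong proj₁ eq) =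
      cong (x ,_) (table-ext λ M → xor-injectiveʳ (twist-at x M) (begin
        look χ M xor twist-at x M       ≡⟨ look-moveTable x χ M ⟨
        look (moveTable x χ) (φ* M)     ≡⟨ cong (λ t → look (proj₂ t) (φ* M)) eq ⟩
        look (moveTable x ψ) (φ* M)     ≡⟨ look-moveTable x ψ M ⟩
        look ψ M xor twist-at x M       ∎))
      where open ≡-Reasoning

    moved-bits : ∀ {x y M} χ ψ → x on M → y on M →
      (look (moveTable x χ) (φ* M) ≡ look χ M xor shift M) × (look (moveTable y ψ) (φ* M) ≡ look ψ M xor shift M)
    moved-bits {x} {y} {M} χ ψ hx hy =
      trans (look-moveTable x χ M) (cong (look χ M xor_) (twist-on hx)) ,
      trans (look-moveTable y ψ M) (cong (look ψ M xor_) (twist-on hy))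

    consistent-φ : ∀ {x χ y ψ M} → Consistent x χ y ψ M →
      Consistent (φ x) (moveTable x χ) (φ y) (moveTable y ψ) (φ* M)
    consistent-φ {x} {χ} {y} {ψ} {M} c = consistent
      (λ b h′ → let h = pathEdge-φ⁻ h′
                    u , v = moved-bits χ ψ (pathEdge⇒on h) (pathEdge⇒on (pathEdge-sym h))
                in trans u (trans (cong (_xor shift M) (on-path c (bad-φ⁻ b) h)) (sym v)))
      (λ b h′ → let h = closingEdge-φ⁻ h′
                    u , v = moved-bits χ ψ (closingEdge⇒on h) (closingEdge⇒on (closingEdge-sym h))
                in trans u (trans (cong (_xor shift M) (on-closing c (bad-φ⁻ b) h))
                     (trans (sym (Bool.not-distribˡ-xor (look ψ M) (shift M))) (cong not (sym v)))))

    consistent-φ⁻ : ∀ {x χ y ψ M} → Consistent (φ x) (moveTable x χ) (φ y) (moveTable y ψ) (φ* M) →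
      Consistent x χ y ψ M
    consistent-φ⁻ {x} {χ} {y} {ψ} {M} c = consistent
      (λ b h → let u , v = moved-bits χ ψ (pathEdge⇒on h) (pathEdge⇒on (pathEdge-sym h))
               in xor-injectiveʳ (shift M) (trans (sym u) (trans (on-path c (bad-φ b) (pathEdge-φ h)) v)))
      (λ b h → let u , v = moved-bits χ ψ (closingEdge⇒on h) (closingEdge⇒on (closingEdge-sym h))
               in xor-cancel-notʳ (shift M)
                    (trans (sym u) (trans (on-closing c (bad-φ b) (closingEdge-φ h)) (cong not v))))

    lifted : Automorphismᴳ cover
    lifted = record
      { φ = φ′
      ; φ-inverse = injective⇒inverse (Graph.V-finite cover) φ′-injective
      ; φ-τ = λ (x , χ) → cong₂ _,_ (φ-τ x) (table-ext λ M′ → trans (look-table (moveBit (τ x) χ) M′)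
          (trans (cong (look χ (φ*⁻¹ M′) xor_) (twist-τ x (φ*⁻¹ M′))) (sym (look-table (moveBit x χ) M′))))
      ; φ-r = λ x y → φ-r (proj₁ x) (proj₁ y)
      ; φ-adj = λ { {x , χ} {y , ψ} (a , c) → φ-adj a , λ M′ →
          subst (Consistent (φ x) (moveTable x χ) (φ y) (moveTable y ψ)) (φ*φ*⁻¹ M′)
            (consistent-φ {x} {χ} {y} {ψ} (c (φ*⁻¹ M′))) }
      ; φ-adj⁻ = λ { {x , χ} {y , ψ} (a , c) → φ-adj⁻ a , λ M → consistent-φ⁻ {x} {χ} {y} {ψ} (c (φ* M)) }
      }

    lifted-extends : ∀ {a a′} → p a ≡ just a′ → φ′ (e′ a) ≡ e′ a′
    lifted-extends {a} {a′} pa = cong₂ _,_ (α-extends pa) (table-ext λ M′ →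
      subst (λ M → look (moveTable (e a) (table (mark a))) M ≡ look (table (mark a′)) M) (φ*φ*⁻¹ M′) (pointwise (φ*⁻¹ M′)))
      where
      bits : ∀ M → Dec (e a on M) → mark a M xor twist-at (e a) M ≡ mark a′ (φ* M)
      bits M (yes h) = trans (cong (mark a M xor_) (trans (twist-on h) (shift-moved (pa , h)))) (xor-cancelˡ (mark a M) _)
      bits M (no ¬h) = trans
        (cong₂ _xor_ (dec-false (marked? a M) (λ (_ , h , _) → ¬h (on-at 0 z≤n h)))
                     (cong (_∧ shift M) (dec-false (e a on? M) ¬h)))
        (sym (dec-false (marked? a′ (φ* M)) λ (_ , h , _) →
          ¬h (on-at 0 z≤n (≈-φ*⁻ M 0 (subst (_≈ _) (sym (α-extends pa)) h)))))
      pointwise : ∀ M → look (moveTable (e a) (table (mark a))) (φ* M) ≡ look (table (mark a′)) (φ* M)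
      pointwise M = trans (look-moveTable (e a) (table (mark a)) M) (trans (cong (_xor twist-at (e a) M) (look-table (mark a) M))
        (trans (bits M (e a on? M)) (sym (look-table (mark a′) (φ* M)))))

  next : Level (suc k)
  next = record
    { graph = cover
    ; e = e′
    ; e-inj = λ eq → e-inj (cong proj₁ eq)
    ; e-antipode = λ {a} {b} h → e′-≈ {a} {b} true (e-antipode h)
    ; e-τ = λ {a} {b} eq → e-τ (≈-e′ {a} {b} true eq)
    ; e-r = λ {a} {b} h → e-r λ s eq → h s (e′-≈ {a} {b} s eq)
    ; e-adj = e′-adj
    ; good = cover-good
    ; extend = λ p iso → Lift.lifted p (proj₁ (extend p iso)) (proj₂ (extend p iso)) ,
        Lift.lifted-extends p (proj₁ (extend p iso)) (proj₂ (extend p iso))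
    }
    where
    e′-adj : ∀ a b → (∃ λ s → e′ a ≡ tw′ s (e′ b)) ⊎ (∃ λ s → adj′ (e′ a) (tw′ s (e′ b)))
    e′-adj a b with e-adj a b
    ... | inj₁ (s , eq) = inj₁ (s , e′-≈ {a} {b} s eq)
    ... | inj₂ (s , adjacent) = inj₂ (s , subst (adj′ (e′ a)) (sym (tw′-≡ s (e′ b)))
      (adjacent , λ M → consistent-tw false s {e a} {table (mark a)} {e b} {table (mark b)} (marks-consistent a b M)))

-- The metric of a graph without bad cycles

-- μ v ≡ v (mod g) is within g/2 of δ/2, so these are the values used for unrelated pairs.
module Middle (δ g : ℕ) (g∣2 : g ∣ 2) where
  open Divisor2 g∣2

  private
    instance
      g≢0 : NonZero g
      g≢0 = ≢-nonZero λ { refl → contradiction (0∣⇒≡0 g∣2) λ () }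

  g≤2 : g ≤ 2
  g≤2 = ∣⇒≤ g∣2

  centre : ℕ
  centre = suc δ / 2

  centre-lower : δ ≤ 2 * centre
  centre-lower = s≤s⁻¹ (begin
    suc δ                     ≡⟨ m≡m%n+[m/n]*n (suc δ) 2 ⟩
    suc δ % 2 + centre * 2    ≤⟨ +-monoˡ-≤ (centre * 2) (s≤s⁻¹ (m%n<n (suc δ) 2)) ⟩
    suc (centre * 2)          ≡⟨ cong suc (*-comm centre 2) ⟩
    suc (2 * centre)          ∎)
    where open ≤-Reasoning

  centre-upper : 2 * centre ≤ suc δ
  centre-upper = ≤-trans (eq≤ (*-comm 2 centre)) (m/n*n≤m (suc δ) 2)

  -- For `v ≤ centre` this is the largest number up to `centre` in the congruence class of `v`.
  top : ℕ → ℕ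
  top v = v + (centre ∸ v) / g * g

  v≤top : ∀ v → v ≤ top v
  v≤top v = m≤m+n v _

  top≤centre : ∀ v → v ≤ centre → top v ≤ centre
  top≤centre v h = ≤-trans (+-monoʳ-≤ v (m/n*n≤m (centre ∸ v) g)) (eq≤ (m+[n∸m]≡n h))

  centre<top+g : ∀ v → v ≤ centre → centre < top v + g
  centre<top+g v h = begin-strict
    centre                                            ≡⟨ m+[n∸m]≡n h ⟨
    v + (centre ∸ v)                                  ≡⟨ cong (v +_) (m≡m%n+[m/n]*n (centre ∸ v) g) ⟩
    v + ((centre ∸ v) % g + (centre ∸ v) / g * g)     <⟨ +-monoʳ-< v (+-monoˡ-< _ (m%n<n (centre ∸ v) g)) ⟩
    v + (g + (centre ∸ v) / g * g)                    ≡⟨ cong (v +_) (+-comm g _) ⟩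
    v + ((centre ∸ v) / g * g + g)                    ≡⟨ +-assoc v _ g ⟨
    top v + g                                         ∎
    where open ≤-Reasoning

  top-congruent : ∀ v → g ∣ top v + v
  top-congruent v = subst (g ∣_) eq (∣m∣n⇒∣m+n (g∣2* v) (n∣m*n ((centre ∸ v) / g)))
    where
    q = (centre ∸ v) / g * g
    regroup : ∀ v q → 2 * v + q ≡ v + q + v
    regroup v q = solve (v ∷ q ∷ [])
    eq : 2 * v + q ≡ top v + v
    eq = regroup v q

  record Central (v m : ℕ) : Set where
    field
      congruent : g ∣ m + v
      lower     : δ ≤ 2 * m + g
      upper     : 2 * m ≤ δ + g

  2v≤δ⇒v≤centre : ∀ v → 2 * v ≤ δ → v ≤ centre
  2v≤δ⇒v≤centre v h = *-cancelˡ-≤ 2 (≤-trans h centre-lower)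

  top-central : ∀ v → 2 * v ≤ δ → Central v (top v)
  top-central v h = record
    { congruent = top-congruent v
    ; lower = lin₀ {δ} {2 * t + g} {δ + (2 * suc centre + g)} {2 * centre + (2 * (t + g) + 2)}
        (centre-lower ⊕ *-monoʳ-≤ 2 (centre<top+g v v≤c) ⊕ g≤2) (identity₁ δ t g centre)
    ; upper = lin₀ {2 * t} {δ + g} {2 * t + (2 * centre + 1)} {2 * centre + (suc δ + g)}
        (*-monoʳ-≤ 2 (top≤centre v v≤c) ⊕ centre-upper ⊕ >-nonZero⁻¹ g) (identity₂ δ t g centre)
    }
    where
    t = top v
    v≤c = 2v≤δ⇒v≤centre v h
    identity₁ : ∀ δ t g c → δ + (2 * c + (2 * (t + g) + 2)) ≡ (2 * t + g) + (δ + (2 * suc c + g))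
    identity₁ δ t g c = solve (δ ∷ t ∷ g ∷ c ∷ [])
    identity₂ : ∀ δ t g c → (2 * t) + (2 * c + (suc δ + g)) ≡ (δ + g) + (2 * t + (2 * c + 1))
    identity₂ δ t g c = solve (δ ∷ t ∷ g ∷ c ∷ [])

  central-opposite : ∀ {v w m m′} → v + w ≡ δ → m + m′ ≡ δ → Central v m → Central w m′
  central-opposite {v} {w} {m} {m′} vw mm C = record
    { congruent = ∣m+n∣m⇒∣n (subst (g ∣_) (sym (sum v w m m′ vw mm)) (g∣2* δ)) congruent
    ; lower = lin₀ {δ} {2 * m′ + g} {2 * m + 2 * δ} {δ + g + 2 * (m + m′)}
        (upper ⊕ *-monoʳ-≤ 2 (eq≥ mm)) (identity₁ δ m m′ g)
    ; upper = lin₀ {2 * m′} {δ + g} {δ + 2 * (m + m′)} {2 * m + g + 2 * δ}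
        (lower ⊕ *-monoʳ-≤ 2 (eq≤ mm)) (identity₂ δ m m′ g)
    }
    where
    open Central C
    regroup : ∀ v w m m′ → m + v + (m′ + w) ≡ (v + w) + (m + m′)
    regroup v w m m′ = solve (v ∷ w ∷ m ∷ m′ ∷ [])
    sum : ∀ v w m m′ → v + w ≡ δ → m + m′ ≡ δ → m + v + (m′ + w) ≡ 2 * δ
    sum v w m m′ vw mm = trans (regroup v w m m′) (trans (cong₂ _+_ vw mm) (cong (δ +_) (sym (+-identityʳ δ))))
    identity₁ : ∀ δ m m′ g → δ + (δ + g + 2 * (m + m′)) ≡ (2 * m′ + g) + (2 * m + 2 * δ)
    identity₁ δ m m′ g = solve (δ ∷ m ∷ m′ ∷ g ∷ [])
    identity₂ : ∀ δ m m′ g → (2 * m′) + (2 * m + g + 2 * δ) ≡ (δ + g) + (δ + 2 * (m + m′))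
    identity₂ δ m m′ g = solve (δ ∷ m ∷ m′ ∷ g ∷ [])

  -- Values beyond δ/2 go through their complements, so that `μ` commutes with taking complements;
  -- rounding everything up to `centre` would not do so for odd `δ`.
  μ : ℕ → ℕ
  μ v with 2 * v ≤? δ
  ... | yes _ = top v
  ... | no  _ = δ ∸ top (δ ∸ v)

  top≤δ : ∀ v → 2 * v ≤ δ → 1 ≤ δ → top v ≤ δ
  top≤δ v h 1≤δ = ≤-trans (top≤centre v (2v≤δ⇒v≤centre v h))
    (lin 1 1 {centre} {δ} {2 * centre + 1} {suc δ + δ} (centre-upper ⊕ 1≤δ) (identity δ centre))
    where
    identity : ∀ δ c → 2 * c + (suc δ + δ) + 1 ≡ 2 * δ + 1 + (2 * c + 1)
    identity δ c = solve (δ ∷ c ∷ [])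

  module _ (1≤δ : 1 ≤ δ) where

    μ-central : ∀ v → v ≤ δ → Central v (μ v)
    μ-central v v≤δ with 2 * v ≤? δ
    ... | yes h = top-central v h
    ... | no ¬h = central-opposite (m∸n+n≡m v≤δ) (m+[n∸m]≡n (top≤δ (δ ∸ v) h′ 1≤δ)) (top-central (δ ∸ v) h′)
      where
      h′ : 2 * (δ ∸ v) ≤ δ
      h′ = complement-short v≤δ ¬h

    v≤μ : ∀ v → 2 * v ≤ δ → v ≤ μ v
    v≤μ v h with 2 * v ≤? δ
    ... | yes _ = v≤top v
    ... | no ¬h = contradiction h ¬h

    μ-opposite : ∀ v w → v + w ≡ δ → μ v + μ w ≡ δ
    μ-opposite v w vw with 2 * v ≤? δ | 2 * w ≤? δ
    ... | yes h | no _ = trans (cong (λ u → top v + (δ ∸ top u)) δ∸w≡v) (m+[n∸m]≡n (top≤δ v h 1≤δ))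
      where
      δ∸w≡v : δ ∸ w ≡ v
      δ∸w≡v = trans (cong (_∸ w) (sym vw)) (m+n∸n≡m v w)
    ... | no _ | yes h = trans (cong (λ u → (δ ∸ top u) + top w) δ∸v≡w) (m∸n+n≡m (top≤δ w h 1≤δ))
      where
      δ∸v≡w : δ ∸ v ≡ w
      δ∸v≡w = trans (cong (_∸ v) (sym vw)) (m+n∸m≡n v w)
    ... | no ¬h | no ¬h′ = ⊥-elim (lin⊥ 1 {suc δ + (suc δ + 2 * (v + w))} {2 * v + (2 * w + 2 * δ)}
        (≰⇒> ¬h ⊕ ≰⇒> ¬h′ ⊕ *-monoʳ-≤ 2 (eq≤ vw)) (identity v w δ))
      where
      identity : ∀ v w δ → suc (2 * v + (2 * w + 2 * δ) + 1) ≡ suc δ + (suc δ + 2 * (v + w))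
      identity v w δ = solve (v ∷ w ∷ δ ∷ [])
    -- Both values are δ/2, and there is no room between them and `centre`.
    ... | yes h | yes h′ = trans (cong₂ _+_ (top-half v w h h′ vw) (top-half w v h′ h (trans (+-comm w v) vw))) vw
      where
      top-half : ∀ v w → 2 * v ≤ δ → 2 * w ≤ δ → v + w ≡ δ → top v ≡ v
      top-half v w h h′ vw = ≤-antisym (≤-trans (top≤centre v (2v≤δ⇒v≤centre v h))
        (lin 1 0 {centre} {v} {2 * centre + (2 * w + 2 * δ)} {suc δ + (δ + 2 * (v + w))}
          (centre-upper ⊕ h′ ⊕ *-monoʳ-≤ 2 (eq≥ vw)) (identity v w δ centre))) (v≤top v)
        where
        identity : ∀ v w δ c → 2 * c + (suc δ + (δ + 2 * (v + w))) + 0 ≡ 2 * v + 1 + (2 * c + (2 * w + 2 * δ))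
        identity v w δ c = solve (v ∷ w ∷ δ ∷ c ∷ [])

-- `2 * K + g ≤ suc δ` makes every distance that is not near at least `K`. `g < δ` keeps central
-- values positive and lets two of them outweigh a third.
module Completion {δ g K : ℕ} (g∣2 : g ∣ 2) (g<δ : g < δ) (2K+g≤ : 2 * K + g ≤ suc δ)
  (G : Graph δ g) (good≤δ : Walks.Good G K δ) where

  open Graph G
  open Walks G
  open Divisor2 g∣2
  open Middle δ g g∣2

  1≤g : 1 ≤ g
  1≤g = n≢0⇒n>0 λ { refl → contradiction (0∣⇒≡0 g∣2) λ () }

  1≤δ : 1 ≤ δ
  1≤δ = ≤-trans 1≤g (<⇒≤ g<δ)

  2K≤δ : 2 * K ≤ δ
  2K≤δ = lin₀ {2 * K} {δ} {2 * K + g + 1} {suc δ + g} (2K+g≤ ⊕ 1≤g) (identity K g δ)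
    where
    identity : ∀ K g δ → (2 * K) + (suc δ + g) ≡ δ + (2 * K + g + 1)
    identity K g δ = solve (K ∷ g ∷ δ ∷ [])

  -- Edges have positive labels, so a walk with `δ` or more edges has length at least `δ`, which is
  -- too long for each alternative of `BadCond`.
  good : ∀ s → Good K s
  good s {k} {L} {x} {y} σ a w _ with suc k ≤? δ
  ... | yes k<δ = good≤δ σ a w k<δ
  ... | no k≮δ = too-long σ
    where
    δ≤L : δ ≤ L
    δ≤L = ≤-trans (s≤s⁻¹ (≰⇒> k≮δ)) (steps≤length w)
    too-long : ∀ σ → ¬ BadCond K σ (r x y) L
    too-long true  h = <⇒≱ h (≤-trans δ≤L (m≤n+m L (r x y)))
    too-long false (inj₁ h) = <⇒≱ h (≤-trans (≤-trans (m≤n*m (r x y) 2) (adj-short a)) δ≤L)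
    too-long false (inj₂ (_ , h)) = <⇒≱ h (≤-trans 2K≤δ (≤-trans δ≤L (m≤n+m L (r x y))))

  walk? : ∀ k L x z → Dec (Walk k L x z)
  walk? zero zero x z = map′ (λ { refl → stay }) (λ { stay → refl }) (x ≟V z)
  walk? zero (suc L) x z = no λ ()
  walk? (suc k) L x z = map′
    (λ (y , a , r≤L , w) → cast refl (m+[n∸m]≡n r≤L) (a ▸ w))
    (λ { (_▸_ {L = L′} {y = y} a w) → y , a , m≤m+n (r x y) L′ , cast refl (sym (m+n∸m≡n (r x y) L′)) w })
    (Finite.any-finite? V-finite λ y →
      adj? x y ×-dec (r x y ≤? L) ×-dec walk? k (L ∸ r x y) y z)

  record Reach (L : ℕ) (x z : V) : Set where
    constructor reach
    field
      {steps} : ℕ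
      walk    : Walk steps L x z

  -- Edges have positive labels, so only walks with at most `L` edges need to be tried.
  reach? : ∀ x z L → Dec (Reach L x z)
  reach? x z L = map′ (λ (_ , _ , w) → reach w) (λ (reach w) → _ , s≤s (steps≤length w) , w)
    (anyUpTo? (λ k → walk? k L x z) (suc L))

  infixr 5 _++ᴿ_
  _++ᴿ_ : ∀ {a b x y z} → Reach a x y → Reach b y z → Reach (a + b) x z
  reach v ++ᴿ reach w = reach (v ++ w)

  reverseᴿ : ∀ {a x y} → Reach a x y → Reach a y x
  reverseᴿ (reach w) = reach (reverse w)

  twistᴿ : ∀ {a x y} → Reach a x y → Reach a (τ x) (τ y)
  twistᴿ (reach w) = reach (twist true w)

  untwistᴿ : ∀ {a x y} → Reach a (τ x) y → Reach a x (τ y)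
  untwistᴿ {a} {x} {y} w = subst (λ u → Reach a u (τ y)) (τ-invol x) (twistᴿ w)

  antipodal-length : ∀ {a b x z} → Reach a x z → Reach b x (τ z) → δ ≤ a + b
  antipodal-length {a} {b} {x} {z} u v with reverseᴿ u ++ᴿ v
  ... | reach w = GoodWalks.antipodal (good _) w refl ≤-refl

  odd-length : ∀ {a x} → Reach a x x → Odd a → 2 * K ≤ a
  odd-length (reach w) = GoodWalks.odd-closed (good _) w ≤-refl

  -- By `r-par` labels add up along triangles modulo `g`, so the length of a walk telescopes to the
  -- label of its ends.
  walk-congruent : ∀ {k L x z} → Walk k L x z → g ∣ L + r x z
  walk-congruent {x = x} stay = drop-2* {r x x} {r x x} (r-par x x x) (identity (r x x))
    where
    identity : ∀ v → v + v + v ≡ v + 2 * v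
    identity v = solve (v ∷ [])
  walk-congruent (_▸_ {L = L} {x = x} {y} {z} a w) =
    drop-2* {(r x y + L) + r x z} {r y z} (∣m∣n⇒∣m+n (walk-congruent w) (r-par x y z))
      (identity L (r x y) (r y z) (r x z))
    where
    identity : ∀ L a b c → (L + b) + (a + b + c) ≡ ((a + L) + c) + 2 * b
    identity L a b c = solve (L ∷ a ∷ b ∷ c ∷ [])

  open Flips G {K} using (r≤δ)

  m : V → V → ℕ
  m x z = μ (r x z)

  m-sym : ∀ x z → m x z ≡ m z x
  m-sym x z = cong μ (r-sym x z)

  m-central : ∀ x z → Central (r x z) (m x z)
  m-central x z = μ-central 1≤δ (r x z) (r≤δ x z)

  r-τʳ : ∀ x z → r x (τ z) + r x z ≡ δ
  r-τʳ x z = trans (cong₂ _+_ (r-sym x (τ z)) (r-sym x z)) (r-τ z x)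

  m-τʳ : ∀ x z → m x (τ z) + m x z ≡ δ
  m-τʳ x z = μ-opposite 1≤δ (r x (τ z)) (r x z) (r-τʳ x z)

  r-ττʳ : ∀ x z → r x (τ z) ≡ r (τ x) z
  r-ττʳ x z = trans (sym (r-ττ x (τ z))) (cong (r (τ x)) (τ-invol z))

  record Near (x z : V) (v : ℕ) : Set where
    field
      below   : v < m x z
      path    : Reach v x z
      minimal : ∀ {l} → Reach l x z → v ≤ l

  NoNear : V → V → Set
  NoNear x z = ∀ {l} → Reach l x z → m x z ≤ l

  -- A relation with one value for each pair, by `dist` and `dist-unique`. Symmetry, antipodes and
  -- automorphisms are then handled by transporting a case instead of following the search.
  data Dist (x z : V) (v : ℕ) : Set where
    near : Near x z v → Dist x z v
    far  : ∀ {c} → Near x (τ z) c → v + c ≡ δ → Dist x z v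
    mid  : NoNear x z → NoNear x (τ z) → v ≡ m x z → Dist x z v

  dist : ∀ x z → ∃ (Dist x z)
  dist x z with least (reach? x z) (m x z) | least (reach? x (τ z)) (m x (τ z))
  ... | inj₁ (v , v<m , p , min) | _ = v , near (record { below = v<m ; path = p ; minimal = min _ })
  ... | inj₂ _ | inj₁ (c , c<m , p , min) = δ ∸ c ,
    far (record { below = c<m ; path = p ; minimal = min _ })
        (m∸n+n≡m (≤-trans (<⇒≤ c<m) (≤-trans (m≤m+n _ (m x z)) (eq≤ (m-τʳ x z)))))
  ... | inj₂ none | inj₂ none′ = m x z , mid (none _) (none′ _) refl

  -- The two walks would join `z` to `τ z` with total length below `m x z + m x (τ z)`, which is
  -- `δ`.
  near-exclusive : ∀ {x z v c} → Near x z v → Near x (τ z) c → ⊥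
  near-exclusive {x} {z} {v} {c} N N′ = lin⊥ 1 {suc v + (suc c + (δ + δ))} {m x z + (m x (τ z) + (v + c + δ))}
    (Near.below N ⊕ Near.below N′ ⊕ antipodal-length (Near.path N) (Near.path N′) ⊕ ≤-refl)
    (trans (identity (m x z) (m x (τ z)) v c δ) (cong (λ u → suc v + (suc c + (u + δ))) (m-τʳ x z)))
    where
    identity : ∀ m m′ v c δ → suc (m + (m′ + (v + c + δ)) + 1) ≡ suc v + (suc c + ((m′ + m) + δ))
    identity m m′ v c δ = solve (m ∷ m′ ∷ v ∷ c ∷ δ ∷ [])

  near-noNear : ∀ {x z v} → Near x z v → NoNear x z → ⊥
  near-noNear N none = <⇒≱ (Near.below N) (none (Near.path N))

  near-unique : ∀ {x z v w} → Near x z v → Near x z w → v ≡ w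
  near-unique N N′ = ≤-antisym (Near.minimal N (Near.path N′)) (Near.minimal N′ (Near.path N))

  dist-unique : ∀ {x z v w} → Dist x z v → Dist x z w → v ≡ w
  dist-unique (near N)     (near N′)    = near-unique N N′
  dist-unique (near N)     (far N′ _)   = ⊥-elim (near-exclusive N N′)
  dist-unique (near N)     (mid ∄ _ _)  = ⊥-elim (near-noNear N ∄)
  dist-unique (far N _)    (near N′)    = ⊥-elim (near-exclusive N′ N)
  dist-unique {v = v} {w} (far {c} N eq) (far N′ eq′) with refl ← near-unique N N′ = +-cancelʳ-≡ c v w (trans eq (sym eq′))
  dist-unique (far N _)    (mid _ ∄ _)  = ⊥-elim (near-noNear N ∄)
  dist-unique (mid ∄ _ _)  (near N)     = ⊥-elim (near-noNear N ∄)
  dist-unique (mid _ ∄ _)  (far N _)    = ⊥-elim (near-noNear N ∄)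
  dist-unique (mid _ _ eq) (mid _ _ eq′) = trans eq (sym eq′)

  near-sym : ∀ {x z v} → Near x z v → Near z x v
  near-sym {x} {z} N = record
    { below = subst (_ <_) (m-sym x z) (Near.below N)
    ; path = reverseᴿ (Near.path N)
    ; minimal = Near.minimal N ∘ reverseᴿ }

  near-sym-τ : ∀ {x z v} → Near x (τ z) v → Near z (τ x) v
  near-sym-τ {x} {z} N = record
    { below = subst (_ <_) (cong μ (trans (r-ττʳ x z) (r-sym (τ x) z))) (Near.below N)
    ; path = untwistᴿ (reverseᴿ (Near.path N))
    ; minimal = λ w → Near.minimal N (untwistᴿ (reverseᴿ w)) }

  noNear-sym : ∀ {x z} → NoNear x z → NoNear z x
  noNear-sym {x} {z} ∄ w = ≤-trans (eq≤ (m-sym z x)) (∄ (reverseᴿ w))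

  noNear-sym-τ : ∀ {x z} → NoNear x (τ z) → NoNear z (τ x)
  noNear-sym-τ {x} {z} ∄ w = ≤-trans (eq≤ (cong μ (sym (trans (r-ττʳ x z) (r-sym (τ x) z)))))
    (∄ (untwistᴿ (reverseᴿ w)))

  dist-sym : ∀ {x z v} → Dist x z v → Dist z x v
  dist-sym (near N)      = near (near-sym N)
  dist-sym (far N eq)    = far (near-sym-τ N) eq
  dist-sym {x} {z} (mid ∄ ∄′ eq) = mid (noNear-sym ∄) (noNear-sym-τ ∄′) (trans eq (m-sym x z))

  dist-τ : ∀ {x z v w} → Dist x z v → w + v ≡ δ → Dist x (τ z) w
  dist-τ {x} {z} {v} (near N) eq = far (subst (λ u → Near x u v) (sym (τ-invol z)) N) eq
  dist-τ {x} {z} {v} {w} (far {c} N vc) wv = near (subst (Near x (τ z)) c≡w N)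
    where
    c≡w : c ≡ w
    c≡w = +-cancelʳ-≡ v c w (trans (trans (+-comm c v) vc) (sym wv))
  dist-τ {x} {z} {v} {w} (mid ∄ ∄′ refl) wv =
    mid ∄′ (subst (NoNear x) (sym (τ-invol z)) ∄) (+-cancelʳ-≡ v w _ (trans wv (sym (m-τʳ x z))))

  dist≤δ : ∀ {x z v} → Dist x z v → v ≤ δ
  dist≤δ {x} {z} (near N) = ≤-trans (<⇒≤ (Near.below N)) (≤-trans (m≤n+m _ (m x (τ z))) (eq≤ (m-τʳ x z)))
  dist≤δ (far {c} _ eq) = ≤-trans (m≤m+n _ c) (eq≤ eq)
  dist≤δ {x} {z} (mid _ _ refl) = ≤-trans (m≤n+m _ (m x (τ z))) (eq≤ (m-τʳ x z))

  near-congruent : ∀ {x z v} → Near x z v → g ∣ v + r x z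
  near-congruent N with reach w ← Near.path N = walk-congruent w

  -- Both `v` and the central value are congruent to the label, so a smaller `v` is smaller by at
  -- least `g`.
  near-small : ∀ {x z v} → Near x z v → 2 * v + g ≤ δ
  near-small {x} {z} {v} N = lin₀ {2 * v + g} {δ} {2 * (v + g) + 2 * m x z} {2 * m x z + (δ + g)}
    (*-monoʳ-≤ 2 (congruent-gap congruent-vm (Near.below N)) ⊕ Central.upper (m-central x z))
    (identity v g δ (m x z))
    where
    identity : ∀ v g δ m → (2 * v + g) + (2 * m + (δ + g)) ≡ δ + (2 * (v + g) + 2 * m)
    identity v g δ m = solve (v ∷ g ∷ δ ∷ m ∷ [])
    regroup : ∀ v ρ m → (v + ρ) + (m + ρ) ≡ (v + m) + 2 * ρ
    regroup v ρ m = solve (v ∷ ρ ∷ m ∷ [])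
    congruent-vm : g ∣ v + m x z
    congruent-vm = drop-2* {v + m x z} {r x z}
      (∣m∣n⇒∣m+n (near-congruent N) (Central.congruent (m-central x z))) (regroup v (r x z) (m x z))

  dist-congruent : ∀ {x z v} → Dist x z v → g ∣ v + r x z
  dist-congruent (near N) = near-congruent N
  dist-congruent {x} {z} (mid _ _ refl) = Central.congruent (m-central x z)
  dist-congruent {x} {z} {v} (far {c} N vc) = ∣m+n∣m⇒∣n (subst (g ∣_) (sym total) (g∣2* δ)) (near-congruent N)
    where
    regroup : ∀ c v ρ ρ′ → (c + ρ′) + (v + ρ) ≡ (v + c) + (ρ′ + ρ)
    regroup c v ρ ρ′ = solve (c ∷ v ∷ ρ ∷ ρ′ ∷ [])
    total : (c + r x (τ z)) + (v + r x z) ≡ 2 * δ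
    total = trans (regroup c v (r x z) (r x (τ z))) (trans (cong₂ _+_ vc (r-τʳ x z)) (cong (δ +_) (sym (+-identityʳ δ))))

  triple-congruent : ∀ {x y z a b v} → Dist x y a → Dist y z b → Dist x z v → g ∣ a + b + v
  triple-congruent {x} {y} {z} {a} {b} {v} Da Db Dv = drop-2* {a + b + v} {α + β + γ}
    (∣m∣n⇒∣m+n (∣m∣n⇒∣m+n (dist-congruent Da) (dist-congruent Db))
      (∣m∣n⇒∣m+n (dist-congruent Dv) (r-par x y z)))
    (identity a b v α β γ)
    where
    α = r x y
    β = r y z
    γ = r x z
    identity : ∀ a b v α β γ → (a + α) + (b + β) + ((v + γ) + (α + β + γ)) ≡ (a + b + v) + 2 * (α + β + γ)
    identity a b v α β γ = solve (a ∷ b ∷ v ∷ α ∷ β ∷ γ ∷ [])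

  far-large : ∀ {x z v c} → Near x (τ z) c → v + c ≡ δ → δ + g ≤ 2 * v
  far-large {x} {z} {v} {c} N vc = lin₀ {δ + g} {2 * v} {2 * c + g + 2 * δ} {δ + 2 * (v + c)}
    (near-small N ⊕ *-monoʳ-≤ 2 (eq≥ vc)) (identity v c g δ)
    where
    identity : ∀ v c g δ → (δ + g) + (δ + 2 * (v + c)) ≡ (2 * v) + (2 * c + g + 2 * δ)
    identity v c g δ = solve (v ∷ c ∷ g ∷ δ ∷ [])

  -- A far distance is `δ` minus the length of a walk to `τ z`, and this walk together with any walk
  -- to `z` has length at least `δ`.
  dist≤reach : ∀ {x z v l} → Dist x z v → Reach l x z → v ≤ l
  dist≤reach (near N) w = Near.minimal N w
  dist≤reach {v = v} {l} (far {c} N vc) w = lin₀ {v} {l} {v + c + δ} {δ + (l + c)}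
    (eq≤ vc ⊕ antipodal-length w (Near.path N)) (identity v l c δ)
    where
    identity : ∀ v l c δ → v + (δ + (l + c)) ≡ l + (v + c + δ)
    identity v l c δ = solve (v ∷ l ∷ c ∷ δ ∷ [])
  dist≤reach (mid ∄ _ refl) w = ∄ w

  δ≤dist+reach : ∀ {x z v l} → Dist x z v → Reach l x (τ z) → δ ≤ v + l
  δ≤dist+reach {v = v} {l} D w = lin₀ {δ} {v + l} {(δ ∸ v) + δ} {l + ((δ ∸ v) + v)}
    (dist≤reach (dist-τ D (m∸n+n≡m (dist≤δ D))) w ⊕ eq≥ (m∸n+n≡m (dist≤δ D))) (identity (δ ∸ v) v l δ)
    where
    identity : ∀ u v l δ → δ + (l + (u + v)) ≡ (v + l) + (u + δ)
    identity u v l δ = solve (u ∷ v ∷ l ∷ δ ∷ [])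

  NonNear : ℕ → Set
  NonNear v = δ ≤ 2 * v + g

  near? : ∀ {x z v} → Dist x z v → Near x z v ⊎ NonNear v
  near? (near N) = inj₁ N
  near? {v = v} (far N vc) = inj₂ (≤-trans (m≤m+n δ g) (≤-trans (far-large N vc) (m≤m+n (2 * v) g)))
  near? {x} {z} (mid _ _ refl) = inj₂ (Central.lower (m-central x z))

  half-≤ : ∀ v w {u} → 2 * v + u ≤ δ → δ ≤ 2 * w + u → v ≤ w
  half-≤ v w {u} h h′ = *-cancelˡ-≤ 2 (+-cancelʳ-≤ u (2 * v) (2 * w) (≤-trans h h′))

  -- By the congruence a failure would have a gap of at least `g`. But two central values plus `g`
  -- reach `δ`, while a single one stays below it since `g < δ`.
  mid-triangle : ∀ {a b} x y z → a ≡ m x y → b ≡ m y z → g ∣ a + b + m x z → m x z ≤ a + b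
  mid-triangle {a} {b} x y z refl refl cong-g = ≮⇒≥ λ gap → lin⊥ 0
    {2 * (a + b + g) + (2 * v + (δ + (δ + suc g)))} {2 * v + (δ + g + (2 * a + g + (2 * b + g + δ)))}
    (*-monoʳ-≤ 2 (congruent-gap cong-g gap) ⊕ Central.upper (m-central x z)
      ⊕ Central.lower (m-central x y) ⊕ Central.lower (m-central y z) ⊕ g<δ)
    (identity a b v g δ)
    where
    v = m x z
    identity : ∀ a b v g δ → suc (2 * v + (δ + g + (2 * a + g + (2 * b + g + δ))) + 0)
      ≡ 2 * (a + b + g) + (2 * v + (δ + (δ + suc g)))
    identity a b v g δ = solve (a ∷ b ∷ v ∷ g ∷ δ ∷ [])

  no-overshoot-by-shortcut : ∀ {v w} a b → v + w ≡ δ → δ ≤ a + (w + b) → v ≤ a + b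
  no-overshoot-by-shortcut {v} {w} a b vw h = lin₀ {v} {a + b} {v + w + δ} {δ + (a + (w + b))}
    (eq≤ vw ⊕ h) (identity v w a b δ)
    where
    identity : ∀ v w a b δ → v + (δ + (a + (w + b))) ≡ (a + b) + (v + w + δ)
    identity v w a b δ = solve (v ∷ w ∷ a ∷ b ∷ δ ∷ [])

  far-far : ∀ a b {v u} → v ≤ δ → δ + u ≤ 2 * a → δ ≤ 2 * b + u → v ≤ a + b
  far-far a b {v} {u} v≤δ ha hb = lin 1 1 {v} {a + b} {2 * v + (δ + u + δ)} {2 * δ + (2 * a + (2 * b + u))}
    (*-monoʳ-≤ 2 v≤δ ⊕ ha ⊕ hb) (identity a b v u δ)
    where
    identity : ∀ a b v u δ → 2 * v + (2 * δ + (2 * a + (2 * b + u))) + 1 ≡ 2 * (a + b) + 1 + (2 * v + (δ + u + δ))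
    identity a b v u δ = solve (a ∷ b ∷ v ∷ u ∷ δ ∷ [])

  -- The congruence makes up for the defect of a + b against δ, except when w = 0 and x = τ z.
  mid-mid-far : ∀ {a b v w x y z} → a ≡ m x y → b ≡ m y z → Near x (τ z) w → v + w ≡ δ →
    g ∣ a + b + v → v ≤ a + b
  mid-mid-far {a} {b} {v} {w} {x} {y} {z} refl refl N vw cong-g with Near.path N
  ... | reach stay = ≤-trans (m≤m+n v w) (eq≤ (trans vw (trans (sym (m-τʳ y z)) (trans (+-comm (m y (τ z)) (m y z))
          (trans (cong (m y z +_) (m-sym y x)) (+-comm (m y z) (m x y)))))))
  ... | reach p@(edge ▸ _) = ≮⇒≥ λ gap → lin⊥ 1 {2 * (a + b + g) + (δ + (δ + (2 * (v + w) + 2 * 1)))}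
          {2 * v + (2 * a + g + (2 * b + g + (2 * δ + 2 * w)))}
          (*-monoʳ-≤ 2 (congruent-gap cong-g gap) ⊕ Central.lower (m-central x y) ⊕ Central.lower (m-central y z)
            ⊕ *-monoʳ-≤ 2 (eq≤ vw) ⊕ *-monoʳ-≤ 2 (≤-trans (s≤s z≤n) (steps≤length p)))
          (identity a b v w g δ)
    where
    identity : ∀ a b v w g δ → suc (2 * v + (2 * a + g + (2 * b + g + (2 * δ + 2 * w))) + 1)
      ≡ 2 * (a + b + g) + (δ + (δ + (2 * (v + w) + 2 * 1)))
    identity a b v w g δ = solve (a ∷ b ∷ v ∷ w ∷ g ∷ δ ∷ [])

  -- Central values differ by at most `g`, and a failure would have a gap of at least `g` beyond
  -- `a + b`, so a positive `a` excludes it. For the empty walk `x` and `y` coincide.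
  near-mid-mid : ∀ {a b v} x y z → Near x y a → b ≡ m y z → v ≡ m x z → g ∣ a + b + v → v ≤ a + b
  near-mid-mid {a} x y z N refl refl cong-g with Near.path N
  ... | reach stay = m≤n+m (m x z) a
  ... | reach p@(edge ▸ _) = ≮⇒≥ λ gap → lin⊥ 1 {2 * (a + b + g) + (2 * v + (δ + 2 * 1))} {2 * v + (δ + g + (2 * b + g + 2 * a))}
          (*-monoʳ-≤ 2 (congruent-gap cong-g gap) ⊕ Central.upper (m-central x z) ⊕ Central.lower (m-central y z)
            ⊕ *-monoʳ-≤ 2 (≤-trans (s≤s z≤n) (steps≤length p)))
          (identity a b v g δ)
    where
    b = m y z
    v = m x z
    identity : ∀ a b v g δ → suc (2 * v + (δ + g + (2 * b + g + 2 * a)) + 1) ≡ 2 * (a + b + g) + (2 * v + (δ + 2 * 1))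
    identity a b v g δ = solve (a ∷ b ∷ v ∷ g ∷ δ ∷ [])

  swap-sum : ∀ a b v → a + b + v ≡ b + a + v
  swap-sum a b v = cong (_+ v) (+-comm a b)

  -- Two near sides compose to a walk, which bounds the third. A near third side is at most any side
  -- that is not near. A far third side next to a near side is a statement about walks to `τ z`. The
  -- remaining cases compare sizes with δ/2, and the congruence supplies the missing slack when
  -- central values meet.
  dist-triangle : ∀ {x y z a b v} → Dist x y a → Dist y z b → Dist x z v → v ≤ a + b
  dist-triangle (near A) (near B) D = dist≤reach D (Near.path A ++ᴿ Near.path B)
  dist-triangle {a = a} {b} {v} Da Db (near N) with near? Da | near? Db
  ... | inj₂ ha | _ = ≤-trans (half-≤ v a (near-small N) ha) (m≤m+n a b)
  ... | _ | inj₂ hb = ≤-trans (half-≤ v b (near-small N) hb) (m≤n+m b a)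
  ... | inj₁ A | inj₁ B = Near.minimal N (Near.path A ++ᴿ Near.path B)
  dist-triangle {a = a} {b} Da (near B) (far {w} W vw) = no-overshoot-by-shortcut a b vw
    (δ≤dist+reach Da (Near.path W ++ᴿ twistᴿ (reverseᴿ (Near.path B))))
  dist-triangle {a = a} {b} {v} (near A) Db (far {w} W vw) = ≤-trans
    (no-overshoot-by-shortcut b a vw (≤-trans (δ≤dist+reach Db (reverseᴿ (Near.path A) ++ᴿ Near.path W))
      (eq≤ (cong (b +_) (+-comm a w)))))
    (eq≤ (+-comm b a))
  dist-triangle {a = a} {b} (far A ac) (far B bc) D@(far _ _) =
    far-far a b (dist≤δ D) (far-large A ac) (≤-trans (m≤m+n δ g) (≤-trans (far-large B bc) (m≤m+n _ g)))
  dist-triangle {y = y} {z} {a} {b} (far A ac) (mid _ _ refl) D@(far _ _) =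
    far-far a b (dist≤δ D) (far-large A ac) (Central.lower (m-central y z))
  dist-triangle {x} {y} {a = a} {b} (mid _ _ refl) (far B bc) D@(far _ _) = ≤-trans
    (far-far b a (dist≤δ D) (far-large B bc) (Central.lower (m-central x y))) (eq≤ (+-comm b a))
  dist-triangle Da@(mid _ _ eqa) Db@(mid _ _ eqb) D@(far W vw) =
    mid-mid-far eqa eqb W vw (triple-congruent Da Db D)
  dist-triangle {x} {y} {z} Da@(near A) Db@(mid _ _ eqb) D@(mid _ _ eqv) =
    near-mid-mid x y z A eqb eqv (triple-congruent Da Db D)
  dist-triangle {x} {y} {z} {a} {b} {v} Da@(mid _ _ eqa) Db@(near B) D@(mid _ _ eqv) = ≤-trans
    (near-mid-mid z y x (near-sym B) (trans eqa (m-sym x y)) (trans eqv (m-sym x z))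
      (subst (g ∣_) (swap-sum a b v) (triple-congruent Da Db D)))
    (eq≤ (+-comm b a))
  dist-triangle {x} {y} {z} Da@(mid _ _ eqa) Db@(mid _ _ eqb) D@(mid _ _ refl) =
    mid-triangle x y z eqa eqb (triple-congruent Da Db D)
  dist-triangle {x} {z = z} {a} {b} (far A ac) Db (mid _ _ refl) =
    ≤-trans (*-cancelˡ-≤ 2 (≤-trans (Central.upper (m-central x z)) (far-large A ac))) (m≤m+n a b)
  dist-triangle {x} {z = z} {a} {b} Da (far B bc) (mid _ _ refl) =
    ≤-trans (*-cancelˡ-≤ 2 (≤-trans (Central.upper (m-central x z)) (far-large B bc))) (m≤n+m b a)

  -- The triangle inequality for `x`, `y` and `τ z`.
  dist-perimeter : ∀ {x y z a b v} → Dist x y a → Dist y z b → Dist x z v → a + b + v ≤ 2 * δ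
  dist-perimeter {a = a} {b} {v} Da Db Dv = lin₀ {a + b + v} {2 * δ}
    {a + ((b′ + b) + (v′ + v))} {(v′ + b′) + (δ + δ)}
    (dist-triangle (dist-τ Dv ev) (dist-sym (dist-τ Db eb)) Da ⊕ eq≤ eb ⊕ eq≤ ev)
    (identity a b v b′ v′ δ)
    where
    b′ = δ ∸ b
    v′ = δ ∸ v
    eb : b′ + b ≡ δ
    eb = m∸n+n≡m (dist≤δ Db)
    ev : v′ + v ≡ δ
    ev = m∸n+n≡m (dist≤δ Dv)
    identity : ∀ a b v b′ v′ δ → (a + b + v) + ((v′ + b′) + (δ + δ)) ≡ (2 * δ) + (a + ((b′ + b) + (v′ + v)))
    identity a b v b′ v′ δ = solve (a ∷ b ∷ v ∷ b′ ∷ v′ ∷ δ ∷ [])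

  long-side : ∀ c s → NonNear c → c ≤ s → 2 * K ≤ s + c
  long-side c s h c≤s = ≤-trans (*-monoʳ-≤ 2 K≤c)
    (≤-trans (eq≤ (cong (c +_) (+-identityʳ c))) (+-monoˡ-≤ c c≤s))
    where
    identity : ∀ K c g δ → 2 * K + (suc δ + (2 * c + g)) + 0 ≡ 2 * c + 1 + (2 * K + g + δ)
    identity K c g δ = solve (K ∷ c ∷ g ∷ δ ∷ [])
    K≤c : K ≤ c
    K≤c = lin 1 0 {K} {c} {2 * K + g + δ} {suc δ + (2 * c + g)} (2K+g≤ ⊕ h) (identity K c g δ)

  -- Three near sides form an odd closed walk. Otherwise some side is at least `K`, and the other
  -- two together are no shorter than it.
  dist-odd-lower : ∀ {x y z a b v} → Dist x y a → Dist y z b → Dist x z v →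
    Odd (a + b + v) → 2 * K ≤ a + b + v
  dist-odd-lower {a = a} {b} {v} Da Db Dv o with near? Da | near? Db | near? Dv
  ... | inj₁ A | inj₁ B | inj₁ N = odd-length ((Near.path A ++ᴿ Near.path B) ++ᴿ reverseᴿ (Near.path N)) o
  ... | _ | _ | inj₂ h = long-side v (a + b) h (dist-triangle Da Db Dv)
  ... | inj₂ h | _ | _ = ≤-trans (long-side a (v + b) h (dist-triangle Dv (dist-sym Db) Da)) (eq≤ (regroup a b v))
    where
    regroup : ∀ a b v → v + b + a ≡ a + b + v
    regroup a b v = solve (a ∷ b ∷ v ∷ [])
  ... | _ | inj₂ h | _ = ≤-trans (long-side b (a + v) h (dist-triangle (dist-sym Da) Dv Db)) (eq≤ (regroup a b v))
    where
    regroup : ∀ a b v → a + v + b ≡ a + b + v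
    regroup a b v = solve (a ∷ b ∷ v ∷ [])

  -- The lower bound for `x`, `y` and `τ z`; two sides are flipped, so the parity of the perimeter
  -- stays.
  dist-odd-upper : ∀ {x y z a b v} → Dist x y a → Dist y z b → Dist x z v →
    Odd (a + b + v) → 2 * K + (a + b + v) ≤ 2 * δ + 2 * a
  dist-odd-upper {a = a} {b} {v} Da Db Dv o = lin₀ {2 * K + (a + b + v)} {2 * δ + 2 * a}
    {2 * K + ((b′ + b) + (v′ + v))} {(a + b′ + v′) + (δ + δ)}
    (dist-odd-lower Da (dist-τ Db eb) (dist-τ Dv ev) sum-odd ⊕ eq≤ eb ⊕ eq≤ ev)
    (identity a b v b′ v′ δ K)
    where
    b′ = δ ∸ b
    v′ = δ ∸ v
    eb : b′ + b ≡ δ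
    eb = m∸n+n≡m (dist≤δ Db)
    ev : v′ + v ≡ δ
    ev = m∸n+n≡m (dist≤δ Dv)
    identity : ∀ a b v b′ v′ δ K → (2 * K + (a + b + v)) + ((a + b′ + v′) + (δ + δ))
      ≡ (2 * δ + 2 * a) + (2 * K + ((b′ + b) + (v′ + v)))
    identity a b v b′ v′ δ K = solve (a ∷ b ∷ v ∷ b′ ∷ v′ ∷ δ ∷ K ∷ [])
    regroup : ∀ a b v b′ v′ → (a + b + v) + 2 * (b′ + v′) ≡ (a + b′ + v′) + ((b′ + b) + (v′ + v))
    regroup a b v b′ v′ = solve (a ∷ b ∷ v ∷ b′ ∷ v′ ∷ [])
    sum-odd : Odd (a + b′ + v′)
    sum-odd = Odd-drop-2* δ _ (Odd-add-2* (b′ + v′) _ o refl) (trans (regroup a b v b′ v′)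
      (cong ((a + b′ + v′) +_) (trans (cong₂ _+_ eb ev) (cong (δ +_) (sym (+-identityʳ δ))))))

  0<m : ∀ x z → 0 < m x z
  0<m x z = n≢0⇒n>0 λ eq → <⇒≱ g<δ (subst (λ u → δ ≤ 2 * u + g) eq (Central.lower (m-central x z)))

  near-refl : ∀ x → Near x x 0
  near-refl x = record { below = 0<m x x ; path = reach stay ; minimal = λ _ → z≤n }

  dist-0⇒≡ : ∀ {x z} → Dist x z 0 → x ≡ z
  dist-0⇒≡ (near N) with Near.path N
  ... | reach w = zero-length w refl
    where
    zero-length : ∀ {k L x z} → Walk k L x z → L ≡ 0 → x ≡ z
    zero-length stay      _  = refl
    zero-length (_▸_ {L = L} a w) eq = ⊥-elim (<⇒≢ (≤-trans (adj-pos a) (m≤m+n _ L)) (sym eq))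
  dist-0⇒≡ (far N vc) = ⊥-elim (<⇒≱ (≤-trans 1≤δ (m≤m+n δ g)) (far-large N vc))
  dist-0⇒≡ {x} {z} (mid _ _ eq) = ⊥-elim (<⇒≢ (0<m x z) eq)

  -- An edge is a shortest walk between its ends and at most δ/2, hence at most the central value.
  -- If it equals the central value, the pair falls under `mid` with the same result. This makes the
  -- embedding of the space isometric.
  dist-adj : ∀ {x z} → adj x z → Dist x z (r x z)
  dist-adj {x} {z} a = by-size (ρ <? m x z)
    where
    ρ = r x z
    path : Reach ρ x z
    path = reach (cast refl (+-identityʳ ρ) (a ▸ stay))
    minimal : ∀ {l} → Reach l x z → ρ ≤ l
    minimal (reach w) = GoodWalks.geodesic (good _) a (reverse w) ≤-refl
    ρ≤m : ρ ≤ m x z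
    ρ≤m = v≤μ 1≤δ ρ (adj-short a)
    none : NoNear x (τ z)
    none {l} w = +-cancelˡ-≤ (m x z) _ _ (begin
      m x z + m x (τ z) ≡⟨ +-comm (m x z) _ ⟩
      m x (τ z) + m x z ≡⟨ m-τʳ x z ⟩
      δ                 ≤⟨ antipodal-length path w ⟩
      ρ + l             ≤⟨ +-monoˡ-≤ l ρ≤m ⟩
      m x z + l         ∎)
      where open ≤-Reasoning
    by-size : Dec (ρ < m x z) → Dist x z ρ
    by-size (yes ρ<m) = near (record { below = ρ<m ; path = path ; minimal = minimal })
    by-size (no ρ≮m)  = mid (≤-trans (≮⇒≥ ρ≮m) ∘ minimal) none (≤-antisym ρ≤m (≮⇒≥ ρ≮m))

  walk-map : (α : Automorphismᴳ G) → ∀ {k L x y} → Walk k L x y → Walk k L (Automorphismᴳ.φ α x) (Automorphismᴳ.φ α y)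
  walk-map α stay = stay
  walk-map α (_▸_ {L = L} {x} {y} a w) =
    cast refl (cong (_+ L) (Automorphismᴳ.φ-r α x y)) (Automorphismᴳ.φ-adj α a ▸ walk-map α w)

  module _ (α : Automorphismᴳ G) where
    open Automorphismᴳ α

    reach-map⁻ : ∀ {L x y} → Reach L (φ x) (φ y) → Reach L x y
    reach-map⁻ {L} {x} {y} (reach w) = subst₂ (Reach L) (φ⁻¹φ x) (φ⁻¹φ y) (reach (walk-map inverse w))

    m-map : ∀ x z → m (φ x) (φ z) ≡ m x z
    m-map x z = cong μ (φ-r x z)

    near-map : ∀ {x z v} → Near x z v → Near (φ x) (φ z) v
    near-map {x} {z} N with reach w ← Near.path N = record
      { below = subst (_ <_) (sym (m-map x z)) (Near.below N)
      ; path = reach (walk-map α w)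
      ; minimal = Near.minimal N ∘ reach-map⁻ }

    noNear-map : ∀ {x z} → NoNear x z → NoNear (φ x) (φ z)
    noNear-map {x} {z} ∄ w = ≤-trans (eq≤ (m-map x z)) (∄ (reach-map⁻ w))

    dist-map : ∀ {x z v} → Dist x z v → Dist (φ x) (φ z) v
    dist-map (near N) = near (near-map N)
    dist-map {x} {z} (far {c} N eq) = far (subst (λ u → Near (φ x) u c) (φ-τ z) (near-map N)) eq
    dist-map {x} {z} (mid ∄ ∄′ eq) = mid (noNear-map ∄) (subst (NoNear (φ x)) (φ-τ z) (noNear-map ∄′))
      (trans eq (sym (m-map x z)))

-- The initial graph

bit : Bool → ℕ
bit false = 0
bit true  = 1

-- Words of δ bits; only the first N matter, and the label they encode is their number of ones.
module Words (δ : ℕ) where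

  get : ∀ {m} → Vec Bool m → ℕ → Bool
  get Vec.[]       c       = false
  get (x Vec.∷ xs) zero    = x
  get (x Vec.∷ xs) (suc c) = get xs c

  build : ∀ m → (ℕ → Bool) → Vec Bool m
  build zero    f = Vec.[]
  build (suc m) f = f 0 Vec.∷ build m (f ∘ suc)

  get-build : ∀ {m} f {c} → c < m → get (build m f) c ≡ f c
  get-build {suc m} f {zero}  _       = refl
  get-build {suc m} f {suc c} (s≤s h) = get-build (f ∘ suc) h

  get-ext : ∀ {m} {u v : Vec Bool m} → (∀ {c} → c < m → get u c ≡ get v c) → u ≡ v
  get-ext {u = Vec.[]} {Vec.[]} h = refl
  get-ext {u = x Vec.∷ xs} {y Vec.∷ ys} h = cong₂ Vec._∷_ (h z<s) (get-ext (h ∘ s≤s))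

  Word : Set
  Word = Vec Bool δ

  infixl 6 _⊞_
  _⊞_ : ∀ {m} → Vec Bool m → Vec Bool m → Vec Bool m
  _⊞_ = Vec.zipWith _xor_

  get-⊞ : ∀ {m} (u v : Vec Bool m) c → get (u ⊞ v) c ≡ get u c xor get v c
  get-⊞ Vec.[] Vec.[] c = refl
  get-⊞ (x Vec.∷ u) (y Vec.∷ v) zero = refl
  get-⊞ (x Vec.∷ u) (y Vec.∷ v) (suc c) = get-⊞ u v c

  0ʷ : Word
  0ʷ = build δ λ _ → false

  ⊞-comm : (u v : Word) → u ⊞ v ≡ v ⊞ u
  ⊞-comm u v = get-ext λ {c} _ → trans (get-⊞ u v c) (trans (xor-comm (get u c) (get v c)) (sym (get-⊞ v u c)))

  ⊞-assoc : (u v w : Word) → (u ⊞ v) ⊞ w ≡ u ⊞ (v ⊞ w)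
  ⊞-assoc u v w = get-ext λ {c} _ → begin
    get ((u ⊞ v) ⊞ w) c                 ≡⟨ trans (get-⊞ (u ⊞ v) w c) (cong (_xor get w c) (get-⊞ u v c)) ⟩
    (get u c xor get v c) xor get w c   ≡⟨ xor-assoc (get u c) (get v c) (get w c) ⟩
    get u c xor (get v c xor get w c)   ≡⟨ trans (get-⊞ u (v ⊞ w) c) (cong (get u c xor_) (get-⊞ v w c)) ⟨
    get (u ⊞ (v ⊞ w)) c                 ∎
    where open ≡-Reasoning

  ⊞-self : (u : Word) → u ⊞ u ≡ 0ʷ
  ⊞-self u = get-ext λ {c} c<δ → trans (get-⊞ u u c) (trans (xor-same (get u c)) (sym (get-build _ c<δ)))

  ⊞-identityʳ : (u : Word) → u ⊞ 0ʷ ≡ u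
  ⊞-identityʳ u = get-ext λ {c} c<δ → trans (get-⊞ u 0ʷ c)
    (trans (cong (get u c xor_) (get-build _ c<δ)) (xor-identityʳ (get u c)))

  ⊞-identityˡ : (u : Word) → 0ʷ ⊞ u ≡ u
  ⊞-identityˡ u = trans (⊞-comm 0ʷ u) (⊞-identityʳ u)

  ⊞-cancelˡ : (u v : Word) → u ⊞ (u ⊞ v) ≡ v
  ⊞-cancelˡ u v = trans (sym (⊞-assoc u u v)) (trans (cong (_⊞ v) (⊞-self u)) (⊞-identityˡ v))

  ⊞-cancelʳ : (u v : Word) → (u ⊞ v) ⊞ v ≡ u
  ⊞-cancelʳ u v = trans (⊞-assoc u v v) (trans (cong (u ⊞_) (⊞-self v)) (⊞-identityʳ u))

  ⊞-interchange : (u v w z : Word) → (u ⊞ v) ⊞ (w ⊞ z) ≡ (u ⊞ w) ⊞ (v ⊞ z)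
  ⊞-interchange u v w z = begin
    (u ⊞ v) ⊞ (w ⊞ z) ≡⟨ ⊞-assoc u v (w ⊞ z) ⟩
    u ⊞ (v ⊞ (w ⊞ z)) ≡⟨ cong (u ⊞_) (⊞-assoc v w z) ⟨
    u ⊞ ((v ⊞ w) ⊞ z) ≡⟨ cong (λ t → u ⊞ (t ⊞ z)) (⊞-comm v w) ⟩
    u ⊞ ((w ⊞ v) ⊞ z) ≡⟨ cong (u ⊞_) (⊞-assoc w v z) ⟩
    u ⊞ (w ⊞ (v ⊞ z)) ≡⟨ ⊞-assoc u w (v ⊞ z) ⟨
    (u ⊞ w) ⊞ (v ⊞ z) ∎
    where open ≡-Reasoning

  mirror : ℕ → ℕ → ℕ
  mirror N c = if c <ᵇ N then N ∸ suc c else c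

  mirror-inside : ∀ {N c} → c < N → mirror N c ≡ N ∸ suc c
  mirror-inside {N} {c} h rewrite dec-true (c <? N) h = refl

  mirror-outside : ∀ {N c} → ¬ c < N → mirror N c ≡ c
  mirror-outside {N} {c} h rewrite dec-false (c <? N) h = refl

  mirror-< : ∀ {N c} → c < N → N ∸ suc c < N
  mirror-< {suc N} {c} (s≤s h) = s≤s (m∸n≤m N c)

  mirror-invol : ∀ N c → mirror N (mirror N c) ≡ c
  mirror-invol N c with c <? N
  ... | no ¬h = trans (cong (mirror N) (mirror-outside ¬h)) (mirror-outside ¬h)
  ... | yes h = trans (cong (mirror N) (mirror-inside h)) (trans (mirror-inside (mirror-< h)) (double h))
    where
    double : ∀ {N c} → c < N → N ∸ suc (N ∸ suc c) ≡ c
    double {suc N} (s≤s h) = m∸[m∸n]≡n h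

  mirror-bound : ∀ {N c m} → N ≤ m → c < m → mirror N c < m
  mirror-bound {N} {c} N≤m c<m with c <? N
  ... | yes h = subst (_< _) (sym (mirror-inside h)) (<-≤-trans (mirror-< h) N≤m)
  ... | no ¬h = subst (_< _) (sym (mirror-outside ¬h)) c<m

  -- turn true N reverses the first N bits, and turn true N u ⊞ ones true N also complements them.
  turn : Bool → ℕ → Word → Word
  turn false N u = u
  turn true  N u = build δ (get u ∘ mirror N)

  ones : Bool → ℕ → Word
  ones e N = build δ λ c → e ∧ (c <ᵇ N)

  turn-⊞ : ∀ e N u v → turn e N (u ⊞ v) ≡ turn e N u ⊞ turn e N v
  turn-⊞ false N u v = refl
  turn-⊞ true  N u v = get-ext λ {c} c<δ → begin
    get (turn true N (u ⊞ v)) c                          ≡⟨ get-build _ c<δ ⟩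
    get (u ⊞ v) (mirror N c)                             ≡⟨ get-⊞ u v (mirror N c) ⟩
    get u (mirror N c) xor get v (mirror N c)            ≡⟨ cong₂ _xor_ (get-build _ c<δ) (get-build _ c<δ) ⟨
    get (turn true N u) c xor get (turn true N v) c      ≡⟨ get-⊞ (turn true N u) (turn true N v) c ⟨
    get (turn true N u ⊞ turn true N v) c                ∎
    where open ≡-Reasoning

  turn-invol : ∀ e {N} u → N ≤ δ → turn e N (turn e N u) ≡ u
  turn-invol false u N≤δ = refl
  turn-invol true {N} u N≤δ = get-ext λ {c} c<δ → trans (get-build _ c<δ)
    (trans (get-build _ (mirror-bound N≤δ c<δ)) (cong (get u) (mirror-invol N c)))

  turn-injective : ∀ e {N} {u v} → N ≤ δ → turn e N u ≡ turn e N v → u ≡ v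
  turn-injective e {N} {u} {v} N≤δ eq =
    trans (sym (turn-invol e u N≤δ)) (trans (cong (turn e N) eq) (turn-invol e v N≤δ))

  count : ℕ → (ℕ → Bool) → ℕ
  count zero    f = 0
  count (suc N) f = bit (f 0) + count N (f ∘ suc)

  count-cong : ∀ N {f h} → (∀ {c} → c < N → f c ≡ h c) → count N f ≡ count N h
  count-cong zero    eq = refl
  count-cong (suc N) eq = cong₂ _+_ (cong bit (eq z<s)) (count-cong N (eq ∘ s≤s))

  count-snoc : ∀ N f → count (suc N) f ≡ count N f + bit (f N)
  count-snoc zero    f = +-identityʳ _
  count-snoc (suc N) f = trans (cong (bit (f 0) +_) (count-snoc N (f ∘ suc)))
    (sym (+-assoc (bit (f 0)) (count N (f ∘ suc)) (bit (f (suc N)))))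

  count-reverse : ∀ N f → count N (λ c → f (N ∸ suc c)) ≡ count N f
  count-reverse zero    f = refl
  count-reverse (suc N) f = trans (cong (bit (f N) +_) (count-reverse N f))
    (trans (+-comm (bit (f N)) (count N f)) (sym (count-snoc N f)))

  count-not : ∀ N f → count N (not ∘ f) + count N f ≡ N
  count-not zero    f = refl
  count-not (suc N) f = trans (regroup (bit (not (f 0))) (count N (not ∘ f ∘ suc)) (bit (f 0)) (count N (f ∘ suc)))
    (cong₂ _+_ (one (f 0)) (count-not N (f ∘ suc)))
    where
    one : ∀ b → bit (not b) + bit b ≡ 1
    one false = refl
    one true  = refl
    regroup : ∀ a b c d → (a + b) + (c + d) ≡ (a + c) + (b + d)
    regroup a b c d = solve (a ∷ b ∷ c ∷ d ∷ [])

  value : ℕ → Word → ℕ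
  value N u = count N (get u)

  threshold : ℕ → Word
  threshold k = build δ (_<ᵇ k)

  <ᵇ-true : ∀ {c k} → c < k → (c <ᵇ k) ≡ true
  <ᵇ-true {c} {k} h = dec-true (c <? k) h

  <ᵇ-false : ∀ {c k} → ¬ c < k → (c <ᵇ k) ≡ false
  <ᵇ-false {c} {k} h = dec-false (c <? k) h

  value-threshold : ∀ {N k} → k ≤ N → N ≤ δ → value N (threshold k) ≡ k
  value-threshold {N} {k} k≤N N≤δ = trans (count-cong N (λ c<N → get-build _ (<-≤-trans c<N N≤δ))) (count-< k≤N)
    where
    count-< : ∀ {N k} → k ≤ N → count N (_<ᵇ k) ≡ k
    count-< {zero}  z≤n = refl
    count-< {suc N} z≤n = count-< {N} z≤n
    count-< (s≤s h) = cong suc (count-< h)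

  get-opposite : ∀ {N} u → N ≤ δ → ∀ {c} → c < N → get (turn true N u ⊞ ones true N) c ≡ not (get u (N ∸ suc c))
  get-opposite {N} u N≤δ {c} c<N = begin
    get (turn true N u ⊞ ones true N) c                ≡⟨ get-⊞ (turn true N u) (ones true N) c ⟩
    get (turn true N u) c xor get (ones true N) c      ≡⟨ cong₂ _xor_ (get-build _ c<δ) (get-build _ c<δ) ⟩
    get u (mirror N c) xor (c <ᵇ N)                    ≡⟨ cong₂ _xor_ (cong (get u) (mirror-inside c<N)) (<ᵇ-true c<N) ⟩
    get u (N ∸ suc c) xor true                         ≡⟨ xor-comm _ true ⟩
    not (get u (N ∸ suc c))                            ∎
    where
    open ≡-Reasoning
    c<δ = <-≤-trans c<N N≤δ

  value-opposite : ∀ {N} u → N ≤ δ → value N (turn true N u ⊞ ones true N) + value N u ≡ N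
  value-opposite {N} u N≤δ = trans (cong₂ _+_
    (count-cong N (get-opposite u N≤δ)) (sym (count-reverse N (get u)))) (count-not N (λ c → get u (N ∸ suc c)))

  -- Complementing alone would leave the ones at the end of the word. Reversing as well brings them
  -- to the front, so that threshold words go to threshold words.
  threshold-opposite : ∀ {N k l} → k + l ≡ N → N ≤ δ → threshold l ≡ turn true N (threshold k) ⊞ ones true N
  threshold-opposite {N} {k} {l} refl N≤δ = get-ext λ {c} c<δ → trans (get-build _ c<δ) (sym (bits c<δ (c <? N)))
    where
    bits : ∀ {c} → c < δ → Dec (c < N) → get (turn true N (threshold k) ⊞ ones true N) c ≡ (c <ᵇ l)
    bits {c} c<δ (yes c<N) = trans (get-opposite (threshold k) N≤δ c<N)
      (trans (cong not (get-build _ (<-≤-trans (mirror-< c<N) N≤δ))) (flipped (N ∸ suc c <? k)))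
      where
      sum : N ∸ suc c + suc c ≡ k + l
      sum = m∸n+n≡m c<N
      flipped : Dec (N ∸ suc c < k) → not (N ∸ suc c <ᵇ k) ≡ (c <ᵇ l)
      flipped (yes h) = trans (cong not (<ᵇ-true h)) (sym (<ᵇ-false λ c<l →
        <-irrefl sum (≤-trans (+-mono-<-≤ h c<l) ≤-refl)))
      flipped (no ¬h) = trans (cong not (<ᵇ-false ¬h)) (sym (<ᵇ-true (+-cancelˡ-≤ k _ _
        (≤-trans (+-monoˡ-≤ (suc c) (≮⇒≥ ¬h)) (eq≤ sum)))))
    bits {c} c<δ (no c≮N) = trans (get-⊞ (turn true N (threshold k)) (ones true N) c)
      (trans (cong₂ _xor_ (trans (get-build _ c<δ) (trans (cong (get (threshold k)) (mirror-outside c≮N)) (get-build _ c<δ))) (get-build _ c<δ))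
      (trans (cong₂ _xor_ (<ᵇ-false (λ h → c≮N (≤-trans h (m≤m+n k l)))) (<ᵇ-false c≮N))
        (sym (<ᵇ-false (λ h → c≮N (≤-trans h (m≤n+m l k)))))))

-- The labels v ≤ δ in a congruence class c mod g are g * u + offset c for u ≤ N c, and
-- v ↦ δ ∸ v maps class c to class c xor turned.
record Classes (δ g : ℕ) : Set where
  field
    N        : Bool → ℕ
    offset   : Bool → ℕ
    turned   : Bool
    total    : ∀ c → g * N c + offset c + offset (c xor turned) ≡ δ
    N-turned : ∀ c → N (c xor turned) ≡ N c
    offset-sum : ∀ c c′ → g ∣ offset c + offset c′ + offset (c xor c′)
    class    : ℕ → Bool
    quo      : ℕ → ℕ
    decompose : ∀ v → v ≡ g * quo v + offset (class v)
    class-opposite : ∀ {v w} → v + w ≡ δ → class w ≡ class v xor turned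
    class-sum : ∀ {a b c} → g ∣ a + b + c → class c ≡ class a xor class b

  module _ (1≤g : 1 ≤ g) where

    quo-opposite : ∀ {v w} → v + w ≡ δ → quo v + quo w ≡ N (class v)
    quo-opposite {v} {w} vw = *-cancelˡ-≡ _ _ g {{>-nonZero 1≤g}} (+-cancelʳ-≡ (o + o′) _ _ (begin
      g * (quo v + quo w) + (o + o′)     ≡⟨ regroup g (quo v) (quo w) o o′ ⟩
      (g * quo v + o) + (g * quo w + o′) ≡⟨ cong₂ _+_ (decompose v) (trans (decompose w) (cong (λ c → g * quo w + offset c) (class-opposite vw))) ⟨
      v + w                              ≡⟨ vw ⟩
      δ                                  ≡⟨ total (class v) ⟨
      g * N (class v) + o + o′           ≡⟨ +-assoc (g * N (class v)) o o′ ⟩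
      g * N (class v) + (o + o′)         ∎))
      where
      open ≡-Reasoning
      o = offset (class v)
      o′ = offset (class v xor turned)
      regroup : ∀ g u v o o′ → g * (u + v) + (o + o′) ≡ (g * u + o) + (g * v + o′)
      regroup g u v o o′ = solve (g ∷ u ∷ v ∷ o ∷ o′ ∷ [])

    N≤δ : ∀ c → N c ≤ δ
    N≤δ c = ≤-trans (m≤n*m (N c) g {{>-nonZero 1≤g}}) (≤-trans (m≤m+n _ (offset c))
      (≤-trans (m≤m+n _ (offset (c xor turned))) (eq≤ (total c))))

-- For `g = 1` all labels form one class, and both values of the bit stand for it.
trivial-classes : ∀ δ → Classes δ 1
trivial-classes δ = record
  { N = λ _ → δ ; offset = λ _ → 0 ; turned = false
  ; total = λ _ → solve (δ ∷ [])
  ; N-turned = λ _ → refl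
  ; offset-sum = λ _ _ → 1∣ 0
  ; class = λ _ → false ; quo = λ v → v
  ; decompose = λ v → solve (v ∷ [])
  ; class-opposite = λ _ → refl
  ; class-sum = λ _ → refl
  }

isOdd : ℕ → Bool
isOdd zero    = false
isOdd (suc n) = not (isOdd n)

isOdd-+ : ∀ a b → isOdd (a + b) ≡ isOdd a xor isOdd b
isOdd-+ zero    b = refl
isOdd-+ (suc a) b = trans (cong not (isOdd-+ a b)) (Bool.not-distribˡ-xor (isOdd a) (isOdd b))

isOdd-double : ∀ a → isOdd (2 * a) ≡ false
isOdd-double a = trans (isOdd-+ a (a + 0)) (trans (cong (isOdd a xor_) (cong isOdd (+-identityʳ a))) (xor-same (isOdd a)))

half-bit : ∀ v → v ≡ 2 * ⌊ v /2⌋ + bit (isOdd v)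
half-bit zero          = refl
half-bit (suc zero)    = refl
half-bit (suc (suc v)) = trans (cong 2+ (half-bit v)) (trans (regroup ⌊ v /2⌋ (bit (isOdd v)))
  (cong (λ c → 2 * suc ⌊ v /2⌋ + bit c) (sym (Bool.not-involutive (isOdd v)))))
  where
  regroup : ∀ u o → 2+ (2 * u + o) ≡ 2 * suc u + o
  regroup u o = solve (u ∷ o ∷ [])

parity-classes : ∀ δ → 1 ≤ δ → Classes δ 2
parity-classes δ 1≤δ = record
  { N = N ; offset = bit ; turned = isOdd δ
  ; total = total
  ; N-turned = N-turned
  ; offset-sum = offset-sum
  ; class = isOdd ; quo = ⌊_/2⌋
  ; decompose = half-bit
  ; class-opposite = λ {v} {w} vw → trans (sym (xor-cancelˡ (isOdd v) (isOdd w)))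
      (cong (isOdd v xor_) (trans (sym (isOdd-+ v w)) (cong isOdd vw)))
  ; class-sum = λ {a} {b} {c} 2∣ → same (isOdd a xor isOdd b) (isOdd c)
      (trans (trans (cong (_xor isOdd c) (sym (isOdd-+ a b))) (sym (isOdd-+ (a + b) c))) (even 2∣))
  }
  where
  N : Bool → ℕ
  N false = ⌊ δ /2⌋
  -- The largest `u` with `2 * u + 1 ≤ δ`.
  N true  = ⌊ pred δ /2⌋
  same : ∀ b c → b xor c ≡ false → c ≡ b
  same false c eq = eq
  same true true eq = refl
  even : ∀ {n} → 2 ∣ n → isOdd n ≡ false
  even (divides q refl) = trans (cong isOdd (*-comm q 2)) (isOdd-double q)
  offset-sum : ∀ c c′ → 2 ∣ bit c + bit c′ + bit (c xor c′)
  offset-sum false false = divides 0 refl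
  offset-sum false true  = divides 1 refl
  offset-sum true  false = divides 1 refl
  offset-sum true  true  = divides 1 refl
  total : ∀ c → 2 * N c + bit c + bit (c xor isOdd δ) ≡ δ
  total false = trans (cong (_+ bit (isOdd δ)) (+-identityʳ _)) (sym (half-bit δ))
  total true = odd-total δ 1≤δ
    where
    regroup : ∀ u o → 2 * u + 1 + o ≡ suc (2 * u + o)
    regroup u o = solve (u ∷ o ∷ [])
    odd-total : ∀ δ → 1 ≤ δ → 2 * ⌊ pred δ /2⌋ + 1 + bit (not (isOdd δ)) ≡ δ
    odd-total (suc δ) _ = trans (cong (λ c → 2 * ⌊ δ /2⌋ + 1 + bit c) (Bool.not-involutive (isOdd δ)))
      (trans (regroup ⌊ δ /2⌋ (bit (isOdd δ))) (cong suc (sym (half-bit δ))))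
  odd-half : ∀ δ → isOdd δ ≡ true → ⌊ δ /2⌋ ≡ ⌊ pred δ /2⌋
  odd-half (suc zero)          _  = refl
  odd-half (suc (suc (suc δ))) eq = cong suc (odd-half (suc δ) (trans (sym (Bool.not-involutive _)) eq))
  N-turned : ∀ c → N (c xor isOdd δ) ≡ N c
  N-turned c with isOdd δ in eq
  N-turned false | false = refl
  N-turned false | true  = sym (odd-half δ eq)
  N-turned true  | false = refl
  N-turned true  | true  = odd-half δ eq

-- Antipodal pairs of the given space

module Poles {δ g K n : ℕ} {d : Fin n → Fin n → ℕ} (A : AntipodalSpace δ g K d) (1≤δ : 1 ≤ δ) where
  open AntipodalSpace A
  open TriangleFlips {δ} {K}

  -- One inequality is the perimeter bound, the other the triangle inequality.
  antipode-sum : ∀ {a b} → d a b ≡ δ → ∀ c → d b c + d a c ≡ δ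
  antipode-sum {a} {b} ab c = ≤-antisym
    (+-cancelˡ-≤ δ _ _ (≤-trans (eq≤ (trans (sym (+-assoc δ (d b c) (d a c))) (cong (λ v → v + d b c + d a c) (sym ab))))
      (≤-trans (perimeter a b c) (eq≤ (cong (δ +_) (+-identityʳ δ))))))
    (≤-trans (≤-trans (eq≥ ab) (triangle a c b)) (eq≤ (trans (cong (d a c +_) (d-sym c b)) (+-comm (d a c) (d b c)))))

  antipode-unique : ∀ {a b b′} → d a b ≡ δ → d a b′ ≡ δ → b ≡ b′
  antipode-unique {a} {b} {b′} ab ab′ = d0⇒≡ b b′
    (+-cancelʳ-≡ δ _ 0 (trans (cong (d b b′ +_) (sym ab′)) (antipode-sum ab b′)))

  antipode≢ : ∀ {a} → d a a ≢ δ
  antipode≢ {a} eq = <⇒≢ 1≤δ (trans (sym (d-refl a)) eq)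

  LowerAntipode : Fin n → Fin n → Set
  LowerAntipode a b = d a b ≡ δ × toℕ b < toℕ a

  lowerAntipode? : ∀ a → Dec (∃ (LowerAntipode a))
  lowerAntipode? a = Fin.any? λ b → (d a b ≟ δ) ×-dec (toℕ b <? toℕ a)

  -- Each pole is represented by the smaller of its points, the other one having sign true.
  record Pole (a : Fin n) : Set where
    field
      rep  : Fin n
      sg   : Bool
      flipped : ∀ c → d a c ≡ flip sg (d rep c)
      lower : ∀ {b} → d a b ≡ δ → toℕ b < toℕ a → rep ≡ b × sg ≡ true
      upper : ∀ {b} → d a b ≡ δ → ¬ (toℕ b < toℕ a) → rep ≡ a × sg ≡ false

  abstract
    pole : ∀ a → Pole a
    pole a with lowerAntipode? a
    ... | yes (b , ab , b<a) = record
      { rep = b ; sg = true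
      ; flipped = λ c → trans (sym (m+n∸m≡n (d b c) (d a c))) (cong (_∸ d b c) (antipode-sum ab c))
      ; lower = λ ab′ _ → antipode-unique ab ab′ , refl
      ; upper = λ ab′ ≮ → ⊥-elim (≮ (subst (λ v → toℕ v < toℕ a) (antipode-unique ab ab′) b<a)) }
    ... | no ∄ = record
      { rep = a ; sg = false
      ; flipped = λ _ → refl
      ; lower = λ ab b<a → ⊥-elim (∄ (_ , ab , b<a))
      ; upper = λ _ _ → refl , refl }

  rep : Fin n → Fin n
  rep a = Pole.rep (pole a)

  sg : Fin n → Bool
  sg a = Pole.sg (pole a)

  d-poles : ∀ a b → d a b ≡ flip (sg a xor sg b) (d (rep a) (rep b))
  d-poles a b = begin
    d a b                                       ≡⟨ Pole.flipped (pole a) b ⟩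
    flip (sg a) (d (rep a) b)                   ≡⟨ cong (flip (sg a)) (trans (d-sym (rep a) b) (Pole.flipped (pole b) (rep a))) ⟩
    flip (sg a) (flip (sg b) (d (rep b) (rep a))) ≡⟨ flip-flip (sg a) (sg b) (d≤δ _ _) ⟩
    flip (sg a xor sg b) (d (rep b) (rep a))    ≡⟨ cong (flip (sg a xor sg b)) (d-sym (rep b) (rep a)) ⟩
    flip (sg a xor sg b) (d (rep a) (rep b))    ∎
    where open ≡-Reasoning

  d-same-pole : ∀ {a b} → rep a ≡ rep b → d a b ≡ flip (sg a xor sg b) 0
  d-same-pole {a} {b} eq = trans (d-poles a b) (cong (flip (sg a xor sg b)) (trans (cong (d (rep a)) (sym eq)) (d-refl (rep a))))

  same-pole : ∀ {a b} → rep a ≡ rep b → a ≡ b ⊎ d a b ≡ δ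
  same-pole {a} {b} eq with sg a xor sg b | d-same-pole eq
  ... | false | ab = inj₁ (d0⇒≡ a b ab)
  ... | true  | ab = inj₂ ab

  pole-injective : ∀ {a b} → rep a ≡ rep b → sg a ≡ sg b → a ≡ b
  pole-injective {a} {b} eq sgs = d0⇒≡ a b (trans (d-same-pole eq)
    (cong (λ s → flip s 0) (trans (cong (_xor sg b) sgs) (xor-same (sg b)))))

  opposite-signs : ∀ {a b} → rep a ≡ rep b → sg a ≡ not (sg b) → d a b ≡ δ
  opposite-signs {a} {b} eq sgs = trans (d-same-pole eq)
    (cong (λ s → flip s 0) (trans (cong (_xor sg b) sgs) (Bool.xor-inverseˡ (sg b))))

  antipodes-share-pole : ∀ {a b} → d a b ≡ δ → rep a ≡ rep b × sg a ≡ not (sg b)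
  antipodes-share-pole {a} {b} ab with toℕ b <? toℕ a | toℕ a <? toℕ b
  ... | yes b<a | yes a<b = ⊥-elim (<-asym b<a a<b)
  ... | yes b<a | no a≮b with Pole.lower (pole a) ab b<a | Pole.upper (pole b) (trans (d-sym b a) ab) a≮b
  ...   | ra , sa | rb , sb = trans ra (sym rb) , trans sa (cong not (sym sb))
  antipodes-share-pole {a} {b} ab | no b≮a | yes a<b
    with Pole.upper (pole a) ab b≮a | Pole.lower (pole b) (trans (d-sym b a) ab) a<b
  ...   | ra , sa | rb , sb = trans ra (sym rb) , trans sa (cong not (sym sb))
  antipodes-share-pole {a} {b} ab | no b≮a | no a≮b =
    ⊥-elim (antipode≢ (trans (cong (d a) (Fin.toℕ-injective (≤-antisym (≮⇒≥ b≮a) (≮⇒≥ a≮b)))) ab))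

-- The graph of words

module Base {δ g K n : ℕ} {d : Fin n → Fin n → ℕ} (A : AntipodalSpace δ g K d) (1≤δ : 1 ≤ δ) (1≤g : 1 ≤ g)
  (C : Classes δ g) where

  open AntipodalSpace A
  open Poles A 1≤δ
  open Classes C
  open TriangleFlips {δ} {K}
  open Words δ
  open Extension δ g K d

  Pt : Set
  Pt = Fin n × Bool

  Pt-finite : Finite Pt
  Pt-finite = Fin-finite n ×-finite Bool-finite

  open Table Pt-finite Word

  -- A point lies over a base point, which is a pole with a class bit, and has a sign.
  V₀ : Set
  V₀ = Pt × Bool × Table

  V₀-finite : Finite V₀
  V₀-finite = Pt-finite ×-finite Bool-finite ×-finite Vec-finite (Vec-finite Bool-finite δ) (Finite.size Pt-finite)

  pairClass : Pt → Pt → Bool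
  pairClass (_ , b) (_ , c) = b xor c

  pairN : Pt → Pt → ℕ
  pairN I J = N (pairClass I J)

  pairN≤δ : ∀ I J → pairN I J ≤ δ
  pairN≤δ I J = N≤δ 1≤g (pairClass I J)

  label : Bool → Word → ℕ
  label c w = g * value (N c) w + offset c

  label-opposite : ∀ c w → label (c xor turned) (turn true (N c) w ⊞ ones true (N c)) + label c w ≡ δ
  label-opposite c w = begin
    g * value (N (c xor turned)) w′ + o′ + (g * value (N c) w + o)
      ≡⟨ cong (λ M → g * value M w′ + o′ + (g * value (N c) w + o)) (N-turned c) ⟩
    g * value (N c) w′ + o′ + (g * value (N c) w + o)
      ≡⟨ regroup g (value (N c) w′) (value (N c) w) o o′ ⟩
    g * (value (N c) w′ + value (N c) w) + o + o′
      ≡⟨ cong (λ M → g * M + o + o′) (value-opposite w (N≤δ 1≤g c)) ⟩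
    g * N c + o + o′
      ≡⟨ total c ⟩
    δ ∎
    where
    open ≡-Reasoning
    w′ = turn true (N c) w ⊞ ones true (N c)
    o = offset c
    o′ = offset (c xor turned)
    regroup : ∀ g u v o o′ → g * u + o′ + (g * v + o) ≡ g * (u + v) + o + o′
    regroup g u v o o′ = solve (g ∷ u ∷ v ∷ o ∷ o′ ∷ [])

  label≤δ : ∀ c w → label c w ≤ δ
  label≤δ c w = ≤-trans (m≤n+m (label c w) (label (c xor turned) (turn true (N c) w ⊞ ones true (N c)))) (eq≤ (label-opposite c w))

  word : V₀ → V₀ → Word
  word (I , _ , χ) (J , _ , ψ) = look χ J ⊞ look ψ I

  r₀ : V₀ → V₀ → ℕ
  r₀ x@(I , s , _) y@(J , t , _) = flip (s xor t) (label (pairClass I J) (word x y))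

  τ₀ : V₀ → V₀
  τ₀ (I , s , χ) = I , not s , χ

  tw₀ : Bool → V₀ → V₀
  tw₀ = twistBy τ₀

  tw₀-≡ : ∀ s x → tw₀ s x ≡ (proj₁ x , s xor proj₁ (proj₂ x) , proj₂ (proj₂ x))
  tw₀-≡ false x = refl
  tw₀-≡ true  x = refl

  word-sym : ∀ x y → word x y ≡ word y x
  word-sym (I , _ , χ) (J , _ , ψ) = ⊞-comm (look χ J) (look ψ I)

  r₀-sym : ∀ x y → r₀ x y ≡ r₀ y x
  r₀-sym x@((i , b) , s , _) y@((j , c) , t , _) =
    cong₂ flip (xor-comm s t) (cong₂ label (xor-comm b c) (word-sym x y))

  flip-not : ∀ s {v} → v ≤ δ → flip (not s) v + flip s v ≡ δ
  flip-not false h = m∸n+n≡m h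
  flip-not true  h = m+[n∸m]≡n h

  r₀-τ : ∀ x y → r₀ (τ₀ x) y + r₀ x y ≡ δ
  r₀-τ x@((_ , b) , s , _) y@((_ , c) , t , _) =
    trans (cong (λ u → flip u ℓ + flip (s xor t) ℓ) (sym (Bool.not-distribˡ-xor s t))) (flip-not (s xor t) (label≤δ (b xor c) (word x y)))
    where ℓ = label (b xor c) (word x y)

  signedClass : V₀ → Bool
  signedClass ((_ , b) , s , _) = b xor (s ∧ turned)

  signedClass-xor : ∀ b c s t u → (b xor (s ∧ u)) xor (c xor (t ∧ u)) ≡ (b xor c) xor ((s xor t) ∧ u)
  signedClass-xor b c s t u = begin
    (b xor (s ∧ u)) xor (c xor (t ∧ u)) ≡⟨ xor-interchange b (s ∧ u) c (t ∧ u) ⟩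
    (b xor c) xor ((s ∧ u) xor (t ∧ u)) ≡⟨ cong ((b xor c) xor_) (Bool.∧-distribʳ-xor u s t) ⟨
    (b xor c) xor ((s xor t) ∧ u)       ∎
    where
    open ≡-Reasoning

  -- Modulo `g` a label depends only on one bit attached to each of its points, and these bits
  -- cancel around a triangle; this yields `r₀-par`.
  r₀-class : ∀ x y → ∃ λ k → r₀ x y ≡ g * k + offset (signedClass x xor signedClass y)
  r₀-class x@((_ , b) , s , _) y@((_ , c) , t , _) rewrite signedClass-xor b c s t turned = by-sign (s xor t)
    where
    w = word x y
    by-sign : ∀ u → ∃ λ k → flip u (label (b xor c) w) ≡ g * k + offset ((b xor c) xor (u ∧ turned))
    by-sign false = value (N (b xor c)) w , cong (λ e → g * value (N (b xor c)) w + offset e) (sym (xor-identityʳ (b xor c)))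
    by-sign true  = _ , trans (cong (_∸ label (b xor c) w) (sym (label-opposite (b xor c) w))) (m+n∸n≡m _ (label (b xor c) w))

  r₀-par : ∀ x y z → g ∣ r₀ x y + r₀ y z + r₀ x z
  r₀-par x y z with r₀-class x y | r₀-class y z | r₀-class x z
  ... | k₁ , e₁ | k₂ , e₂ | k₃ , e₃ = subst (g ∣_) eq
      (∣m∣n⇒∣m+n (m∣m*n (k₁ + k₂ + k₃)) (offset-sum (α xor β) (β xor γ)))
    where
    α = signedClass x
    β = signedClass y
    γ = signedClass z
    regroup : ∀ g k l m o p q → g * (k + l + m) + (o + p + q) ≡ (g * k + o) + (g * l + p) + (g * m + q)
    regroup g k l m o p q = solve (g ∷ k ∷ l ∷ m ∷ o ∷ p ∷ q ∷ [])
    eq : g * (k₁ + k₂ + k₃) + (offset (α xor β) + offset (β xor γ) + offset ((α xor β) xor (β xor γ)))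
      ≡ r₀ x y + r₀ y z + r₀ x z
    eq = trans (cong (λ o → g * (k₁ + k₂ + k₃) + (offset (α xor β) + offset (β xor γ) + offset o)) (xor-chain α β γ))
      (trans (regroup g k₁ k₂ k₃ _ _ _) (sym (cong₂ _+_ (cong₂ _+_ e₁ e₂) e₃)))

  record Adj₀ (x y : V₀) : Set where
    constructor adj₀
    field
      not-same : ∀ s → x ≢ tw₀ s y
      positive : 0 < r₀ x y
      short    : 2 * r₀ x y ≤ δ

  adj₀? : ∀ x y → Dec (Adj₀ x y)
  adj₀? x y = map′ (λ (h , p , s) → adj₀ h p s) (λ (adj₀ h p s) → h , p , s)
    (Finite.all-finite? Bool-finite (λ s → ¬? (Finite._≟ᶠ_ V₀-finite x (tw₀ s y)))
      ×-dec (0 <? r₀ x y) ×-dec (2 * r₀ x y ≤? δ))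

  τ₀-invol : ∀ x → τ₀ (τ₀ x) ≡ x
  τ₀-invol (I , s , χ) = cong (λ t → I , t , χ) (not-involutive s)

  τ₀-injective : ∀ {x y} → τ₀ x ≡ τ₀ y → x ≡ y
  τ₀-injective {x} {y} eq = trans (sym (τ₀-invol x)) (trans (cong τ₀ eq) (τ₀-invol y))

  tw₀-swap : ∀ s {x y} → x ≡ tw₀ s y → y ≡ tw₀ s x
  tw₀-swap false eq = sym eq
  tw₀-swap true {x} {y} eq = sym (trans (cong τ₀ eq) (τ₀-invol y))

  τ₀-tw₀ : ∀ s y → tw₀ s (τ₀ y) ≡ τ₀ (tw₀ s y)
  τ₀-tw₀ false y = refl
  τ₀-tw₀ true  y = refl

  r₀-ττ : ∀ x y → r₀ (τ₀ x) (τ₀ y) ≡ r₀ x y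
  r₀-ττ x@(I , s , _) y@(J , t , _) = cong (λ u → flip u (label (pairClass I J) (word x y))) (not-xor-not s t)

  graph₀ : Graph δ g
  graph₀ = record
    { V = V₀ ; V-finite = V₀-finite
    ; τ = τ₀ ; τ-invol = τ₀-invol
    ; τ-free = λ (_ , s , _) eq → Bool.not-¬ {s} refl (cong (proj₁ ∘ proj₂) eq)
    ; r = r₀ ; r-sym = r₀-sym ; r-τ = r₀-τ ; r-par = r₀-par
    ; adj = Adj₀ ; adj? = adj₀?
    ; adj-sym = λ {x} {y} (adj₀ h p s) → adj₀ (λ t eq → h t (tw₀-swap t eq))
        (subst (0 <_) (r₀-sym x y) p) (subst (λ v → 2 * v ≤ δ) (r₀-sym x y) s)
    ; adj-τ = λ {x} {y} (adj₀ h p s) → adj₀ (λ t eq → h t (τ₀-injective (trans eq (τ₀-tw₀ t y))))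
        (subst (0 <_) (sym (r₀-ττ x y)) p) (subst (λ v → 2 * v ≤ δ) (sym (r₀-ττ x y)) s)
    ; adj-pos = Adj₀.positive ; adj-short = Adj₀.short ; adj-≉ = Adj₀.not-same
    }

  -- A cycle with two edges runs along one edge and back, up to antipodes, so its length is
  -- `2 * r₀ x y` or exactly `δ`.
  good₂ : Walks.Good graph₀ K 2
  good₂ σ a Walks.stay _ cond = Graph.adj-≉ graph₀ (Graph.adj-sym graph₀ a) σ refl
  good₂ {x = x} {y} false a (_ Walks.▸ Walks.stay) _ (inj₁ L<q) =
    <⇒≢ L<q (trans (+-identityʳ _) (r₀-sym y x))
  good₂ {x = x} {y} false a (_ Walks.▸ Walks.stay) _ (inj₂ ((k , odd) , _)) = even-odd {k} {r₀ x y}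
    (trans (sym odd) (cong (r₀ x y +_) (cong (_+ 0) (r₀-sym y x))))
  good₂ {x = x} {y} true a (_ Walks.▸ Walks.stay) _ L<δ = <⇒≢ L<δ (begin
    r₀ x y + (r₀ y (τ₀ x) + 0) ≡⟨ cong (r₀ x y +_) (trans (+-identityʳ _) (r₀-sym y (τ₀ x))) ⟩
    r₀ x y + r₀ (τ₀ x) y       ≡⟨ +-comm (r₀ x y) _ ⟩
    r₀ (τ₀ x) y + r₀ x y       ≡⟨ r₀-τ x y ⟩
    δ                          ∎)
    where open ≡-Reasoning
  good₂ _ _ (_ Walks.▸ _ Walks.▸ _) (s≤s (s≤s ())) _

  first : ∀ {m} → Fin m → Fin m
  first {suc m} _ = zero

  first-constant : ∀ {m} (i j : Fin m) → first i ≡ first j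
  first-constant {suc m} i j = refl

  -- The congruence of perimeters makes the class of a distance a sum of two bits, each measured
  -- from one reference point.
  pointClass : Fin n → Bool
  pointClass i = class (d i (first i))

  class-d : ∀ i j → class (d i j) ≡ pointClass i xor pointClass j
  class-d i j = trans (class-sum (congruent i (first i) j))
    (cong (λ v → pointClass i xor class v) (trans (d-sym (first i) j) (cong (d j) (first-constant i j))))

  below : Fin n → Fin n → Word → Word
  below j i w = if does (j Fin.<? i) then w else 0ʷ

  below-true : ∀ {j i} → j Fin.< i → ∀ w → below j i w ≡ w
  below-true {j} {i} h w = cong (if_then w else 0ʷ) (dec-true (j Fin.<? i) h)

  below-false : ∀ {j i} → ¬ (j Fin.< i) → ∀ w → below j i w ≡ 0ʷ
  below-false {j} {i} h w = cong (if_then w else 0ʷ) (dec-false (j Fin.<? i) h)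

  -- Of two points only the one with the larger index holds the word that encodes their distance, so
  -- the sum of the two words is that word.
  towards : Fin n → Fin n → Word
  towards i j = below j i (threshold (quo (d i j)))

  towards-sum : ∀ {i j} → i ≢ j → towards i j ⊞ towards j i ≡ threshold (quo (d i j))
  towards-sum {i} {j} i≢j with <-cmp (toℕ i) (toℕ j)
  ... | tri< i<j _ j≮i = trans (cong₂ _⊞_ (below-false j≮i _) (below-true i<j _))
        (trans (⊞-identityˡ _) (cong (threshold ∘ quo) (d-sym j i)))
  ... | tri≈ _ i≡j _ = contradiction (Fin.toℕ-injective i≡j) i≢j
  ... | tri> i≮j _ j<i = trans (cong₂ _⊞_ (below-true j<i _) (below-false i≮j _)) (⊞-identityʳ _)

  view : Fin n → Pt → Word
  view i (j , _) = towards i j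

  base : Fin n → Pt
  base a = rep a , pointClass (rep a)

  e₀ : Fin n → V₀
  e₀ a = base a , sg a , table (view (rep a))

  word-e₀ : ∀ a b → word (e₀ a) (e₀ b) ≡ towards (rep a) (rep b) ⊞ towards (rep b) (rep a)
  word-e₀ a b = cong₂ _⊞_ (look-table (view (rep a)) (base b)) (look-table (view (rep b)) (base a))

  label-d : ∀ i j → label (class (d i j)) (threshold (quo (d i j))) ≡ d i j
  label-d i j = trans (cong (λ u → g * u + offset (class (d i j)))
    (value-threshold quo≤N (N≤δ 1≤g (class (d i j))))) (sym (decompose (d i j)))
    where
    quo≤N : quo (d i j) ≤ N (class (d i j))
    quo≤N = ≤-trans (m≤m+n _ (quo (δ ∸ d i j))) (eq≤ (quo-opposite 1≤g (m+[n∸m]≡n (d≤δ i j))))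

  r₀-e₀ : ∀ {a b} → rep a ≢ rep b → r₀ (e₀ a) (e₀ b) ≡ d a b
  r₀-e₀ {a} {b} a≢b = trans (cong (flip (sg a xor sg b)) (trans
    (cong₂ label (sym (class-d (rep a) (rep b))) (trans (word-e₀ a b) (towards-sum a≢b)))
    (label-d (rep a) (rep b)))) (sym (d-poles a b))

  e₀-pole : ∀ {a b} s → sg a ≡ s xor sg b → rep a ≡ rep b → e₀ a ≡ tw₀ s (e₀ b)
  e₀-pole {a} {b} s sgs eq = trans (cong₂ (λ i t → (i , pointClass i) , t , table (view i)) eq sgs) (sym (tw₀-≡ s (e₀ b)))

  pole-e₀ : ∀ {a b} s → e₀ a ≡ tw₀ s (e₀ b) → rep a ≡ rep b × sg a ≡ s xor sg b
  pole-e₀ {a} {b} s eq = cong (proj₁ ∘ proj₁) eq′ , cong (proj₁ ∘ proj₂) eq′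
    where eq′ = trans eq (tw₀-≡ s (e₀ b))

  same-pole-e₀ : ∀ {a b} → rep a ≡ rep b → ∃ λ s → e₀ a ≡ tw₀ s (e₀ b)
  same-pole-e₀ {a} {b} eq = sg a xor sg b , e₀-pole (sg a xor sg b)
    (sym (xor-cancelʳ (sg a) (sg b))) eq

  -- A distance or its complement is at most δ/2, so one of the two points of the other pole is
  -- adjacent.
  e₀-adj : ∀ a b → (∃ λ s → e₀ a ≡ tw₀ s (e₀ b)) ⊎ (∃ λ s → Adj₀ (e₀ a) (tw₀ s (e₀ b)))
  e₀-adj a b with rep a Fin.≟ rep b
  ... | yes eq = inj₁ (same-pole-e₀ eq)
  ... | no a≢b = inj₂ (edge (2 * d a b ≤? δ))
    where
    rab : r₀ (e₀ a) (e₀ b) ≡ d a b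
    rab = r₀-e₀ a≢b
    not-same : ∀ t s → e₀ a ≢ tw₀ s (tw₀ t (e₀ b))
    not-same t s eq = a≢b (cong (proj₁ ∘ proj₁) (trans eq (trans (cong (tw₀ s) (tw₀-≡ t (e₀ b))) (tw₀-≡ s _))))
    d≢0 : d a b ≢ 0
    d≢0 eq = a≢b (cong rep (d0⇒≡ a b eq))
    d≢δ : d a b ≢ δ
    d≢δ eq = a≢b (proj₁ (antipodes-share-pole eq))
    complement : r₀ (e₀ a) (τ₀ (e₀ b)) ≡ δ ∸ d a b
    complement = trans (r₀-sym (e₀ a) (τ₀ (e₀ b))) (trans (sym (m+n∸n≡m _ (r₀ (e₀ b) (e₀ a))))
      (cong₂ _∸_ (r₀-τ (e₀ b) (e₀ a)) (trans (r₀-sym (e₀ b) (e₀ a)) rab)))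
    edge : Dec (2 * d a b ≤ δ) → ∃ λ s → Adj₀ (e₀ a) (tw₀ s (e₀ b))
    edge (yes h) = false , adj₀ (not-same false) (subst (0 <_) (sym rab) (n≢0⇒n>0 d≢0))
      (subst (λ v → 2 * v ≤ δ) (sym rab) h)
    edge (no ¬h) = true , adj₀ (not-same true)
      (subst (0 <_) (sym complement) (m<n⇒0<n∸m (≤∧≢⇒< (d≤δ a b) d≢δ)))
      (subst (λ v → 2 * v ≤ δ) (sym complement) (complement-short (d≤δ a b) ¬h))

  totalClass : Fin n → Bool
  totalClass a = pointClass (rep a) xor (sg a ∧ turned)

  class-flip : ∀ s v → v ≤ δ → class (flip s v) ≡ class v xor (s ∧ turned)
  class-flip false v h = sym (xor-identityʳ (class v))
  class-flip true  v h = class-opposite (m+[n∸m]≡n h)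

  class-total : ∀ a b → class (d a b) ≡ totalClass a xor totalClass b
  class-total a b = begin
    class (d a b)
      ≡⟨ cong class (d-poles a b) ⟩
    class (flip (sg a xor sg b) (d (rep a) (rep b)))
      ≡⟨ class-flip (sg a xor sg b) _ (d≤δ _ _) ⟩
    class (d (rep a) (rep b)) xor ((sg a xor sg b) ∧ turned)
      ≡⟨ cong (_xor ((sg a xor sg b) ∧ turned)) (class-d (rep a) (rep b)) ⟩
    (pointClass (rep a) xor pointClass (rep b)) xor ((sg a xor sg b) ∧ turned)
      ≡⟨ signedClass-xor (pointClass (rep a)) (pointClass (rep b)) (sg a) (sg b) turned ⟨
    totalClass a xor totalClass b ∎
    where open ≡-Reasoning

  -- Extending a partial isometry to the graph of words

  module Extend (p : Fin n → Maybe (Fin n)) (iso : IsPartialIso p) where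

    Active : Fin n → Set
    Active a = ∃ λ a′ → p a ≡ just a′

    target : Maybe (Fin n) → Fin n → Fin n
    target (just a′) _ = rep a′
    target nothing   a = a

    target-active : ∀ {a a′} → p a ≡ just a′ → target (p a) a ≡ rep a′
    target-active {a} eq = cong (λ m → target m a) eq

    active? : ∀ a → Dec (Active a)
    active? a with p a
    ... | just a′ = yes (a′ , refl)
    ... | nothing = no λ ()

    d-active : ∀ {a a′ b b′} → p a ≡ just a′ → p b ≡ just b′ → d a′ b′ ≡ d a b
    d-active {a} {a′} {b} {b′} pa pb = iso a b a′ b′ pa pb

    pole-forward : ∀ {a a′ b b′} → p a ≡ just a′ → p b ≡ just b′ → rep a ≡ rep b → rep a′ ≡ rep b′
    pole-forward {a′ = a′} {b′ = b′} pa pb eq with same-pole eq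
    ... | inj₁ refl = cong rep (d0⇒≡ a′ b′ (trans (d-active pa pb) (d-refl _)))
    ... | inj₂ opp  = proj₁ (antipodes-share-pole (trans (d-active pa pb) opp))

    pole-backward : ∀ {a a′ b b′} → p a ≡ just a′ → p b ≡ just b′ → rep a′ ≡ rep b′ → rep a ≡ rep b
    pole-backward {a} {b = b} pa pb eq with same-pole eq
    ... | inj₁ refl = cong rep (d0⇒≡ a b (trans (sym (d-active pa pb)) (d-refl _)))
    ... | inj₂ opp  = proj₁ (antipodes-share-pole (trans (sym (d-active pa pb)) opp))

    -- Distances 0 and `δ` tell when two points share a pole, so `p` induces a partial injection of
    -- poles.
    extended : ∃ λ φ → Injective _≡_ _≡_ φ × (∀ a → Active a → φ (rep a) ≡ target (p a) a)
    extended = extend-to-permutation rep (λ a → target (p a) a) active?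
      (λ { a b (_ , pa) (_ , pb) eq →
        trans (target-active pa) (trans (pole-forward pa pb eq) (sym (target-active pb))) })
      (λ { a b (_ , pa) (_ , pb) eq →
        pole-backward pa pb (trans (sym (target-active pa)) (trans eq (target-active pb))) })

    φ : Fin n → Fin n
    φ = proj₁ extended

    φ-rep : ∀ {a a′} → p a ≡ just a′ → φ (rep a) ≡ rep a′
    φ-rep {a} pa = trans (proj₂ (proj₂ extended) a (_ , pa)) (target-active pa)

    Dom : Fin n → Set
    Dom i = ∃₂ λ a a′ → p a ≡ just a′ × rep a ≡ i

    dom? : ∀ i → Dec (Dom i)
    dom? i = Fin.any? λ a → Fin.any? λ a′ → Maybe-≡-dec Fin._≟_ (p a) (just a′) ×-dec (rep a Fin.≟ i)

    switch-by : ∀ {i} → Dec (Dom i) → Bool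
    switch-by (yes (a , a′ , _)) = sg a xor sg a′
    switch-by (no _)             = false

    -- Whether φ exchanges the two points of the pole i.
    switch : Fin n → Bool
    switch i = switch-by (dom? i)

    flip-0-injective : ∀ {s t} → flip s 0 ≡ flip t 0 → s ≡ t
    flip-0-injective {false} {false} eq = refl
    flip-0-injective {false} {true}  eq = contradiction eq (<⇒≢ 1≤δ)
    flip-0-injective {true}  {false} eq = contradiction (sym eq) (<⇒≢ 1≤δ)
    flip-0-injective {true}  {true}  eq = refl

    -- `p` preserves whether two points of a pole coincide or are antipodal, hence the sum of their
    -- signs.
    switch-constant : ∀ {a a′ b b′} → p a ≡ just a′ → p b ≡ just b′ → rep a ≡ rep b → sg a xor sg a′ ≡ sg b xor sg b′
    switch-constant {a} {a′} {b} {b′} pa pb eq = xor-transpose (sg a) (sg a′) (sg b) (sg b′) (flip-0-injective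
      (trans (sym (d-same-pole eq)) (trans (sym (d-active pa pb)) (d-same-pole (pole-forward pa pb eq)))))

    switch-rep : ∀ {a a′} → p a ≡ just a′ → switch (rep a) ≡ sg a xor sg a′
    switch-rep {a} pa with dom? (rep a)
    ... | yes (b , b′ , pb , eq) = switch-constant pb pa eq
    ... | no ¬dom = ⊥-elim (¬dom (a , _ , pa , refl))

    exchange-by : Dec (∃₂ λ a a′ → p a ≡ just a′) → Bool
    exchange-by (yes (a , a′ , _)) = totalClass a xor totalClass a′
    exchange-by (no _)             = false

    some-active? : Dec (∃₂ λ a a′ → p a ≡ just a′)
    some-active? = Fin.any? active?

    exchange : Bool
    exchange = exchange-by some-active?

    -- The class of a distance is the sum of the total classes of its ends and `p` preserves
    -- distances, so all total classes change by the same bit.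
    exchange-active : ∀ {a a′} → p a ≡ just a′ → exchange ≡ totalClass a xor totalClass a′
    exchange-active {a} {a′} pa with some-active?
    ... | no ∄ = ⊥-elim (∄ (a , a′ , pa))
    ... | yes (b , b′ , pb) = xor-transpose (totalClass b) (totalClass b′) (totalClass a) (totalClass a′)
          (trans (sym (class-total b a)) (trans (cong class (sym (d-active pb pa))) (class-total b′ a′)))

    -- `exchange` concerns total classes, which involve the sign. Where the points of a pole are
    -- switched, the contribution `turned` of the sign has to be taken back in the base point.
    classShift : Fin n → Bool
    classShift i = exchange xor (switch i ∧ turned)

    pointClass-rep : ∀ {a a′} → p a ≡ just a′ → pointClass (rep a) xor classShift (rep a) ≡ pointClass (rep a′)
    pointClass-rep {a} {a′} pa = trans
      (cong₂ (λ x s → pointClass (rep a) xor (x xor (s ∧ turned))) (exchange-active pa) (switch-rep pa))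
      (cancel (pointClass (rep a)) (pointClass (rep a′)) (sg a) (sg a′) turned)
      where
      cancel : ∀ b b′ s s′ u → b xor (((b xor (s ∧ u)) xor (b′ xor (s′ ∧ u))) xor ((s xor s′) ∧ u)) ≡ b′
      cancel b b′ s s′ u = trans (cong (λ x → b xor (x xor v)) (signedClass-xor b b′ s s′ u))
        (trans (cong (b xor_) (xor-cancelʳ (b xor b′) v)) (xor-cancelˡ b b′))
        where v = (s xor s′) ∧ u

    φᴾ : Pt → Pt
    φᴾ (i , b) = φ i , b xor classShift i

    φᴾ-base : ∀ {a a′} → p a ≡ just a′ → φᴾ (base a) ≡ base a′
    φᴾ-base pa = cong₂ _,_ (φ-rep pa) (pointClass-rep pa)

    φᴾ-injective : Injective _≡_ _≡_ φᴾ
    φᴾ-injective {i , b} {j , c} eq with refl ← proj₁ (proj₂ extended) (cong proj₁ eq) =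
      cong (i ,_) (xor-injectiveʳ (classShift i) (cong proj₂ eq))

    φᴾ-inverse : Inverse φᴾ
    φᴾ-inverse = injective⇒inverse Pt-finite φᴾ-injective

    open Inverse φᴾ-inverse renaming (f⁻¹ to φᴾ⁻¹; f⁻¹f to φᴾ⁻¹φᴾ; ff⁻¹ to φᴾφᴾ⁻¹)

    turns : Pt → Pt → Bool
    turns (i , _) (j , _) = switch i xor switch j

    pairClass-φ : ∀ I J → pairClass (φᴾ I) (φᴾ J) ≡ pairClass I J xor (turns I J ∧ turned)
    pairClass-φ (i , b) (j , c) = trans (xor-interchange b (exchange xor u) c (exchange xor v))
      (cong ((b xor c) xor_) (trans (cong₂ _xor_ (xor-comm exchange u) (xor-comm exchange v))
        (trans (xor-shift u v exchange) (sym (Bool.∧-distribʳ-xor turned (switch i) (switch j))))))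
      where
      u = switch i ∧ turned
      v = switch j ∧ turned

    turns-sym : ∀ I J → turns I J ≡ turns J I
    turns-sym (i , _) (j , _) = xor-comm (switch i) (switch j)

    pairN-sym : ∀ I J → pairN I J ≡ pairN J I
    pairN-sym (_ , b) (_ , c) = cong N (xor-comm b c)

    turnᴾ : Pt → Pt → Word → Word
    turnᴾ I J = turn (turns I J) (pairN I J)

    onesᴾ : Pt → Pt → Word
    onesᴾ I J = ones (turns I J) (pairN I J)

    turnᴾ-sym : ∀ I J w → turnᴾ I J w ≡ turnᴾ J I w
    turnᴾ-sym I J w = cong₂ (λ e M → turn e M w) (turns-sym I J) (pairN-sym I J)

    onesᴾ-sym : ∀ I J → onesᴾ I J ≡ onesᴾ J I
    onesᴾ-sym I J = cong₂ ones (turns-sym I J) (pairN-sym I J)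

    onesᴾ-same : ∀ I J → proj₁ I ≡ proj₁ J → onesᴾ I J ≡ 0ʷ
    onesᴾ-same I@(i , _) J refl = cong (λ e → ones e (pairN I J)) (xor-same (switch i))

    Domᴾ : Pt → Set
    Domᴾ (i , b) = Dom i × b ≡ pointClass i

    domᴾ? : ∀ I → Dec (Domᴾ I)
    domᴾ? (i , b) = dom? i ×-dec (b Bool.≟ pointClass i)

    -- Found by solving for the correction that takes the turned word `towards i j` to
    -- `towards (φ i) (φ j)`.
    forced : Pt → Pt → Word
    forced I@(i , _) J@(j , _) = towards (φ i) (φ j) ⊞ turnᴾ I J (towards i j)

    correction-by : ∀ I J → Dec (Domᴾ I) → Dec (Domᴾ J) → Word
    correction-by I J (yes _) _       = forced I J
    -- The opposite correction is prescribed, so this one supplies what is missing from the sum.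
    correction-by I J (no _)  (yes _) = forced J I ⊞ onesᴾ I J
    -- Nothing is prescribed, and the order of the poles decides which side carries the complement.
    -- Over a single pole the complement vanishes.
    correction-by I J (no _)  (no _)  = below (proj₁ I) (proj₁ J) (onesᴾ I J)

    -- The words of the points over I receive this correction, which maps the words of the
    -- embedded copy as required and is a symmetric function of (I , J) up to the complement.
    correction : Pt → Pt → Word
    correction I J = correction-by I J (domᴾ? I) (domᴾ? J)

    threshold-turn : ∀ e {v} → v ≤ δ →
      threshold (quo (flip e v)) ⊞ turn e (N (class v)) (threshold (quo v)) ≡ ones e (N (class v))
    threshold-turn false {v} h = ⊞-self (threshold (quo v))
    threshold-turn true  {v} h = trans
      (cong (_⊞ t) (threshold-opposite {k = quo v} {quo (δ ∸ v)} (quo-opposite 1≤g (m+[n∸m]≡n h)) (N≤δ 1≤g (class v))))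
      (trans (cong (_⊞ t) (⊞-comm t (ones true (N (class v))))) (⊞-cancelʳ (ones true (N (class v))) t))
      where t = turn true (N (class v)) (threshold (quo v))

    d-φ : ∀ {a a′ b b′} → p a ≡ just a′ → p b ≡ just b′ →
      d (φ (rep a)) (φ (rep b)) ≡ flip (switch (rep a) xor switch (rep b)) (d (rep a) (rep b))
    d-φ {a} {a′} {b} {b′} pa pb = begin
      d (φ (rep a)) (φ (rep b))         ≡⟨ cong₂ d (φ-rep pa) (φ-rep pb) ⟩
      d (rep a′) (rep b′)               ≡⟨ unflip s′ (d≤δ (rep a′) (rep b′)) ⟨
      flip s′ (flip s′ (d (rep a′) (rep b′))) ≡⟨ cong (flip s′) (trans (sym (d-poles a′ b′)) (trans (d-active pa pb) (d-poles a b))) ⟩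
      flip s′ (flip s (d (rep a) (rep b)))    ≡⟨ flip-flip s′ s (d≤δ (rep a) (rep b)) ⟩
      flip (s′ xor s) (d (rep a) (rep b))     ≡⟨ cong (λ t → flip t (d (rep a) (rep b))) signs ⟩
      flip (switch (rep a) xor switch (rep b)) (d (rep a) (rep b)) ∎
      where
      open ≡-Reasoning
      s = sg a xor sg b
      s′ = sg a′ xor sg b′
      unflip : ∀ s {v} → v ≤ δ → flip s (flip s v) ≡ v
      unflip s h = trans (flip-flip s s h) (cong (λ t → flip t _) (xor-same s))
      signs : s′ xor s ≡ switch (rep a) xor switch (rep b)
      signs = trans (xor-interchange (sg a′) (sg b′) (sg a) (sg b)) (cong₂ _xor_
        (trans (xor-comm (sg a′) (sg a)) (sym (switch-rep pa))) (trans (xor-comm (sg b′) (sg b)) (sym (switch-rep pb))))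

    -- With both sides prescribed there is no freedom left. The sum comes out right because `p`
    -- preserves the distance of two poles up to their switches, as in `d-φ`.
    forced-sum : ∀ {I J} → Domᴾ I → Domᴾ J → forced I J ⊞ forced J I ≡ onesᴾ I J
    forced-sum {I@(.(rep a) , .(pointClass (rep a)))} {J@(.(rep b) , .(pointClass (rep b)))}
      ((a , a′ , pa , refl) , refl) ((b , b′ , pb , refl) , refl) = by-poles (i Fin.≟ j)
      where
      i = rep a
      j = rep b
      e = turns I J
      by-poles : Dec (i ≡ j) → forced I J ⊞ forced J I ≡ onesᴾ I J
      by-poles (yes eq) = trans (cong (forced I J ⊞_) (cong₂ forced J≡I (sym J≡I)))
        (trans (⊞-self (forced I J)) (sym (onesᴾ-same I J eq)))
        where
        J≡I : J ≡ I
        J≡I = cong (λ k → k , pointClass k) (sym eq)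
      by-poles (no i≢j) = begin
        forced I J ⊞ forced J I
          ≡⟨ ⊞-interchange (towards (φ i) (φ j)) (turnᴾ I J (towards i j)) (towards (φ j) (φ i)) (turnᴾ J I (towards j i)) ⟩
        (towards (φ i) (φ j) ⊞ towards (φ j) (φ i)) ⊞ (turnᴾ I J (towards i j) ⊞ turnᴾ J I (towards j i))
          ≡⟨ cong₂ _⊞_ (towards-sum (i≢j ∘ proj₁ (proj₂ extended))) turned-sum ⟩
        threshold (quo (d (φ i) (φ j))) ⊞ turnᴾ I J (threshold (quo (d i j)))
          ≡⟨ cong₂ _⊞_ (cong (threshold ∘ quo) (d-φ pa pb)) (cong (λ c → turn e (N c) (threshold (quo (d i j)))) (sym (class-d i j))) ⟩
        threshold (quo (flip e (d i j))) ⊞ turn e (N (class (d i j))) (threshold (quo (d i j)))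
          ≡⟨ threshold-turn e (d≤δ i j) ⟩
        ones e (N (class (d i j)))
          ≡⟨ cong (λ c → ones e (N c)) (class-d i j) ⟩
        onesᴾ I J ∎
        where
        open ≡-Reasoning
        turned-sum : turnᴾ I J (towards i j) ⊞ turnᴾ J I (towards j i) ≡ turnᴾ I J (threshold (quo (d i j)))
        turned-sum = trans (cong (turnᴾ I J (towards i j) ⊞_) (turnᴾ-sym J I (towards j i)))
          (trans (sym (turn-⊞ e (pairN I J) (towards i j) (towards j i))) (cong (turnᴾ I J) (towards-sum i≢j)))

    correction-by-sum : ∀ I J (DI : Dec (Domᴾ I)) (DJ : Dec (Domᴾ J)) →
      correction-by I J DI DJ ⊞ correction-by J I DJ DI ≡ onesᴾ I J
    correction-by-sum I J (yes hI) (yes hJ) = forced-sum hI hJ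
    correction-by-sum I J (yes _) (no _) = trans (⊞-cancelˡ (forced I J) (onesᴾ J I)) (onesᴾ-sym J I)
    correction-by-sum I J (no _) (yes _) = trans (⊞-comm (forced J I ⊞ onesᴾ I J) (forced J I)) (⊞-cancelˡ (forced J I) (onesᴾ I J))
    correction-by-sum I@(i , _) J@(j , _) (no _) (no _) with <-cmp (toℕ i) (toℕ j)
    ... | tri< i<j _ j≮i = trans (cong₂ _⊞_ (below-true i<j _) (below-false j≮i _)) (⊞-identityʳ (onesᴾ I J))
    ... | tri> i≮j _ j<i = trans (cong₂ _⊞_ (below-false i≮j _) (below-true j<i _))
          (trans (⊞-identityˡ (onesᴾ J I)) (onesᴾ-sym J I))
    ... | tri≈ i≮j i≡j j≮i = trans (cong₂ _⊞_ (below-false i≮j _) (below-false j≮i _))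
          (trans (⊞-self 0ʷ) (sym (onesᴾ-same I J (Fin.toℕ-injective i≡j))))

    correction-sum : ∀ I J → correction I J ⊞ correction J I ≡ onesᴾ I J
    correction-sum I J = correction-by-sum I J (domᴾ? I) (domᴾ? J)

    correction-forced : ∀ {a a′} → p a ≡ just a′ → ∀ J → correction (base a) J ≡ forced (base a) J
    correction-forced {a} {a′} pa J with domᴾ? (base a)
    ... | yes _ = refl
    ... | no ¬h = ⊥-elim (¬h ((a , a′ , pa , refl) , refl))

    moveWord : Pt → Table → Pt → Word
    moveWord I χ J′ = turnᴾ I (φᴾ⁻¹ J′) (look χ (φᴾ⁻¹ J′)) ⊞ correction I (φᴾ⁻¹ J′)

    φ₀ : V₀ → V₀
    φ₀ (I , s , χ) = φᴾ I , s xor switch (proj₁ I) , table (moveWord I χ)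

    look-φ₀ : ∀ I χ J → look (table (moveWord I χ)) (φᴾ J) ≡ turnᴾ I J (look χ J) ⊞ correction I J
    look-φ₀ I χ J = trans (look-table (moveWord I χ) (φᴾ J))
      (cong (λ J → turnᴾ I J (look χ J) ⊞ correction I J) (φᴾ⁻¹φᴾ J))

    ⊞-injectiveʳ : ∀ {u v} w → u ⊞ w ≡ v ⊞ w → u ≡ v
    ⊞-injectiveʳ {u} {v} w eq = trans (sym (⊞-cancelʳ u w)) (trans (cong (_⊞ w) eq) (⊞-cancelʳ v w))

    φ₀-injective : Injective _≡_ _≡_ φ₀
    φ₀-injective {I , s , χ} {J , t , ψ} eq with refl ← φᴾ-injective {I} {J} (cong proj₁ eq) =
      cong₂ (λ s χ → I , s , χ) (xor-injectiveʳ (switch (proj₁ I)) (cong (proj₁ ∘ proj₂) eq))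
        (table-ext λ M → turn-injective (turns I M) (pairN≤δ I M) (⊞-injectiveʳ (correction I M)
          (trans (sym (look-φ₀ I χ M)) (trans (cong (λ x → look (proj₂ (proj₂ x)) (φᴾ M)) eq) (look-φ₀ I ψ M)))))

    -- Turning is additive and the corrections depend on the base points only, so the sum undergoes
    -- one affine map for all points over a given pair of base points.
    word-φ₀ : ∀ x y → word (φ₀ x) (φ₀ y) ≡
      turnᴾ (proj₁ x) (proj₁ y) (word x y) ⊞ onesᴾ (proj₁ x) (proj₁ y)
    word-φ₀ x@(I , _ , χ) y@(J , _ , ψ) = begin
      word (φ₀ x) (φ₀ y)
        ≡⟨ cong₂ _⊞_ (look-φ₀ I χ J) (look-φ₀ J ψ I) ⟩
      (turnᴾ I J (look χ J) ⊞ correction I J) ⊞ (turnᴾ J I (look ψ I) ⊞ correction J I)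
        ≡⟨ ⊞-interchange (turnᴾ I J (look χ J)) (correction I J) (turnᴾ J I (look ψ I)) (correction J I) ⟩
      (turnᴾ I J (look χ J) ⊞ turnᴾ J I (look ψ I)) ⊞ (correction I J ⊞ correction J I)
        ≡⟨ cong₂ _⊞_ (cong (turnᴾ I J (look χ J) ⊞_) (turnᴾ-sym J I (look ψ I))) (correction-sum I J) ⟩
      (turnᴾ I J (look χ J) ⊞ turnᴾ I J (look ψ I)) ⊞ onesᴾ I J
        ≡⟨ cong (_⊞ onesᴾ I J) (turn-⊞ (turns I J) (pairN I J) (look χ J) (look ψ I)) ⟨
      turnᴾ I J (word x y) ⊞ onesᴾ I J ∎
      where open ≡-Reasoning

    label-turn : ∀ e c w → label (c xor (e ∧ turned)) (turn e (N c) w ⊞ ones e (N c)) ≡ flip e (label c w)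
    label-turn false c w = cong₂ label (xor-identityʳ c) (⊞-identityʳ w)
    label-turn true  c w = trans (sym (m+n∸n≡m _ (label c w))) (cong (_∸ label c w) (label-opposite c w))

    r₀-φ₀ : ∀ x y → r₀ (φ₀ x) (φ₀ y) ≡ r₀ x y
    r₀-φ₀ x@(I@(i , b) , s , χ) y@(J@(j , c) , t , ψ) = begin
      flip ((s xor switch i) xor (t xor switch j)) (label (pairClass (φᴾ I) (φᴾ J)) (word (φ₀ x) (φ₀ y)))
        ≡⟨ cong₂ flip (xor-interchange s (switch i) t (switch j)) (cong₂ label (pairClass-φ I J) (word-φ₀ x y)) ⟩
      flip ((s xor t) xor e) (label (pairClass I J xor (e ∧ turned)) (turn e (pairN I J) (word x y) ⊞ ones e (pairN I J)))
        ≡⟨ cong (flip ((s xor t) xor e)) (label-turn e (pairClass I J) (word x y)) ⟩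
      flip ((s xor t) xor e) (flip e (label (pairClass I J) (word x y)))
        ≡⟨ flip-flip ((s xor t) xor e) e (label≤δ (pairClass I J) (word x y)) ⟩
      flip (((s xor t) xor e) xor e) (label (pairClass I J) (word x y))
        ≡⟨ cong (λ u → flip u (label (pairClass I J) (word x y))) (xor-cancelʳ (s xor t) e) ⟩
      flip (s xor t) (label (pairClass I J) (word x y)) ∎
      where
      open ≡-Reasoning
      e = turns I J

    φ₀-τ : ∀ x → φ₀ (τ₀ x) ≡ τ₀ (φ₀ x)
    φ₀-τ (I , s , χ) = cong (λ t → φᴾ I , t , table (moveWord I χ)) (sym (Bool.not-distribˡ-xor s (switch (proj₁ I))))

    φ₀-tw : ∀ s x → φ₀ (tw₀ s x) ≡ tw₀ s (φ₀ x)
    φ₀-tw false x = refl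
    φ₀-tw true  x = φ₀-τ x

    automorphism₀ : Automorphismᴳ graph₀
    automorphism₀ = record
      { φ = φ₀
      ; φ-inverse = injective⇒inverse V₀-finite φ₀-injective
      ; φ-τ = φ₀-τ
      ; φ-r = r₀-φ₀
      ; φ-adj = λ {x} {y} (adj₀ h q s) → adj₀ (λ t eq → h t (φ₀-injective (trans eq (sym (φ₀-tw t y)))))
          (subst (0 <_) (sym (r₀-φ₀ x y)) q) (subst (λ v → 2 * v ≤ δ) (sym (r₀-φ₀ x y)) s)
      ; φ-adj⁻ = λ {x} {y} (adj₀ h q s) → adj₀ (λ t eq → h t (trans (cong φ₀ eq) (φ₀-tw t y)))
          (subst (0 <_) (r₀-φ₀ x y) q) (subst (λ v → 2 * v ≤ δ) (r₀-φ₀ x y) s)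
      }

    φ₀-e₀ : ∀ {a a′} → p a ≡ just a′ → φ₀ (e₀ a) ≡ e₀ a′
    φ₀-e₀ {a} {a′} pa = cong₂ _,_ (φᴾ-base pa) (cong₂ _,_
      (trans (cong (sg a xor_) (switch-rep pa)) (xor-cancelˡ (sg a) (sg a′)))
      (table-ext λ J′ → subst (λ J′ → look (table (moveWord (base a) (table (view (rep a))))) J′ ≡ look (table (view (rep a′))) J′)
        (φᴾφᴾ⁻¹ J′) (pointwise (φᴾ⁻¹ J′))))
      where
      pointwise : ∀ J → look (table (moveWord (base a) (table (view (rep a))))) (φᴾ J) ≡ look (table (view (rep a′))) (φᴾ J)
      pointwise J@(j , _) = begin
        look (table (moveWord (base a) (table (view (rep a))))) (φᴾ J)
          ≡⟨ look-φ₀ (base a) (table (view (rep a))) J ⟩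
        turnᴾ (base a) J (look (table (view (rep a))) J) ⊞ correction (base a) J
          ≡⟨ cong₂ _⊞_ (cong (turnᴾ (base a) J) (look-table (view (rep a)) J)) (correction-forced pa J) ⟩
        turnᴾ (base a) J (towards (rep a) j) ⊞ (towards (φ (rep a)) (φ j) ⊞ turnᴾ (base a) J (towards (rep a) j))
          ≡⟨ ⊞-comm (turnᴾ (base a) J (towards (rep a) j)) _ ⟩
        (towards (φ (rep a)) (φ j) ⊞ turnᴾ (base a) J (towards (rep a) j)) ⊞ turnᴾ (base a) J (towards (rep a) j)
          ≡⟨ ⊞-cancelʳ (towards (φ (rep a)) (φ j)) (turnᴾ (base a) J (towards (rep a) j)) ⟩
        towards (φ (rep a)) (φ j)
          ≡⟨ cong (λ i → towards i (φ j)) (φ-rep pa) ⟩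
        towards (rep a′) (φ j)
          ≡⟨ look-table (view (rep a′)) (φᴾ J) ⟨
        look (table (view (rep a′))) (φᴾ J) ∎
        where open ≡-Reasoning

  level₂ : Level 2
  level₂ = record
    { graph = graph₀
    ; e = e₀
    ; e-inj = λ eq → let i , s = pole-e₀ false eq in pole-injective i s
    ; e-antipode = λ ab → let i , s = antipodes-share-pole ab in e₀-pole true s i
    ; e-τ = λ eq → let i , s = pole-e₀ true eq in opposite-signs i s
    ; e-r = λ h → r₀-e₀ λ eq → let s , same = same-pole-e₀ eq in h s same
    ; e-adj = e₀-adj
    ; good = good₂
    ; extend = λ p iso → Extend.automorphism₀ p iso , Extend.φ₀-e₀ p iso
    }

-- The theorem

open import Defs

EPPA-witness : {δ : ℕ} → ℕ → MetricSpace δ → Set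
EPPA-witness {δ} K A = Σ (MetricSpace δ) λ B → InA δ K B × Σ (Embedding A B) λ ι →
  (p : Fin (n A) → Maybe (Fin (n A))) → PartialIso A p →
  Σ (Automorphism B) λ α → ∀ x x′ → p x ≡ just x′ → g α (f ι x) ≡ f ι x′

-- The data of a witness over any vertex type; `realise` moves them to `Fin`.
record Extensions {δ : ℕ} (K : ℕ) (A : MetricSpace δ) {V : Set} (D : V → V → ℕ) : Set where
  field
    D≤δ     : ∀ x y → D x y ≤ δ
    D0⇒≡    : ∀ x y → D x y ≡ 0 → x ≡ y
    D-refl  : ∀ x → D x x ≡ 0
    D-sym   : ∀ x y → D x y ≡ D y x
    D-tri   : ∀ x y z → D x z ≤ D x y + D y z
    allowed : ∀ x y z → ¬ Forbidden δ K (D x y) (D y z) (D x z)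
    ι       : Fin (n A) → V
    ι-inj   : Injective _≡_ _≡_ ι
    ι-pres  : ∀ a b → D (ι a) (ι b) ≡ d A a b
    extend  : ∀ p → PartialIso A p → Σ (V → V) λ φ → Inverse φ × (∀ x y → D (φ x) (φ y) ≡ D x y) ×
                (∀ a a′ → p a ≡ just a′ → φ (ι a) ≡ ι a′)

realise : {δ K : ℕ} {A : MetricSpace δ} {V : Set} {D : V → V → ℕ} → Finite V → Extensions K A D → EPPA-witness K A
realise {δ} {K} {A} {V} {D} F X = B , (λ x y z → allowed (from x) (from y) (from z)) , embedding , λ p iso →
  let φ , inv , pres , ext = extend p iso in record
    { g = to ∘ φ ∘ from
    ; g⁻¹ = to ∘ Inverse.f⁻¹ inv ∘ from
    ; inv-l = λ x → trans (cong (to ∘ Inverse.f⁻¹ inv) (from-to _)) (trans (cong to (Inverse.f⁻¹f inv _)) (to-from x))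
    ; inv-r = λ x → trans (cong (to ∘ φ) (from-to _)) (trans (cong to (Inverse.ff⁻¹ inv _)) (to-from x))
    ; g-pres = λ x y → trans (cong₂ D (from-to _) (from-to _)) (pres _ _)
    } , λ x x′ px → cong to (trans (cong φ (from-to (ι x))) (ext x x′ px))
  where
  open Finite F
  open Extensions X
  B : MetricSpace δ
  B = record
    { n = size
    ; d = λ x y → D (from x) (from y)
    ; d≤δ = λ x y → D≤δ _ _
    ; d0⇒≡ = λ x y eq → from-injective (D0⇒≡ _ _ eq)
    ; d-refl = λ x → D-refl _
    ; d-sym = λ x y → D-sym _ _
    ; d-tri = λ x y z → D-tri _ _ _
    }
  embedding : Embedding A B
  embedding = record
    { f = to ∘ ι
    ; f-inj = ι-inj ∘ to-injective
    ; f-pres = λ x y → trans (cong₂ D (from-to _) (from-to _)) (ι-pres x y)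
    }

module Main {δ g K : ℕ} (g∣2 : g ∣ 2) (g<δ : g < δ) (2K+g≤ : 2 * K + g ≤ suc δ) (C : Classes δ g)
  (A : MetricSpace δ) (A-space : AntipodalSpace δ g K (d A)) where

  private
    1≤g : 1 ≤ g
    1≤g = n≢0⇒n>0 λ { refl → contradiction (0∣⇒≡0 g∣2) λ () }

    1≤δ : 1 ≤ δ
    1≤δ = ≤-trans 1≤g (<⇒≤ g<δ)

    2K≤δ : 2 * K ≤ δ
    2K≤δ = s≤s⁻¹ (≤-trans (≤-trans (eq≤ (+-comm 1 (2 * K))) (+-monoʳ-≤ (2 * K) 1≤g)) 2K+g≤)

  open Extension δ g K (d A) using (Level)

  levels : ∀ m → Level (2 + m)
  levels zero    = Base.level₂ A-space 1≤δ 1≤g C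
  levels (suc m) = Step.next A-space 2K≤δ (s≤s (s≤s z≤n)) (levels m)

  open Level (levels δ) using (graph; e; e-inj; e-τ; e-r; e-adj; good; extend)

  open Graph graph
  -- Levels are counted from 2, so the last one controls cycles with up to `δ + 2` edges;
  -- `Completion` asks for `δ`.
  open Completion {δ} {g} {K} g∣2 g<δ 2K+g≤ graph (λ σ a w k<δ → good σ a w (≤-trans k<δ (m≤n+m δ 2)))
    using (Dist; Near; near; far; near-refl; dist; dist-unique; dist-sym; dist-triangle; dist-perimeter; dist-odd-lower;
      dist-odd-upper; triple-congruent; dist≤δ; dist-0⇒≡; dist-adj; dist-τ; dist-map; r-τʳ)

  D : V → V → ℕ
  D x z = proj₁ (dist x z)

  D-dist : ∀ x z → Dist x z (D x z)
  D-dist x z = proj₂ (dist x z)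

  D-space : AntipodalSpace δ g K D
  D-space = record
    { d≤δ = λ x y → dist≤δ (D-dist x y)
    ; d0⇒≡ = λ x y eq → dist-0⇒≡ (subst (Dist x y) eq (D-dist x y))
    ; d-refl = λ x → dist-unique (D-dist x x) (near (near-refl x))
    ; d-sym = λ x y → dist-unique (D-dist x y) (dist-sym (D-dist y x))
    ; triangle = λ x y z → dist-triangle (D-dist x y) (D-dist y z) (D-dist x z)
    ; perimeter = λ x y z → dist-perimeter (D-dist x y) (D-dist y z) (D-dist x z)
    ; odd-lower = λ x y z → dist-odd-lower (D-dist x y) (D-dist y z) (D-dist x z)
    ; odd-upper = λ x y z → dist-odd-upper (D-dist x y) (D-dist y z) (D-dist x z)
    ; congruent = λ x y z → triple-congruent (D-dist x y) (D-dist y z) (D-dist x z)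
    }

  e-dist : ∀ a b → Dist (e a) (e b) (d A a b)
  e-dist a b with e-adj a b
  ... | inj₁ (false , eq) with refl ← e-inj eq = subst (Dist (e a) (e a)) (sym (AntipodalSpace.d-refl A-space a)) (near (near-refl (e a)))
  ... | inj₁ (true , eq) = far (subst (λ x → Near (e a) x 0) eq (near-refl (e a)))
          (trans (+-identityʳ (d A a b)) (e-τ eq))
  ... | inj₂ (false , a~b) = subst (Dist (e a) (e b)) (e-r (adj-≉ a~b)) (dist-adj a~b)
  ... | inj₂ (true , a~τb) = subst₂ (Dist (e a)) (τ-invol (e b)) (e-r not-same)
          (dist-τ (dist-adj a~τb) (trans (+-comm (r (e a) (e b)) _) (r-τʳ (e a) (e b))))
    where
    not-same : ∀ s → e a ≢ tw s (e b)
    not-same false eq = adj-≉ a~τb true (trans eq (sym (τ-invol (e b))))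
    not-same true  eq = adj-≉ a~τb false eq

  witness : ∀ {K′} → (∀ {X : Set} {D : X → X → ℕ} → AntipodalSpace δ g K D → ∀ x y z → ¬ Forbidden δ K′ (D x y) (D y z) (D x z)) →
    EPPA-witness K′ A
  witness {K′} allowed = realise {K = K′} {A} V-finite (record
    { D≤δ = AntipodalSpace.d≤δ D-space
    ; D0⇒≡ = AntipodalSpace.d0⇒≡ D-space
    ; D-refl = AntipodalSpace.d-refl D-space
    ; D-sym = AntipodalSpace.d-sym D-space
    ; D-tri = AntipodalSpace.triangle D-space
    ; allowed = allowed D-space
    ; ι = e
    ; ι-inj = e-inj
    ; ι-pres = λ a b → dist-unique (D-dist (e a) (e b)) (e-dist a b)
    ; extend = λ p iso → let α , ext = extend p iso in Automorphismᴳ.φ α , Automorphismᴳ.φ-inverse α ,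
        (λ x y → dist-unique (D-dist _ _) (dist-map α (D-dist x y))) , λ a a′ → ext
    })

min3≤₁ : ∀ a b c → min3 a b c ≤ a
min3≤₁ a b c = ≤-trans (m⊓n≤m (a ⊓ b) c) (m⊓n≤m a b)

-- Forbidden triangles and antipodal spaces

module NonBipartite {δ K : ℕ} (2K≤δ : 2 * K ≤ δ) where

  private
    K≤δ : K ≤ δ
    K≤δ = ≤-trans (m≤n*m K 2) 2K≤δ

  -- The bound with `min3` is recorded for the first side; reordering the points in `space-triangle`
  -- recovers it for the others.
  space : (A : MetricSpace δ) → InA δ K A → AntipodalSpace δ 1 K (d A)
  space A A∈ = record
    { d≤δ = d≤δ A ; d0⇒≡ = d0⇒≡ A ; d-refl = d-refl A ; d-sym = d-sym A ; triangle = d-tri A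
    ; perimeter = λ x y z → ≮⇒≥ (A∈ x y z ∘ inj₁)
    ; odd-lower = λ x y z o → ≮⇒≥ (λ h → A∈ x y z (inj₂ (inj₁ (o , h))))
    ; odd-upper = λ x y z o → upper (d A x y) (d A y z) (d A x z) (≮⇒≥ (λ h → A∈ x y z (inj₂ (inj₂ (o , h)))))
    ; congruent = λ x y z → 1∣ _
    }
    where
    upper : ∀ a b c → a + b + c ≤ 2 * (δ ∸ K) + 2 * min3 a b c → 2 * K + (a + b + c) ≤ 2 * δ + 2 * a
    upper a b c h = ≤-trans (+-monoʳ-≤ (2 * K) (≤-trans h (+-monoʳ-≤ (2 * (δ ∸ K)) (*-monoʳ-≤ 2 (min3≤₁ a b c)))))
      (eq≤ (trans (regroup K (δ ∸ K) a) (cong (λ v → 2 * v + 2 * a) (m+[n∸m]≡n K≤δ))))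
      where
      regroup : ∀ K L a → 2 * K + (2 * L + 2 * a) ≡ 2 * (K + L) + 2 * a
      regroup K L a = solve (K ∷ L ∷ a ∷ [])

  allowed : ∀ {X : Set} {D : X → X → ℕ} → AntipodalSpace δ 1 K D → ∀ x y z → ¬ Forbidden δ K (D x y) (D y z) (D x z)
  allowed {D = D} S x y z = refute (SpaceTriangles.space-triangle S x y z)
    where
    open TriangleFlips {δ} {K}
    refute : ∀ {a b c} → Triangle a b c → ¬ Forbidden δ K a b c
    refute T (inj₁ h) = <⇒≱ h (Triangle.sum≤ T)
    refute T (inj₂ (inj₁ (o , h))) = <⇒≱ h (Triangle.odd₀ T o)
    refute {a} {b} {c} T (inj₂ (inj₂ (o , h))) = min-case (⊓-sel (a ⊓ b) c) (⊓-sel a b)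
      where
      regroup : ∀ K L w → 2 * (K + L) + 2 * w ≡ 2 * K + (2 * L + 2 * w)
      regroup K L w = solve (K ∷ L ∷ w ∷ [])
      exceed : ∀ {w} → min3 a b c ≡ w → 2 * K + (a + b + c) ≤ 2 * δ + 2 * w → ⊥
      exceed {w} refl h′ = <⇒≱ h (+-cancelˡ-≤ (2 * K) _ _ (≤-trans h′
        (eq≤ (trans (cong (λ v → 2 * v + 2 * w) (sym (m+[n∸m]≡n K≤δ))) (regroup K (δ ∸ K) w)))))
      min-case : min3 a b c ≡ a ⊓ b ⊎ min3 a b c ≡ c → a ⊓ b ≡ a ⊎ a ⊓ b ≡ b → ⊥
      min-case (inj₂ eq) _          = exceed eq (Triangle.oddᶜ T o)
      min-case (inj₁ eq) (inj₁ eq′) = exceed (trans eq eq′) (Triangle.oddᵃ T o)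
      min-case (inj₁ eq) (inj₂ eq′) = exceed (trans eq eq′) (Triangle.oddᵇ T o)

module Bipartite {δ : ℕ} where

  -- For `K = δ` odd perimeters are excluded both below and above `2 * δ`, which is itself even, so
  -- every perimeter is even.
  space : (A : MetricSpace δ) → InA δ δ A → AntipodalSpace δ 2 0 (d A)
  space A A∈ = record
    { d≤δ = d≤δ A ; d0⇒≡ = d0⇒≡ A ; d-refl = d-refl A ; d-sym = d-sym A ; triangle = d-tri A
    ; perimeter = λ x y z → ≮⇒≥ (A∈ x y z ∘ inj₁)
    ; odd-lower = λ _ _ _ _ → z≤n
    ; odd-upper = λ x y z o → ⊥-elim (not-odd x y z o)
    ; congruent = λ x y z → even x y z (Even⊎Odd _)
    }
    where
    not-odd : ∀ x y z → ¬ Odd (d A x y + d A y z + d A x z)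
    not-odd x y z o with <-cmp (d A x y + d A y z + d A x z) (2 * δ)
    ... | tri< h _ _ = A∈ x y z (inj₂ (inj₁ (o , h)))
    ... | tri> _ _ h = A∈ x y z (inj₁ h)
    ... | tri≈ _ h _ = even-odd {proj₁ o} {δ} (trans (sym (proj₂ o)) h)
    even : ∀ x y z → (∃ λ k → d A x y + d A y z + d A x z ≡ 2 * k) ⊎ Odd (d A x y + d A y z + d A x z) →
      2 ∣ d A x y + d A y z + d A x z
    even x y z (inj₁ (k , eq)) = subst (2 ∣_) (sym eq) (m∣m*n k)
    even x y z (inj₂ o) = ⊥-elim (not-odd x y z o)

  2∣⇒¬Odd : ∀ {s} → 2 ∣ s → ¬ Odd s
  2∣⇒¬Odd (divides q refl) (k , eq) = even-odd {k} {q} (trans (sym eq) (*-comm q 2))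

  allowed : ∀ {X : Set} {D : X → X → ℕ} → AntipodalSpace δ 2 0 D → ∀ x y z → ¬ Forbidden δ δ (D x y) (D y z) (D x z)
  allowed S x y z (inj₁ h) = <⇒≱ h (AntipodalSpace.perimeter S x y z)
  allowed S x y z (inj₂ (inj₁ (o , _))) = 2∣⇒¬Odd (AntipodalSpace.congruent S x y z) o
  allowed S x y z (inj₂ (inj₂ (o , _))) = 2∣⇒¬Odd (AntipodalSpace.congruent S x y z) o

-- Bipartite classes with δ at most 2

transpose-target : ∀ {n} (i j : Fin n) → transpose i j j ≡ i
transpose-target i j with j Fin.≟ i
... | yes j≡i = j≡i
... | no  _ rewrite dec-true (j Fin.≟ j) refl = refl

-- A space with distances at most 1 has at most two points.
module Tiny {δ : ℕ} (δ≤1 : δ ≤ 1) (A : MetricSpace δ) (A∈ : InA δ δ A) where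

  apart : ∀ {x y} → x ≢ y → d A x y ≡ 1
  apart {x} {y} x≢y = ≤-antisym (≤-trans (d≤δ A x y) δ≤1) (n≢0⇒n>0 (x≢y ∘ d0⇒≡ A x y))

  no-three : ∀ {x y z} → x ≢ y → y ≢ z → x ≢ z → ⊥
  no-three {x} {y} {z} x≢y y≢z x≢z = A∈ x y z (inj₁ (subst (2 * δ <_)
    (sym (cong₂ _+_ (cong₂ _+_ (apart x≢y) (apart y≢z)) (apart x≢z))) (s≤s (*-monoʳ-≤ 2 δ≤1))))

  injective-pres : ∀ {φ} → Injective _≡_ _≡_ φ → ∀ x y → d A (φ x) (φ y) ≡ d A x y
  injective-pres {φ} φ-inj x y with x Fin.≟ y
  ... | yes refl = trans (d-refl A (φ x)) (sym (d-refl A x))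
  ... | no x≢y   = trans (apart (x≢y ∘ φ-inj)) (sym (apart x≢y))

  -- One pair `a ↦ a′` fixes a transposition, and with at most two points every other value of `p`
  -- agrees with it.
  extend-by : ∀ p → PartialIso A p → Dec (∃₂ λ a a′ → p a ≡ just a′) →
    ∃ λ φ → Injective _≡_ _≡_ φ × (∀ b b′ → p b ≡ just b′ → φ b ≡ b′)
  extend-by p iso (no ∄) = (λ x → x) , (λ eq → eq) , λ b b′ pb → ⊥-elim (∄ (b , b′ , pb))
  extend-by p iso (yes (a , a′ , pa)) = transpose a a′ , transpose-injective a a′ , ext
    where
    ext : ∀ b b′ → p b ≡ just b′ → transpose a a′ b ≡ b′
    ext b b′ pb with a Fin.≟ b
    ... | yes refl = trans (transpose-source a a′)
          (d0⇒≡ A a′ b′ (trans (iso a a a′ b′ pa pb) (d-refl A a)))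
    ... | no a≢b = by-case (a Fin.≟ a′) (b Fin.≟ a′) (b′ Fin.≟ a) (b Fin.≟ b′)
      where
      a′≢b′ : a′ ≢ b′
      a′≢b′ refl = a≢b (d0⇒≡ A a b (trans (sym (iso a b a′ a′ pa pb)) (d-refl A a′)))
      by-case : Dec (a ≡ a′) → Dec (b ≡ a′) → Dec (b′ ≡ a) → Dec (b ≡ b′) → transpose a a′ b ≡ b′
      by-case (yes refl) _ _ (yes refl) = transpose-diagonal a b
      by-case (yes refl) _ _ (no b≢b′) = ⊥-elim (no-three a≢b b≢b′ a′≢b′)
      by-case (no _) (yes refl) (yes refl) _ = transpose-target a a′
      by-case (no a≢a′) (no b≢a′) _ _ = ⊥-elim (no-three a≢a′ (b≢a′ ∘ sym) a≢b)
      by-case (no a≢a′) _ (no b′≢a) _ = ⊥-elim (no-three a≢a′ a′≢b′ (b′≢a ∘ sym))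

  witness : EPPA-witness δ A
  witness = realise {K = δ} {A} (Fin-finite (n A)) (record
    { D≤δ = d≤δ A ; D0⇒≡ = d0⇒≡ A ; D-refl = d-refl A ; D-sym = d-sym A ; D-tri = d-tri A
    ; allowed = A∈
    ; ι = λ a → a ; ι-inj = λ eq → eq ; ι-pres = λ _ _ → refl
    ; extend = λ p iso → let φ , φ-inj , ext = extend-by p iso
                                (Fin.any? λ a → Fin.any? λ a′ → Maybe-≡-dec Fin._≟_ (p a) (just a′))
                         in φ , injective⇒inverse (Fin-finite (n A)) φ-inj , injective-pres φ-inj , ext
    })

-- For δ = 2 the bipartite class consists of the subspaces of the 4-cycle.
module FourCycle (A : MetricSpace 2) (A∈ : InA 2 2 A) where

  A-space : AntipodalSpace 2 2 0 (d A)
  A-space = Bipartite.space A A∈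

  open Poles A-space (s≤s z≤n) using (rep; sg; antipodes-share-pole; d-same-pole; pole-injective)
  open Base A-space (s≤s z≤n) (s≤s z≤n) (parity-classes 2 (s≤s z≤n)) using (totalClass; class-total; module Extend)

  -- The first bit names a diagonal of the 4-cycle and the second an end of it.
  V : Set
  V = Bool × Bool

  V-finite : Finite V
  V-finite = Bool-finite ×-finite Bool-finite

  side : Bool → Bool → ℕ
  side true  _     = 1
  side false false = 0
  side false true  = 2

  D : V → V → ℕ
  D (b , s) (c , t) = side (b xor c) (s xor t)

  ι : Fin (n A) → V
  ι a = totalClass a , sg a

  even-distance : ∀ {a b} → isOdd (d A a b) ≡ false → rep a ≡ rep b
  even-distance {a} {b} eq with d A a b in ab | d≤δ A a b
  ... | 0 | _ = cong rep (d0⇒≡ A a b ab)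
  ... | 2 | _ = proj₁ (antipodes-share-pole ab)
  ... | suc (suc (suc _)) | s≤s (s≤s ())

  odd-distance : ∀ {a b} → isOdd (d A a b) ≡ true → d A a b ≡ 1
  odd-distance {a} {b} eq with d A a b | d≤δ A a b
  ... | 1 | _ = refl
  ... | suc (suc (suc _)) | s≤s (s≤s ())

  xor-false : ∀ {b c} → b xor c ≡ false → b ≡ c
  xor-false {false} {false} _ = refl
  xor-false {true}  {true}  _ = refl

  same-class : ∀ {a b} → totalClass a ≡ totalClass b → rep a ≡ rep b
  same-class {a} {b} eq = even-distance (trans (class-total a b) (trans (cong (_xor totalClass b) eq) (xor-same (totalClass b))))

  ι-pres : ∀ a b → D (ι a) (ι b) ≡ d A a b
  ι-pres a b = by-class (totalClass a xor totalClass b) refl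
    where
    side-0 : ∀ u → side false u ≡ TriangleFlips.flip {2} {0} u 0
    side-0 false = refl
    side-0 true  = refl
    by-class : ∀ c → totalClass a xor totalClass b ≡ c → D (ι a) (ι b) ≡ d A a b
    by-class true  eq = trans (cong (λ c → side c (sg a xor sg b)) eq) (sym (odd-distance (trans (class-total a b) eq)))
    by-class false eq = trans (cong (λ c → side c (sg a xor sg b)) eq)
      (trans (side-0 (sg a xor sg b)) (sym (d-same-pole (same-class (xor-false eq)))))

  forbidden? : ∀ a b c → Dec (Forbidden 2 2 a b c)
  forbidden? a b c = (4 <? a + b + c) ⊎-dec (odd? (a + b + c) ×-dec (a + b + c <? 4))
    ⊎-dec (odd? (a + b + c) ×-dec (0 + 2 * min3 a b c <? a + b + c))

  open Finite V-finite using (all-finite?; _≟ᶠ_)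

  module _ (p : Fin (n A) → Maybe (Fin (n A))) (iso : PartialIso A p) where
    open Extend p iso using (exchange; exchange-active; switch-constant)

    InClass : Bool → Set
    InClass b = ∃₂ λ a a′ → p a ≡ just a′ × totalClass a ≡ b

    inClass? : ∀ b → Dec (InClass b)
    inClass? b = Fin.any? λ a → Fin.any? λ a′ → Maybe-≡-dec Fin._≟_ (p a) (just a′) ×-dec (totalClass a Bool.≟ b)

    signShift-by : ∀ {b} → Dec (InClass b) → Bool
    signShift-by (yes (a , a′ , _)) = sg a xor sg a′
    signShift-by (no _)             = false

    signShift : Bool → Bool
    signShift b = signShift-by (inClass? b)

    signShift-active : ∀ {a a′} → p a ≡ just a′ → signShift (totalClass a) ≡ sg a xor sg a′
    signShift-active {a} {a′} pa with inClass? (totalClass a)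
    ... | yes (b , b′ , pb , eq) = switch-constant pb pa (same-class eq)
    ... | no ∄ = ⊥-elim (∄ (a , a′ , pa , refl))

    φ : V → V
    φ (b , s) = b xor exchange , s xor signShift b

    φ-injective : Injective _≡_ _≡_ φ
    φ-injective {b , s} {c , t} eq with refl ← xor-injectiveʳ exchange {b} {c} (cong proj₁ eq) =
      cong (b ,_) (xor-injectiveʳ (signShift b) (cong proj₂ eq))

    φ-pres : ∀ x y → D (φ x) (φ y) ≡ D x y
    φ-pres (b , s) (c , t) = trans (cong (λ u → side u ((s xor signShift b) xor (t xor signShift c))) (xor-shift b c exchange))
      (by-class (b xor c) refl)
      where
      by-class : ∀ u → b xor c ≡ u → side (b xor c) ((s xor signShift b) xor (t xor signShift c)) ≡ side (b xor c) (s xor t)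
      by-class true  eq = trans (cong (λ u → side u ((s xor signShift b) xor (t xor signShift c))) eq)
        (sym (cong (λ u → side u (s xor t)) eq))
      by-class false eq with refl ← xor-false {b} {c} eq = cong (side (b xor b)) (xor-shift s t (signShift b))

    φ-extends : ∀ a a′ → p a ≡ just a′ → φ (ι a) ≡ ι a′
    φ-extends a a′ pa = cong₂ _,_ (restore (totalClass a) (totalClass a′) (exchange-active pa))
      (restore (sg a) (sg a′) (signShift-active pa))
      where
      restore : ∀ b b′ {x} → x ≡ b xor b′ → b xor x ≡ b′
      restore b b′ refl = xor-cancelˡ b b′

  witness : EPPA-witness 2 A
  witness = realise {K = 2} {A} V-finite (record
    { D≤δ = from-yes (all-finite? λ x → all-finite? λ y → D x y ≤? 2)
    ; D0⇒≡ = from-yes (all-finite? λ x → all-finite? λ y → (D x y ≟ 0) →-dec (x ≟ᶠ y))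
    ; D-refl = from-yes (all-finite? λ x → D x x ≟ 0)
    ; D-sym = from-yes (all-finite? λ x → all-finite? λ y → D x y ≟ D y x)
    ; D-tri = from-yes (all-finite? λ x → all-finite? λ y → all-finite? λ z → D x z ≤? D x y + D y z)
    ; allowed = from-yes (all-finite? λ x → all-finite? λ y → all-finite? λ z → ¬? (forbidden? (D x y) (D y z) (D x z)))
    ; ι = ι
    ; ι-inj = λ eq → pole-injective (same-class (cong proj₁ eq)) (cong proj₂ eq)
    ; ι-pres = ι-pres
    ; extend = λ p iso → φ p iso , injective⇒inverse V-finite (φ-injective p iso) , φ-pres p iso , φ-extends p iso
    })

theorem1p2 : (δ K : ℕ) → ((1 ≤ K × 2 * K ≤ δ) ⊎ K ≡ δ) → EPPA (InA δ K)
theorem1p2 δ K (inj₁ (1≤K , 2K≤δ)) A A∈ =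
  Main.witness {δ} {1} {K} (1∣ 2) (≤-trans (*-monoʳ-≤ 2 1≤K) 2K≤δ) (≤-trans (eq≤ (+-comm (2 * K) 1)) (s≤s 2K≤δ))
    (trivial-classes δ) A (NonBipartite.space 2K≤δ A A∈) {K} (NonBipartite.allowed 2K≤δ)
-- For `δ ≤ 2` the condition `g < δ` fails at `g = 2`: a central value could be 0, and distinct
-- points would collapse.
theorem1p2 0 K (inj₂ refl) A A∈ = Tiny.witness z≤n A A∈
theorem1p2 1 K (inj₂ refl) A A∈ = Tiny.witness (s≤s z≤n) A A∈
theorem1p2 2 K (inj₂ refl) A A∈ = FourCycle.witness A A∈
theorem1p2 δ@(suc (suc (suc _))) K (inj₂ refl) A A∈ =
  Main.witness {δ} {2} {0} ∣-refl (s≤s (s≤s (s≤s z≤n))) (s≤s (s≤s z≤n)) (parity-classes δ (s≤s z≤n)) A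
    (Bipartite.space A A∈) {δ} Bipartite.allowed
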